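{- There is an algorithm which, given a straight-line program of size $n$ generating a string $T$, finds the length of the minimal period of $T$ and computes a compressed representation of all periods of $T$, in time $O(n^3\log|T|)$.
   Context: A straight-line program (SLP) is a context-free grammar generating exactly one string, with nonterminals $X_1,\dots,X_k$, exactly one production for each nonterminal, and only productions of the two forms $X_i\to a$ (with $a$ a letter) and $X_i\to X_pX_q$ with $i>p$ and $i>q$. The string generated by the SLP is the string derived from its last nonterminal $X_k$. The size of an SLP is its number of productions. A period of a string $T$ is a string $W$ (and also the integer $|W|$) such that $T$ is a prefix of $W^k$ for some integer $k$. Periods considered here are prefixes of $T$, so each is uniquely determined by its length. A compressed representation of all periods is a list of arithmetical progressions, each encoded by three integers (first element, difference, number of elements), whose union is the set of lengths of all periods of $T$. Computational model: arithmetical operations on text positions and lengths (integers with at most about $\log|T|$ bits) are counted as unit-cost operations. The bound is understood for $|T|\ge 2$. -}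

module Defs where

open import Data.Bool using (Bool; true; false; not; _∧_; if_then_else_)
open import Data.Fin using (Fin; toℕ; fromℕ; fromℕ<)
import Data.Fin as Fin
open import Data.List using (List; []; _∷_; [_]; _++_; length; concat; concatMap; replicate)
open import Data.List.Relation.Binary.Prefix.Heterogeneous using (Prefix)
open import Data.List.Relation.Unary.Any using (Any)
open import Data.Nat using (ℕ; zero; suc; _+_; _*_; _∸_; _/_; _^_; _≤_; _<_; _<?_; _≡ᵇ_; _<ᵇ_)
open import Data.Product using (∃; _×_)
open import Data.Unit using (⊤)
open import Function using (_⇔_)
open import Relation.Binary.PropositionalEquality using (_≡_)
open import Relation.Nullary using (yes; no)

-- Letters are given by arbitrary natural-number codes.
Letter : Set
Letter = ℕ

data Production {n : ℕ} (i : Fin n) : Set where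
  letter : Letter → Production i
  pair   : (p q : Fin n) → p Fin.< i → q Fin.< i → Production i

-- The n nonterminals are numbered 0, …, n − 1.
SLP : ℕ → Set
SLP n = (i : Fin n) → Production i

-- G ⊢ i ⇒ w : the string w is derived from nonterminal i.
data _⊢_⇒_ {n : ℕ} (G : SLP n) (i : Fin n) : List Letter → Set where
  letter : ∀ {a} → G i ≡ letter a → G ⊢ i ⇒ [ a ]
  pair   : ∀ {p q p<i q<i u v} → G i ≡ pair p q p<i q<i →
           G ⊢ p ⇒ u → G ⊢ q ⇒ v → G ⊢ i ⇒ (u ++ v)

_Generates_ : ∀ {k} → SLP (suc k) → List Letter → Set
_Generates_ {k} G T = G ⊢ fromℕ k ⇒ T

IsPeriod : List Letter → List Letter → Set
IsPeriod W T = ∃ λ k → Prefix _≡_ T (concat (replicate k W))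

IsPeriodLength : ℕ → List Letter → Set
IsPeriodLength p T = ∃ λ W → length W ≡ p × Prefix _≡_ W T × IsPeriod W T

IsMinimalPeriodLength : ℕ → List Letter → Set
IsMinimalPeriodLength p T =
  IsPeriodLength p T × (∀ q → IsPeriodLength q T → p ≤ q)

record Progression : Set where
  constructor progression
  field
    first difference count : ℕ

open Progression public

_∈ᴾ_ : ℕ → Progression → Set
x ∈ᴾ π = ∃ λ j → j < count π × x ≡ first π + j * difference π

RepresentsPeriods : List Progression → List Letter → Set
RepresentsPeriods L T = ∀ p → Any (p ∈ᴾ_) L ⇔ IsPeriodLength p T

-- The computational model: structured programs for a random access machine
-- with finitely many registers, finitely many arrays (each program names its
-- registers and arrays by constants) and a write-only output tape.

infixl 20 _⟦_⟧

data Op : Set where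
  add sub mul div : Op

data Exp : Set where
  lit  : ℕ → Exp
  reg  : ℕ → Exp
  _⟦_⟧ : ℕ → Exp → Exp
  op   : Op → Exp → Exp → Exp

data Test : Set where
  eq lt : Exp → Exp → Test
  neg   : Test → Test
  and   : Test → Test → Test

infixr 10 _⨾_

data Program : Set where
  skip   : Program
  set    : ℕ → Exp → Program
  store  : ℕ → Exp → Exp → Program
  emit   : Exp → Program
  _⨾_    : Program → Program → Program
  branch : Test → Program → Program → Program
  while  : Test → Program → Program

record State : Set where
  constructor state
  field
    regs   : ℕ → ℕ
    arrays : ℕ → ℕ → ℕ
    output : List ℕ

open State public

update : {A : Set} → (ℕ → A) → ℕ → A → ℕ → A
update f i v j = if j ≡ᵇ i then v else f j

setReg : ℕ → ℕ → State → State
setReg x v s = record s { regs = update (regs s) x v }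

setCell : ℕ → ℕ → ℕ → State → State
setCell a i v s =
  record s { arrays = update (arrays s) a (update (arrays s a) i v) }

write : ℕ → State → State
write v s = record s { output = output s ++ [ v ] }

-- Subtraction is truncated at 0, and division by 0 yields 0.
applyOp : Op → ℕ → ℕ → ℕ
applyOp add m n       = m + n
applyOp sub m n       = m ∸ n
applyOp mul m n       = m * n
applyOp div m zero    = 0
applyOp div m (suc n) = m / suc n

eval : Exp → State → ℕ
eval (lit m)    s = m
eval (reg x)    s = regs s x
eval (a ⟦ e ⟧)  s = arrays s a (eval e s)
eval (op o e f) s = applyOp o (eval e s) (eval f s)

test : Test → State → Bool
test (eq e f)  s = eval e s ≡ᵇ eval f s
test (lt e f)  s = eval e s <ᵇ eval f s
test (neg b)   s = not (test b s)
test (and b c) s = test b s ∧ test c s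

-- The word-size restriction that justifies unit costs: operands and results
-- of arithmetical operations, and array indices, must not exceed B.  Letter
-- codes are exempt as long as they are only moved, compared or emitted, so
-- that B need not depend on the alphabet.

Fits : ℕ → Exp → State → Set
Fits B (lit m)    s = ⊤
Fits B (reg x)    s = ⊤
Fits B (a ⟦ e ⟧)  s = Fits B e s × eval e s ≤ B
Fits B (op o e f) s =
  Fits B e s × Fits B f s ×
  eval e s ≤ B × eval f s ≤ B × eval (op o e f) s ≤ B

FitsTest : ℕ → Test → State → Set
FitsTest B (eq e f)  s = Fits B e s × Fits B f s
FitsTest B (lt e f)  s = Fits B e s × Fits B f s
FitsTest B (neg b)   s = FitsTest B b s
FitsTest B (and b c) s = FitsTest B b s × FitsTest B c s

cost : Exp → ℕ
cost (lit m)    = 1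
cost (reg x)    = 1
cost (a ⟦ e ⟧)  = 1 + cost e
cost (op o e f) = 1 + cost e + cost f

costTest : Test → ℕ
costTest (eq e f)  = 1 + cost e + cost f
costTest (lt e f)  = 1 + cost e + cost f
costTest (neg b)   = 1 + costTest b
costTest (and b c) = 1 + costTest b + costTest c

-- B ⊢ P , s ⇓[ t ] s′ : started in s, the program P halts in s′ after t unit
-- cost steps, and no operation performed on the way violates the bound B.
data _⊢_,_⇓[_]_ (B : ℕ) : Program → State → ℕ → State → Set where

  skip : ∀ {s} → B ⊢ skip , s ⇓[ 1 ] s

  set : ∀ {x e s} → Fits B e s →
        B ⊢ set x e , s ⇓[ 1 + cost e ] setReg x (eval e s) s

  store : ∀ {a e f s} → Fits B e s → eval e s ≤ B → Fits B f s →
          B ⊢ store a e f , s ⇓[ 1 + cost e + cost f ]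
            setCell a (eval e s) (eval f s) s

  emit : ∀ {e s} → Fits B e s →
         B ⊢ emit e , s ⇓[ 1 + cost e ] write (eval e s) s

  seq : ∀ {P Q s s′ s″ t u} →
        B ⊢ P , s ⇓[ t ] s′ → B ⊢ Q , s′ ⇓[ u ] s″ →
        B ⊢ P ⨾ Q , s ⇓[ t + u ] s″

  branch-true : ∀ {b P Q s s′ t} → FitsTest B b s → test b s ≡ true →
                B ⊢ P , s ⇓[ t ] s′ →
                B ⊢ branch b P Q , s ⇓[ 1 + costTest b + t ] s′

  branch-false : ∀ {b P Q s s′ t} → FitsTest B b s → test b s ≡ false →
                 B ⊢ Q , s ⇓[ t ] s′ →
                 B ⊢ branch b P Q , s ⇓[ 1 + costTest b + t ] s′

  while-true : ∀ {b P s s′ s″ t u} → FitsTest B b s → test b s ≡ true →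
               B ⊢ P , s ⇓[ t ] s′ → B ⊢ while b P , s′ ⇓[ u ] s″ →
               B ⊢ while b P , s ⇓[ 1 + costTest b + t + u ] s″

  while-false : ∀ {b P s} → FitsTest B b s → test b s ≡ false →
                B ⊢ while b P , s ⇓[ 1 + costTest b ] s

-- The production of nonterminal i is stored as three numbers: 0, a, 0 for a
-- letter a and 1, p, q for a pair p q.

productionCode : ∀ {n} {i : Fin n} → Production i → ℕ → ℕ
productionCode (letter a)     1 = a
productionCode (pair p q _ _) 0 = 1
productionCode (pair p q _ _) 1 = toℕ p
productionCode (pair p q _ _) 2 = toℕ q
productionCode _              _ = 0

-- Cell i of array a, for a = 0, 1, 2, is component a of production i; all
-- other cells are 0.
inputArrays : ∀ {n} → SLP n → ℕ → ℕ → ℕ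
inputArrays {n} G a i with i <? n
... | yes i<n = productionCode (G (fromℕ< i<n)) a
... | no  _   = 0

-- Register 0 holds the size of the program.
initial : ∀ {n} → SLP n → State
initial {n} G = state (update (λ _ → 0) 0 n) (inputArrays G) []

encode : List Progression → List ℕ
encode = concatMap λ π → first π ∷ difference π ∷ count π ∷ []

-- Words of O(log |T| + log n) bits; the term log n is there because indices
-- of productions must fit into a word, and n may exceed every fixed power of
-- |T| (for instance when there are many unused nonterminals).
wordBound : (w n : ℕ) → List Letter → ℕ
wordBound w n T = (n + length T) ^ w

{-# OPTIONS --safe #-}
module Submission where

-- Let X, Y be the words of nonterminals x, y.  An overlap of (x, y) is a
-- length l such that the suffix of X of length l is a prefix of Y; if x → x₁ x₂,
-- consider also the occurrences of Y in X that cross the cut of X = X₁X₂.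
-- Cutting X and Y = Y₁Y₂ shows that for overlaps
--   l ≤ |X₂| or l ≤ |Y₁|:          overlap of (x₂, y) or of (x, y₁),
--   |X₂|, |Y₁| < l < |X₂| + |Y₁|:  Y₁ occurs across the cut of X and X₂ across
--                                  the cut of Y,
--   l ≥ |X₂| + |Y₁|:               l − |X₂| overlap of (x₁, y) and l − |Y₁|
--                                  overlap of (x, y₂),
-- while Y occurs across the cut of X with s letters in X₁ iff s is an overlap
-- of (x₁, y) and |Y| − s one of (y, x₂).  So everything about (x, y) is an
-- intersection of two sets that belong to pairs with a smaller x + y.
--
-- By the theorem of Fine and Wilf the overlaps in [2ᵗ, 2ᵗ⁺¹), and likewise all
-- crossing occurrences, form one arithmetical progression, whose difference is
-- the least period of a factor of X or Y.  If two progressions to be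
-- intersected have different differences d and e, their ranges therefore share
-- less than d + e, and the largest, the second largest and the least element of
-- the intersection are among three candidates, each tested in constant time.
-- This fills a table of O(n² log |T|) progressions in time
-- O(n² log² |T|) ≤ O(n³ log |T|), and the periods of T are the numbers |T| − l
-- for the overlaps l < |T| of T with itself, together with |T|.

-- Fine and Wilf enter twice. Within one scale, two differences counted from the largest overlap add
-- up to at most that overlap, so a common divisor of them is a period as well; this is why overlaps
-- are cut at powers of two. In an intersection, a common range of length d + e would exhibit a
-- factor having both least periods d and e, and a common divisor would extend to a smaller period
-- of one side.
--
-- In the third case the scales of l - |X₂| and l - |Y₁| are not both free: the two numbers add up
-- to at least l, so the larger has the scale of l or the next lower one. Crossing occurrences need
-- all pairs of scales, whence log² |T| per pair of nonterminals; one factor is absorbed by n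
-- because |T| < 2ⁿ.
--
-- Cells are filled by inserting candidates in any order. Two properties are kept apart: every cell
-- is sound at all times, and coverage of an element is never lost, so completeness is collected
-- pass by pass.
--
-- Nonterminals not reachable from the last one may generate words whose lengths overflow a machine
-- word, so reachability is computed first.

open import Data.Bool using (Bool; true; false; not; _∧_; if_then_else_; T)
open import Data.Empty using (⊥; ⊥-elim)
open import Data.Fin using (Fin; toℕ; fromℕ; fromℕ<)
open import Data.Fin.Properties using (toℕ-fromℕ<; fromℕ<-toℕ; toℕ<n; toℕ-fromℕ)
open import Data.List using (List; []; _∷_; [_]; _++_; length; map; concat; replicate; take)
open import Data.List.Properties using (length-++; length-take; ++-assoc; concatMap-++)
open import Data.List.Relation.Unary.Any using (Any; here)
open import Data.List.Relation.Unary.Any.Properties using (++⁺ˡ; ++⁺ʳ; ++⁻)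
open import Data.Maybe using (Maybe; just; nothing)
open import Data.Nat
open import Data.Nat.Divisibility using (_∣_; divides; ∣-refl; ∣m∣n⇒∣m+n; ∣⇒≤; _∣0)
open import Data.Nat.DivMod using (m/n*n≤m; m/n≤m; m*n/n≡m; /-monoˡ-≤)
open import Data.Nat.Logarithm using (⌊log₂_⌋; ⌊log₂⌋-mono-≤; ⌊log₂[2*b]⌋≡1+⌊log₂b⌋; ⌊log₂[2^n]⌋≡n)
open import Data.Nat.Properties
open import Data.Nat.Tactic.RingSolver using (solve-∀)
open import Data.Product using (∃; _×_; _,_; proj₁; proj₂)
open import Data.Sum using (_⊎_; inj₁; inj₂)
open import Data.Unit using (⊤; tt)
open import Function using (mk⇔)
open import Relation.Binary.Definitions using (tri<; tri≈; tri>)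
open import Relation.Binary.PropositionalEquality hiding ([_])
open import Relation.Nullary using (yes; no; ¬_)
open import Relation.Nullary.Reflects using (Reflects; ofʸ; ofⁿ; fromEquivalence)

-- Linear arithmetic over ℕ

module LinearArithmetic where
  open import Data.Integer using (ℤ; +_; -[1+_]; ∣_∣)
  import Data.Integer as ℤ
  open import Data.Vec using (Vec; []; _∷_; lookup)

  infixl 6 _⊕_
  infixl 7 _⊛_
  infix 4 _≼_ _≺_ _≐_
  infix 3 _⊢ˡ_

  data Lin (n : ℕ) : Set where
    var : Fin n → Lin n
    con : ℕ → Lin n
    _⊕_ : Lin n → Lin n → Lin n
    _⊛_ : ℕ → Lin n → Lin n

  data Fact (n : ℕ) : Set where
    _≼_ _≺_ _≐_ : Lin n → Lin n → Fact n
    absurd : Fact n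

  record Problem (n : ℕ) : Set where
    constructor _⊢ˡ_
    field
      hyps : List (Fact n)
      goal : Fact n

  ⟦_⟧ˡ : ∀ {n} → Lin n → Vec ℕ n → ℕ
  ⟦ var i ⟧ˡ ρ = lookup ρ i
  ⟦ con k ⟧ˡ ρ = k
  ⟦ e ⊕ f ⟧ˡ ρ = ⟦ e ⟧ˡ ρ + ⟦ f ⟧ˡ ρ
  ⟦ k ⊛ e ⟧ˡ ρ = k * ⟦ e ⟧ˡ ρ

  ⟦_⟧ᶠ : ∀ {n} → Fact n → Vec ℕ n → Set
  ⟦ e ≼ f ⟧ᶠ ρ = ⟦ e ⟧ˡ ρ ≤ ⟦ f ⟧ˡ ρ
  ⟦ e ≺ f ⟧ᶠ ρ = ⟦ e ⟧ˡ ρ < ⟦ f ⟧ˡ ρ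
  ⟦ e ≐ f ⟧ᶠ ρ = ⟦ e ⟧ˡ ρ ≡ ⟦ f ⟧ˡ ρ
  ⟦ absurd ⟧ᶠ ρ = ⊥

  Form : Set
  Form = ℕ × List ℕ

  evalCoeffs : ∀ {n} → List ℕ → Vec ℕ n → ℕ
  evalCoeffs []       ρ       = 0
  evalCoeffs (c ∷ cs) []      = 0
  evalCoeffs (c ∷ cs) (x ∷ ρ) = c * x + evalCoeffs cs ρ

  evalForm : ∀ {n} → Form → Vec ℕ n → ℕ
  evalForm (k , cs) ρ = k + evalCoeffs cs ρ

  unit : ∀ {n} → Fin n → List ℕ
  unit Fin.zero    = 1 ∷ []
  unit (Fin.suc i) = 0 ∷ unit i

  addCoeffs : List ℕ → List ℕ → List ℕ
  addCoeffs []       ds       = ds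
  addCoeffs (c ∷ cs) []       = c ∷ cs
  addCoeffs (c ∷ cs) (d ∷ ds) = c + d ∷ addCoeffs cs ds

  scaleCoeffs : ℕ → List ℕ → List ℕ
  scaleCoeffs k = map (k *_)

  addForm : Form → Form → Form
  addForm (k , cs) (l , ds) = k + l , addCoeffs cs ds

  scaleForm : ℕ → Form → Form
  scaleForm m (k , cs) = m * k , scaleCoeffs m cs

  norm : ∀ {n} → Lin n → Form
  norm (var i) = 0 , unit i
  norm (con k) = k , []
  norm (e ⊕ f) = addForm (norm e) (norm f)
  norm (k ⊛ e) = scaleForm k (norm e)

  evalCoeffs-unit : ∀ {n} (i : Fin n) ρ → evalCoeffs (unit i) ρ ≡ lookup ρ i
  evalCoeffs-unit Fin.zero    (x ∷ ρ) = trans (+-identityʳ _) (*-identityˡ x)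
  evalCoeffs-unit (Fin.suc i) (x ∷ ρ) = evalCoeffs-unit i ρ

  evalCoeffs-add : ∀ {n} cs ds (ρ : Vec ℕ n) →
    evalCoeffs (addCoeffs cs ds) ρ ≡ evalCoeffs cs ρ + evalCoeffs ds ρ
  evalCoeffs-add []       ds       ρ       = refl
  evalCoeffs-add (c ∷ cs) []       ρ       = sym (+-identityʳ _)
  evalCoeffs-add (c ∷ cs) (d ∷ ds) []      = refl
  evalCoeffs-add (c ∷ cs) (d ∷ ds) (x ∷ ρ) =
    trans (cong (_+_ ((c + d) * x)) (evalCoeffs-add cs ds ρ))
          (rearrange c d x (evalCoeffs cs ρ) (evalCoeffs ds ρ))
    where
    rearrange : ∀ c d x u v → (c + d) * x + (u + v) ≡ c * x + u + (d * x + v)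
    rearrange = solve-∀

  evalCoeffs-scale : ∀ {n} k cs (ρ : Vec ℕ n) →
    evalCoeffs (scaleCoeffs k cs) ρ ≡ k * evalCoeffs cs ρ
  evalCoeffs-scale k []       ρ       = sym (*-zeroʳ k)
  evalCoeffs-scale k (c ∷ cs) []      = sym (*-zeroʳ k)
  evalCoeffs-scale k (c ∷ cs) (x ∷ ρ) =
    trans (cong (_+_ (k * c * x)) (evalCoeffs-scale k cs ρ))
          (rearrange k c x (evalCoeffs cs ρ))
    where
    rearrange : ∀ k c x u → k * c * x + k * u ≡ k * (c * x + u)
    rearrange = solve-∀

  evalForm-add : ∀ {n} u v (ρ : Vec ℕ n) → evalForm (addForm u v) ρ ≡ evalForm u ρ + evalForm v ρ
  evalForm-add (k , cs) (l , ds) ρ =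
    trans (cong (_+_ (k + l)) (evalCoeffs-add cs ds ρ)) (rearrange k l (evalCoeffs cs ρ) (evalCoeffs ds ρ))
    where
    rearrange : ∀ k l u v → k + l + (u + v) ≡ k + u + (l + v)
    rearrange = solve-∀

  evalForm-scale : ∀ {n} m u (ρ : Vec ℕ n) → evalForm (scaleForm m u) ρ ≡ m * evalForm u ρ
  evalForm-scale m (k , cs) ρ =
    trans (cong (_+_ (m * k)) (evalCoeffs-scale m cs ρ)) (sym (*-distribˡ-+ m k _))

  evalForm-norm : ∀ {n} (e : Lin n) ρ → evalForm (norm e) ρ ≡ ⟦ e ⟧ˡ ρ
  evalForm-norm (var i) ρ = evalCoeffs-unit i ρ
  evalForm-norm (con k) ρ = +-identityʳ k
  evalForm-norm (e ⊕ f) ρ =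
    trans (evalForm-add (norm e) (norm f) ρ) (cong₂ _+_ (evalForm-norm e ρ) (evalForm-norm f ρ))
  evalForm-norm (k ⊛ e) ρ =
    trans (evalForm-scale k (norm e) ρ) (cong (k *_) (evalForm-norm e ρ))

  -- A row (l , r) stands for l ≤ r. Both sides keep natural coefficients, so a certificate is
  -- checked without subtraction.
  Row : Set
  Row = Form × Form

  Holds : ∀ {n} → Row → Vec ℕ n → Set
  Holds (l , r) ρ = evalForm l ρ ≤ evalForm r ρ

  rowsOf : ∀ {n} → Fact n → List Row
  rowsOf (e ≼ f) = [ norm e , norm f ]
  rowsOf (e ≺ f) = [ norm (con 1 ⊕ e) , norm f ]
  rowsOf (e ≐ f) = (norm e , norm f) ∷ (norm f , norm e) ∷ []
  rowsOf absurd  = []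

  data AllHold {n} (ρ : Vec ℕ n) : List Row → Set where
    []  : AllHold ρ []
    _∷_ : ∀ {r rs} → Holds r ρ → AllHold ρ rs → AllHold ρ (r ∷ rs)

  allHold-++ : ∀ {n} {ρ : Vec ℕ n} {rs ss} → AllHold ρ rs → AllHold ρ ss → AllHold ρ (rs ++ ss)
  allHold-++ []       qs = qs
  allHold-++ (p ∷ ps) qs = p ∷ allHold-++ ps qs

  normMono : ∀ {n} (e f : Lin n) ρ → ⟦ e ⟧ˡ ρ ≤ ⟦ f ⟧ˡ ρ → Holds (norm e , norm f) ρ
  normMono e f ρ = subst₂ _≤_ (sym (evalForm-norm e ρ)) (sym (evalForm-norm f ρ))

  rowsOf-hold : ∀ {n} (φ : Fact n) ρ → ⟦ φ ⟧ᶠ ρ → AllHold ρ (rowsOf φ)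
  rowsOf-hold (e ≼ f) ρ p = normMono e f ρ p ∷ []
  rowsOf-hold (e ≺ f) ρ p = normMono (con 1 ⊕ e) f ρ p ∷ []
  rowsOf-hold (e ≐ f) ρ p = normMono e f ρ (≤-reflexive p) ∷ normMono f e ρ (≤-reflexive (sym p)) ∷ []

  -- Surplus multipliers or rows count with multiplier 0, so every list of multipliers, good or bad,
  -- yields a valid row.
  combine : List ℕ → List Row → Row
  combine []       rs             = (0 , []) , (0 , [])
  combine (m ∷ ms) []             = (0 , []) , (0 , [])
  combine (m ∷ ms) ((l , r) ∷ rs) =
    let (l′ , r′) = combine ms rs in addForm (scaleForm m l) l′ , addForm (scaleForm m r) r′

  combine-holds : ∀ {n} {ρ : Vec ℕ n} ms {rs} → AllHold ρ rs → Holds (combine ms rs) ρ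
  combine-holds []       ps = ≤-refl
  combine-holds (m ∷ ms) [] = ≤-refl
  combine-holds {ρ = ρ} (m ∷ ms) {(l , r) ∷ rs} (p ∷ ps) =
    subst₂ _≤_ (sym (eval-combination l (proj₁ (combine ms rs))))
               (sym (eval-combination r (proj₂ (combine ms rs))))
               (+-mono-≤ (*-monoʳ-≤ m p) (combine-holds ms ps))
    where
    eval-combination : ∀ u v → evalForm (addForm (scaleForm m u) v) ρ ≡ m * evalForm u ρ + evalForm v ρ
    eval-combination u v =
      trans (evalForm-add (scaleForm m u) v ρ) (cong (_+ evalForm v ρ) (evalForm-scale m u ρ))

  -- Missing entries count as 0.
  belowCoeffs : List ℕ → List ℕ → Bool
  belowCoeffs []       ds       = true
  belowCoeffs (c ∷ cs) []       = (c ≡ᵇ 0) ∧ belowCoeffs cs []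
  belowCoeffs (c ∷ cs) (d ∷ ds) = (c ≤ᵇ d) ∧ belowCoeffs cs ds

  -- The constant is larger on the left and no coefficient is smaller there, so the row fails for
  -- every valuation in ℕ. Comparing coefficients by ≤ makes implicit use of the nonnegativity of
  -- the variables.
  contradictory : Row → Bool
  contradictory ((k , cs) , (l , ds)) = (l <ᵇ k) ∧ belowCoeffs ds cs

  T-∧ : ∀ {a b} → T (a ∧ b) → T a × T b
  T-∧ {true} {true} _ = tt , tt

  below-sound : ∀ {n} cs ds (ρ : Vec ℕ n) → T (belowCoeffs cs ds) → evalCoeffs cs ρ ≤ evalCoeffs ds ρ
  below-sound []       ds       ρ       t = z≤n
  below-sound (c ∷ cs) ds       []      t = z≤n
  below-sound (c ∷ cs) []       (x ∷ ρ) t with T-∧ {c ≡ᵇ 0} t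
  ... | p , q rewrite ≡ᵇ⇒≡ c 0 p = below-sound cs [] ρ q
  below-sound (c ∷ cs) (d ∷ ds) (x ∷ ρ) t with T-∧ {c ≤ᵇ d} t
  ... | p , q = +-mono-≤ (*-monoˡ-≤ x (≤ᵇ⇒≤ c d p)) (below-sound cs ds ρ q)

  contradictory-sound : ∀ {n} r (ρ : Vec ℕ n) → T (contradictory r) → Holds r ρ → ⊥
  contradictory-sound ((k , cs) , (l , ds)) ρ t p with T-∧ {l <ᵇ k} t
  ... | q , b = <⇒≱ (+-mono-<-≤ (<ᵇ⇒< l k q) (below-sound ds cs ρ b)) p

  -- Equations are used first, to substitute for variables; the rest is
  -- Fourier–Motzkin elimination.  Every derived fact const + coeffs ≥ 0 (or
  -- = 0) carries the multipliers that produce it from the hypotheses.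
  module Search where
    record Derived : Set where
      constructor derived
      field
        multipliers : List ℤ
        const       : ℤ
        coeffs      : List ℤ
    open Derived

    diffs : ℕ → List ℕ → List ℕ → List ℤ
    diffs zero    _        _        = []
    diffs (suc n) []       []       = + 0 ∷ diffs n [] []
    diffs (suc n) (c ∷ cs) []       = ℤ.- + c ∷ diffs n cs []
    diffs (suc n) []       (d ∷ ds) = + d ∷ diffs n [] ds
    diffs (suc n) (c ∷ cs) (d ∷ ds) = (d ℤ.⊖ c) ∷ diffs n cs ds

    tag : ℕ → List ℤ
    tag zero    = + 1 ∷ []
    tag (suc i) = + 0 ∷ tag i

    initially : ℕ → ℕ → Row → Derived
    initially n i ((k , cs) , (l , ds)) = derived (tag i) (l ℤ.⊖ k) (diffs n cs ds)

    equations inequalities : ∀ {n} → ℕ → List (Fact n) → List Derived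
    equations         i []             = []
    equations {n = n} i ((e ≐ f) ∷ φs) = initially n i (norm e , norm f) ∷ equations (suc i) φs
    equations         i (_ ∷ φs)       = equations (suc i) φs
    inequalities         i []             = []
    inequalities {n = n} i ((e ≼ f) ∷ φs) = initially n i (norm e , norm f) ∷ inequalities (suc i) φs
    inequalities {n = n} i ((e ≺ f) ∷ φs) = initially n i (norm (con 1 ⊕ e) , norm f) ∷
        inequalities (suc i) φs
    inequalities         i (_ ∷ φs)       = inequalities (suc i) φs

    unitℤ : ℕ → ℕ → List ℤ
    unitℤ zero    i       = []
    -- Index n lies outside a vector of length n, so the tail consists of zeros.
    unitℤ (suc n) zero    = + 1 ∷ unitℤ n n
    unitℤ (suc n) (suc i) = + 0 ∷ unitℤ n i

    -- These facts carry no multipliers: they are no hypotheses, and the final check supplies them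
    -- through its coefficientwise comparison.
    nonneg : ℕ → ℕ → List Derived
    nonneg n zero    = []
    nonneg n (suc i) = derived [] (+ 0) (unitℤ n i) ∷ nonneg n i

    at : ℕ → List ℤ → ℤ
    at i       []       = + 0
    at zero    (c ∷ cs) = c
    at (suc i) (c ∷ cs) = at i cs

    remove : ℕ → List ℤ → List ℤ
    remove i       []       = []
    remove zero    (c ∷ cs) = cs
    remove (suc i) (c ∷ cs) = c ∷ remove i cs

    drop : ℕ → Derived → Derived
    drop i (derived ms k cs) = derived ms k (remove i cs)

    plusℤ : ℤ → List ℤ → ℤ → List ℤ → List ℤ
    plusℤ a []       b ds       = map (b ℤ.*_) ds
    plusℤ a (c ∷ cs) b []       = map (a ℤ.*_) (c ∷ cs)
    plusℤ a (c ∷ cs) b (d ∷ ds) = (a ℤ.* c ℤ.+ b ℤ.* d) ∷ plusℤ a cs b ds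

    plus : ℤ → Derived → ℤ → Derived → Derived
    plus a (derived ms k cs) b (derived ns l ds) =
      derived (plusℤ a ms b ns) (a ℤ.* k ℤ.+ b ℤ.* l) (plusℤ a cs b ds)

    data Sign : Set where pos neg nil : Sign

    sign : ℤ → Sign
    sign (+ zero)  = nil
    sign (+ suc _) = pos
    sign -[1+ _ ]  = neg

    -- The multiplier of `r` is never negative, so an inequality `r` remains one. That of `e` may be
    -- negative, which an equation allows; in `pairs` the coefficients of `e` and `r` are positive
    -- and negative, and both multipliers are positive.
    substitute : ℕ → Derived → Derived → Derived
    substitute i e r with at i (coeffs e)
    ... | + c       = drop i (plus (+ c) r (ℤ.- at i (coeffs r)) e)
    ... | -[1+ c ]  = drop i (plus (+ suc c) r (at i (coeffs r)) e)

    split : ℕ → List Derived → List Derived × List Derived × List Derived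
    split i []       = [] , [] , []
    split i (r ∷ rs) with sign (at i (coeffs r)) | split i rs
    ... | pos | ps , ns , zs = r ∷ ps , ns , zs
    ... | neg | ps , ns , zs = ps , r ∷ ns , zs
    ... | nil | ps , ns , zs = ps , ns , drop i r ∷ zs

    pairs : ℕ → List Derived → List Derived → List Derived → List Derived
    pairs i []       ns zs = zs
    pairs i (p ∷ ps) ns zs = map (λ n → substitute i p n) ns ++ pairs i ps ns zs

    price : ℕ → List Derived → ℕ
    price i rs with split i rs
    ... | ps , ns , _ = length ps * length ns

    cheapest : ℕ → List Derived → ℕ × ℕ
    cheapest zero    rs = 0 , price 0 rs
    cheapest (suc i) rs with cheapest i rs
    ... | j , c = let d = price (suc i) rs in if d <ᵇ c then (suc i , d) else (j , c)

    isNeg : ℤ → Bool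
    isNeg (+ _)    = false
    isNeg -[1+ _ ] = true

    refute : List Derived → List ℤ
    refute []       = []
    refute (r ∷ rs) = if isNeg (const r) then multipliers r else refute rs

    pivot : List ℤ → ℕ
    pivot []           = 0
    pivot (+ 0 ∷ cs)   = suc (pivot cs)
    pivot (_ ∷ cs)     = 0

    eliminate : ℕ → List Derived → List ℤ
    eliminate zero    rs = refute rs
    eliminate (suc n) rs with cheapest n rs
    ... | i , _ with split i rs
    ...   | ps , ns , zs = eliminate n (pairs i ps ns zs)

    substituteAll : ℕ → ℕ → List Derived → List Derived → List ℤ
    substituteAll zero    n es       rs = eliminate n rs
    substituteAll (suc k) n []       rs = eliminate n rs
    substituteAll (suc k) n (e ∷ es) rs with pivot (coeffs e)
    ... | i = if i <ᵇ n
              then substituteAll k (n ∸ 1) (map (substitute i e) es) (map (substitute i e) rs)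
              -- An equation without variables only restricts its constant; it is kept as two
              -- inequalities, itself and its negative.
              else substituteAll k n es (e ∷ plus (+ 0) e (ℤ.- + 1) e ∷ rs)

    positive negative : ℤ → ℕ
    positive (+ k)    = k
    positive -[1+ _ ] = 0
    negative (+ k)    = 0
    negative -[1+ k ] = suc k

    -- An equation contributes two opposite rows, so a negative integer multiplier becomes a natural
    -- multiplier of the reversed row.
    distribute : ∀ {n} → List (Fact n) → List ℤ → List ℕ
    distribute []               ms       = []
    distribute (φ ∷ φs)         []       = []
    distribute ((_ ≐ _) ∷ φs)   (m ∷ ms) = positive m ∷ negative m ∷ distribute φs ms
    distribute (absurd ∷ φs)    (m ∷ ms) = distribute φs ms
    distribute (_ ∷ φs)         (m ∷ ms) = positive m ∷ distribute φs ms

  rowsOfAll : ∀ {n} → List (Fact n) → List Row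
  rowsOfAll []       = []
  rowsOfAll (φ ∷ φs) = rowsOf φ ++ rowsOfAll φs

  certificate : ∀ {n} → List (Fact n) → List ℕ
  certificate {n} φs = distribute φs
    (substituteAll (length φs) n (equations 0 φs) (inequalities 0 φs ++ nonneg n n))
    where open Search

  -- Soundness rests on this check alone. The search behind `certificate` is unverified, and a wrong
  -- answer of it merely makes the check fail.
  inconsistent : ∀ {n} → List (Fact n) → Bool
  inconsistent φs = contradictory (combine (certificate φs) (rowsOfAll φs))

  inconsistent-sound : ∀ {n} (φs : List (Fact n)) (ρ : Vec ℕ n) → T (inconsistent φs) →
      AllHold ρ (rowsOfAll φs) → ⊥
  inconsistent-sound φs ρ t ps =
    contradictory-sound (combine (certificate φs) (rowsOfAll φs)) ρ t
      (combine-holds (certificate φs) {rowsOfAll φs} ps)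

  decide : ∀ {n} → List (Fact n) → Fact n → Bool
  decide φs (e ≼ f) = inconsistent ((f ≺ e) ∷ φs)
  decide φs (e ≺ f) = inconsistent ((f ≼ e) ∷ φs)
  decide φs (e ≐ f) = inconsistent ((f ≺ e) ∷ φs) ∧ inconsistent ((e ≺ f) ∷ φs)
  decide φs absurd  = inconsistent φs

  decide-≼ : ∀ {n} φs (e f : Lin n) (ρ : Vec ℕ n) → AllHold ρ (rowsOfAll φs) →
             T (inconsistent ((f ≺ e) ∷ φs)) → ⟦ e ⟧ˡ ρ ≤ ⟦ f ⟧ˡ ρ
  decide-≼ φs e f ρ ps t =
    ≮⇒≥ λ q → inconsistent-sound ((f ≺ e) ∷ φs) ρ t (allHold-++ (rowsOf-hold (f ≺ e) ρ q) ps)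

  decide-sound : ∀ {n} φs (φ : Fact n) (ρ : Vec ℕ n) → AllHold ρ (rowsOfAll φs) → T (decide φs φ) → ⟦ φ ⟧ᶠ ρ
  decide-sound φs (e ≼ f) ρ ps t = decide-≼ φs e f ρ ps t
  decide-sound φs (e ≺ f) ρ ps t =
    ≰⇒> λ q → inconsistent-sound ((f ≼ e) ∷ φs) ρ t (allHold-++ (rowsOf-hold (f ≼ e) ρ q) ps)
  decide-sound φs (e ≐ f) ρ ps t with T-∧ {inconsistent ((f ≺ e) ∷ φs)} t
  ... | t₁ , t₂ = ≤-antisym (decide-≼ φs e f ρ ps t₁) (decide-≼ φs f e ρ ps t₂)
  decide-sound φs absurd ρ ps t = inconsistent-sound φs ρ t ps

  Curried : ∀ {n} → List (Fact n) → Set → Vec ℕ n → Set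
  Curried []       A ρ = A
  Curried (ψ ∷ ψs) A ρ = ⟦ ψ ⟧ᶠ ρ → Curried ψs A ρ

  curryRows : ∀ {n} ψs {A : Set} (ρ : Vec ℕ n) → (AllHold ρ (rowsOfAll ψs) → A) → Curried ψs A ρ
  curryRows []       ρ f   = f []
  curryRows (ψ ∷ ψs) ρ f p = curryRows ψs ρ (λ ps → f (allHold-++ (rowsOf-hold ψ ρ p) ps))

  Template : ℕ → ℕ → Set
  Template n zero    = Problem n
  Template n (suc m) = Lin n → Template n m

  instantiate : ∀ n m → (Fin m → Fin n) → Template n m → Problem n
  instantiate n zero    ι f = f
  instantiate n (suc m) ι f = instantiate n m (λ i → ι (Fin.suc i)) (f (var (ι Fin.zero)))

  ForAll : ∀ n → (Vec ℕ n → Set) → Set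
  ForAll zero    A = A []
  ForAll (suc n) A = ∀ x → ForAll n (λ ρ → A (x ∷ ρ))

  generalize : ∀ n {A : Vec ℕ n → Set} → (∀ ρ → A ρ) → ForAll n A
  generalize zero    f = f []
  generalize (suc n) f x = generalize n (λ ρ → f (x ∷ ρ))

  abstract
    -- The implicit argument is `T` of a closed Boolean. Type checking runs the search, and on
    -- success the argument is of unit type and fills itself in.
    lia : ∀ n (f : Template n n) →
          let p = instantiate n n (λ i → i) f in
          {T (decide (Problem.hyps p) (Problem.goal p))} →
          ForAll n (λ ρ → Curried (Problem.hyps p) (⟦ Problem.goal p ⟧ᶠ ρ) ρ)
    lia n f {t} = generalize n (λ ρ → curryRows hyps ρ (λ ps → decide-sound hyps goal ρ ps t))
      where open Problem (instantiate n n (λ i → i) f)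

open LinearArithmetic using (lia; _⊕_; _⊛_; con; _≼_; _≺_; _≐_; absurd; _⊢ˡ_)

-- Periods of words given by position functions

Per : (ℕ → ℕ) → ℕ → ℕ → ℕ → Set
Per f a b p = ∀ z → a ≤ z → z + p < b → f z ≡ f (z + p)

-- One step of Euclid's algorithm: r is reached by going back p and forward p + r, or in the
-- opposite order. The length hypothesis ensures that one of the two routes stays inside the factor.
per-difference : ∀ {f a b p r} → a + p + (p + r) ≤ b → Per f a b p → Per f a b (p + r) → Per f a b r
per-difference {f} {a} {b} {p} {r} long P Q z a≤z z+r<b with a + p ≤? z
... | yes a+p≤z = begin
    f z               ≡⟨ cong f w+p≡z ⟨
    f (w + p)         ≡⟨ P w a≤w (lia 5 (λ w p z r b → (w ⊕ p ≐ z) ∷ (z ⊕ r ≺ b) ∷ [] ⊢ˡ w ⊕ p ≺ b) w p z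
        r b w+p≡z z+r<b) ⟨
    f w               ≡⟨ Q w a≤w (lia 5 (λ w p z r b → (w ⊕ p ≐ z) ∷ (z ⊕ r ≺ b) ∷ [] ⊢ˡ w ⊕ (p ⊕ r) ≺ b) w p
        z r b w+p≡z z+r<b) ⟩
    f (w + (p + r))   ≡⟨ cong f (trans (sym (+-assoc w p r)) (cong (_+ r) w+p≡z)) ⟩
    f (z + r)         ∎
  where
  open ≡-Reasoning
  w = z ∸ p
  w+p≡z : w + p ≡ z
  w+p≡z = m∸n+n≡m (m+n≤o⇒n≤o a a+p≤z)
  a≤w : a ≤ w
  a≤w = lia 4 (λ a p z w → (a ⊕ p ≼ z) ∷ (w ⊕ p ≐ z) ∷ [] ⊢ˡ a ≼ w) a p z w a+p≤z w+p≡z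
... | no a+p≰z = begin
    f z               ≡⟨ Q z a≤z (lia 5 (λ a p z r b → (z ≺ a ⊕ p) ∷ (a ⊕ p ⊕ (p ⊕ r) ≼ b) ∷ [] ⊢ˡ
        z ⊕ (p ⊕ r) ≺ b) a p z r b (≰⇒> a+p≰z) long) ⟩
    f (z + (p + r))   ≡⟨ cong f (lia 3 (λ z p r → [] ⊢ˡ z ⊕ (p ⊕ r) ≐ z ⊕ r ⊕ p) z p r) ⟩
    f (z + r + p)     ≡⟨ P (z + r) (m≤n⇒m≤n+o r a≤z)
        (lia 5 (λ a p z r b → (z ≺ a ⊕ p) ∷ (a ⊕ p ⊕ (p ⊕ r) ≼ b) ∷ [] ⊢ˡ z ⊕ r ⊕ p ≺ b) a p z r b
        (≰⇒> a+p≰z) long) ⟨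
    f (z + r)         ∎
  where open ≡-Reasoning

-- Subtractive Euclid, with k bounding p + q for termination. A factor of length p + q remains long
-- enough after the larger period is replaced by the difference.
fine-wilf′ : ∀ k {f a b p q} → p + q ≤ k → 0 < p → 0 < q → a + p + q ≤ b → Per f a b p → Per f a b q →
             ∃ λ g → 0 < g × g ∣ p × g ∣ q × Per f a b g
fine-wilf′ k {p = p} {q} size 0<p 0<q long P Q with <-cmp p q
fine-wilf′ k {p = p} {q} size 0<p 0<q long P Q | tri≈ _ refl _ = p , 0<p , ∣-refl , ∣-refl , P
fine-wilf′ (suc k) {f} {a} {b} {p} {q} size 0<p 0<q long P Q | tri< p<q _ _
  with q ∸ p | m+[n∸m]≡n (<⇒≤ p<q)
... | r | refl
  with fine-wilf′ k {f} {a} {b} {p} {r}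
         (lia 3 (λ k p r → (con 0 ≺ p) ∷ (p ⊕ (p ⊕ r) ≼ con 1 ⊕ k) ∷ [] ⊢ˡ p ⊕ r ≼ k) k p r 0<p size)
         0<p (lia 2 (λ p r → (p ≺ p ⊕ r) ∷ [] ⊢ˡ con 0 ≺ r) p r p<q)
         (lia 4 (λ a b p r → (a ⊕ p ⊕ (p ⊕ r) ≼ b) ∷ [] ⊢ˡ a ⊕ p ⊕ r ≼ b) a b p r long)
         P (per-difference {f} {a} {b} {p} {r} long P Q)
... | g , 0<g , g∣p , g∣r , R = g , 0<g , g∣p , ∣m∣n⇒∣m+n g∣p g∣r , R
fine-wilf′ zero {p = p} {q} size 0<p 0<q long P Q | tri< p<q _ _ =
  ⊥-elim (lia 2 (λ p q → (p ⊕ q ≼ con 0) ∷ (p ≺ q) ∷ [] ⊢ˡ absurd) p q size p<q)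
fine-wilf′ (suc k) {f} {a} {b} {p} {q} size 0<p 0<q long P Q | tri> _ _ q<p
  with p ∸ q | m+[n∸m]≡n (<⇒≤ q<p)
... | r | refl
  with fine-wilf′ k {f} {a} {b} {q} {r}
         (lia 3 (λ k p r → (con 0 ≺ p) ∷ (p ⊕ r ⊕ p ≼ con 1 ⊕ k) ∷ [] ⊢ˡ p ⊕ r ≼ k) k q r 0<q size)
         0<q (lia 2 (λ p r → (p ≺ p ⊕ r) ∷ [] ⊢ˡ con 0 ≺ r) q r q<p)
         (lia 4 (λ a b p r → (a ⊕ (p ⊕ r) ⊕ p ≼ b) ∷ [] ⊢ˡ a ⊕ p ⊕ r ≼ b) a b q r long)
         Q (per-difference {f} {a} {b} {q} {r}
             (lia 4 (λ a b p r → (a ⊕ (p ⊕ r) ⊕ p ≼ b) ∷ [] ⊢ˡ a ⊕ p ⊕ (p ⊕ r) ≼ b) a b q r long) Q P)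
... | g , 0<g , g∣q , g∣r , R = g , 0<g , ∣m∣n⇒∣m+n g∣q g∣r , g∣q , R
fine-wilf′ zero {p = p} {q} size 0<p 0<q long P Q | tri> _ _ q<p =
  ⊥-elim (lia 2 (λ p q → (p ⊕ q ≼ con 0) ∷ (q ≺ p) ∷ [] ⊢ˡ absurd) p q size q<p)

fine-wilf : ∀ {f a b p q} → 0 < p → 0 < q → a + p + q ≤ b → Per f a b p → Per f a b q →
            ∃ λ g → 0 < g × g ∣ p × g ∣ q × Per f a b g
fine-wilf {f} {a} {b} {p} {q} = fine-wilf′ (p + q) {f} {a} {b} {p} {q} ≤-refl

per-restrict : ∀ {f a b c e p} → a ≤ c → e ≤ b → Per f a b p → Per f c e p
per-restrict a≤c e≤b P z c≤z z+p<e = P z (≤-trans a≤c c≤z) (<-≤-trans z+p<e e≤b)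

-- Positions beyond the window are moved back by multiples of p until both z and z + g fall into it;
-- k bounds z.
per-extendʳ : ∀ {f a b c e p g} → 0 < p → a ≤ c → c + p + g ≤ e →
              Per f a b p → Per f c e g → ∀ k z → z ≤ k → c ≤ z → z + g < b → f z ≡ f (z + g)
per-extendʳ {f} {a} {b} {c} {e} {p} {g} 0<p a≤c long P R k z z≤k c≤z z+g<b with z + g <? e
... | yes z+g<e = R z c≤z z+g<e
per-extendʳ {f} {a} {b} {c} {e} {p} {g} 0<p a≤c long P R zero z z≤0 c≤z z+g<b | no z+g≮e =
  ⊥-elim (lia 5 (λ c e p g z → (con 0 ≺ p) ∷ (c ⊕ p ⊕ g ≼ e) ∷ (z ≼ con 0) ∷ (e ≼ z ⊕ g) ∷ [] ⊢ˡ absurd) c e p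
      g z 0<p long z≤0 (≮⇒≥ z+g≮e))
per-extendʳ {f} {a} {b} {c} {e} {p} {g} 0<p a≤c long P R (suc k) z z≤k c≤z z+g<b | no z+g≮e = begin
    f z           ≡⟨ cong f w+p≡z ⟨
    f (w + p)     ≡⟨ P w (≤-trans a≤c c≤w) (lia 5 (λ w p z g b → (w ⊕ p ≐ z) ∷ (z ⊕ g ≺ b) ∷ [] ⊢ˡ w ⊕ p ≺ b)
        w p z g b w+p≡z z+g<b) ⟨
    f w           ≡⟨ per-extendʳ {f} {a} {b} {c} {e} {p} {g} 0<p a≤c long P R k w
                       (lia 4 (λ w p z k → (con 0 ≺ p) ∷ (w ⊕ p ≐ z) ∷ (z ≼ con 1 ⊕ k) ∷ [] ⊢ˡ w ≼ k) w p z k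
                           0<p w+p≡z z≤k) c≤w
                       (lia 5 (λ w p z g b → (w ⊕ p ≐ z) ∷ (z ⊕ g ≺ b) ∷ [] ⊢ˡ w ⊕ g ≺ b) w p z
                           g b w+p≡z z+g<b) ⟩
    f (w + g)     ≡⟨ P (w + g) (m≤n⇒m≤n+o g (≤-trans a≤c c≤w))
        (lia 5 (λ w p z g b → (w ⊕ p ≐ z) ∷ (z ⊕ g ≺ b) ∷ [] ⊢ˡ w ⊕ g ⊕ p ≺ b) w p z g b w+p≡z z+g<b) ⟩
    f (w + g + p) ≡⟨ cong f (lia 4 (λ w p z g → (w ⊕ p ≐ z) ∷ [] ⊢ˡ w ⊕ g ⊕ p ≐ z ⊕ g) w p z g w+p≡z) ⟩
    f (z + g)     ∎
  where
  open ≡-Reasoning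
  w = z ∸ p
  c+p≤z : c + p ≤ z
  c+p≤z = lia 5 (λ c e p g z → (c ⊕ p ⊕ g ≼ e) ∷ (e ≼ z ⊕ g) ∷ [] ⊢ˡ c ⊕ p ≼ z) c e p g z long (≮⇒≥ z+g≮e)
  w+p≡z : w + p ≡ z
  w+p≡z = m∸n+n≡m (m+n≤o⇒n≤o c c+p≤z)
  c≤w : c ≤ w
  c≤w = lia 4 (λ a p z w → (a ⊕ p ≼ z) ∷ (w ⊕ p ≐ z) ∷ [] ⊢ˡ a ≼ w) c p z w c+p≤z w+p≡z

-- The mirror image: positions before the window are moved forward by p, and k bounds the distance
-- to c.
per-extendˡ : ∀ {f a b c p g} → 0 < p → c + p + g ≤ b →
              Per f a b p → Per f c b g → ∀ k z → c ≤ z + k → a ≤ z → z + g < b → f z ≡ f (z + g)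
per-extendˡ {c = c} 0<p long P R k z c≤z+k a≤z z+g<b with c ≤? z
... | yes c≤z = R z c≤z z+g<b
per-extendˡ {c = c} 0<p long P R zero z c≤z+k a≤z z+g<b | no c≰z =
  ⊥-elim (c≰z (subst (c ≤_) (+-identityʳ z) c≤z+k))
per-extendˡ {f} {a} {b} {c} {p} {g} 0<p long P R (suc k) z c≤z+k a≤z z+g<b | no c≰z = begin
    f z           ≡⟨ P z a≤z (lia 5 (λ b c p g z → (z ≺ c) ∷ (c ⊕ p ⊕ g ≼ b) ∷ [] ⊢ˡ z ⊕ p ≺ b) b c p g
        z (≰⇒> c≰z) long) ⟩
    f (z + p)     ≡⟨ per-extendˡ {f} {a} {b} {c} {p} {g} 0<p long P R k (z + p)
                       (lia 4 (λ c p z k → (con 0 ≺ p) ∷ (c ≼ z ⊕ (con 1 ⊕ k)) ∷ [] ⊢ˡ c ≼ z ⊕ p ⊕ k)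
                           c p z k 0<p c≤z+k)
                       (m≤n⇒m≤n+o p a≤z)
                       (lia 5 (λ b c p g z → (z ≺ c) ∷ (c ⊕ p ⊕ g ≼ b) ∷ [] ⊢ˡ z ⊕ p ⊕ g ≺ b) b c p g
                           z (≰⇒> c≰z) long) ⟩
    f (z + p + g) ≡⟨ cong f (lia 3 (λ z p r → [] ⊢ˡ z ⊕ p ⊕ r ≐ z ⊕ r ⊕ p) z p g) ⟩
    f (z + g + p) ≡⟨ P (z + g) (m≤n⇒m≤n+o g a≤z) (lia 5 (λ b c p g z → (z ≺ c) ∷ (c ⊕ p ⊕ g ≼ b) ∷ [] ⊢ˡ
        z ⊕ g ⊕ p ≺ b) b c p g z (≰⇒> c≰z) long) ⟨
    f (z + g)     ∎
  where open ≡-Reasoning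

-- A window of length p + g determines the whole p-periodic factor, so its period g spreads. This
-- turns a divisor found inside a common factor into a contradiction with the minimality of p.
per-extend : ∀ {f a b c e p g} → 0 < p → a ≤ c → e ≤ b → c + p + g ≤ e →
             Per f a b p → Per f c e g → Per f a b g
per-extend {f} {a} {b} {c} {e} {p} {g} 0<p a≤c e≤b long P R z a≤z z+g<b =
  per-extendˡ {f} {a} {b} {c} {p} {g} 0<p (≤-trans long e≤b) P
    (λ z c≤z → per-extendʳ {f} {a} {b} {c} {e} {p} {g} 0<p a≤c long P R z z ≤-refl c≤z)
    c z (m≤n+m c z) a≤z z+g<b

per-multiple : ∀ {f a b p} → Per f a b p → ∀ k → Per f a b (k * p)
per-multiple {f} P zero    z a≤z z<b = cong f (sym (+-identityʳ z))
per-multiple {f} {a} {b} {p} P (suc k) z a≤z z<b =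
  trans (P z a≤z (≤-<-trans (m≤m+n (z + p) (k * p)) z+p+kp<b))
        (trans (per-multiple {f} {a} {b} {p} P k (z + p) (m≤n⇒m≤n+o p a≤z) z+p+kp<b)
               (cong f (+-assoc z p (k * p))))
  where
  z+p+kp<b : z + p + k * p < b
  z+p+kp<b = subst (_< b) (sym (+-assoc z p (k * p))) z<b

per-transport : ∀ {f f′ c c′ m p} → (∀ z → z < m → f (c + z) ≡ f′ (c′ + z)) →
                Per f c (c + m) p → Per f′ c′ (c′ + m) p
per-transport {f} {f′} {c} {c′} {m} {p} eq P z c′≤z z+p<c′+m with z ∸ c′ | m+[n∸m]≡n c′≤z
... | w | refl = begin
    f′ (c′ + w)       ≡⟨ eq w w<m ⟨
    f (c + w)         ≡⟨ P (c + w) (m≤m+n c w) (subst (_< c + m) (sym (+-assoc c w p)) (+-monoʳ-< c w+p<m)) ⟩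
    f (c + w + p)     ≡⟨ cong f (+-assoc c w p) ⟩
    f (c + (w + p))   ≡⟨ eq (w + p) w+p<m ⟩
    f′ (c′ + (w + p)) ≡⟨ cong f′ (+-assoc c′ w p) ⟨
    f′ (c′ + w + p)   ∎
  where
  open ≡-Reasoning
  w+p<m : w + p < m
  w+p<m = +-cancelˡ-< c′ _ _ (subst (_< c′ + m) (+-assoc c′ w p) z+p<c′+m)
  w<m : w < m
  w<m = ≤-<-trans (m≤m+n w p) w+p<m

MinPer : (ℕ → ℕ) → ℕ → ℕ → ℕ → Set
MinPer f a b d = Per f a b d × (∀ p → 0 < p → p < d → ¬ Per f a b p)

-- The common factor has both periods, hence some common divisor g of them. By `per-extend` g is a
-- period of each whole factor, and minimality on each side leaves d = g = d′.
common-factor : ∀ {f a b d f′ a′ b′ d′ c c′ m} →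
  MinPer f a b d → MinPer f′ a′ b′ d′ → 0 < d → 0 < d′ →
  a ≤ c → c + m ≤ b → a′ ≤ c′ → c′ + m ≤ b′ → (∀ z → z < m → f (c + z) ≡ f′ (c′ + z)) →
  d + d′ ≤ m → d ≡ d′
common-factor {f} {a} {b} {d} {f′} {a′} {b′} {d′} {c} {c′} {m} (P , minP) (Q , minQ) 0<d 0<d′ a≤c c+m≤b
    a′≤c′ c′+m≤b′ eq long
  with fine-wilf {f} {c} {c + m} {d} {d′} 0<d 0<d′
         (subst (_≤ c + m) (sym (+-assoc c d d′)) (+-monoʳ-≤ c long))
         (per-restrict {f} {a} {b} {c} {c + m} {d} a≤c c+m≤b P)
         (per-transport {f′} {f} {c′} {c} {m} {d′} (λ z z<m → sym (eq z z<m))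
           (per-restrict {f′} {a′} {b′} {c′} {c′ + m} {d′} a′≤c′ c′+m≤b′ Q))
... | g , 0<g , g∣d , g∣d′ , R = trans (sym g≡d) g≡d′
  where
  g≤d : g ≤ d
  g≤d = ∣⇒≤ {{>-nonZero 0<d}} g∣d
  g≤d′ : g ≤ d′
  g≤d′ = ∣⇒≤ {{>-nonZero 0<d′}} g∣d′
  g≡d : g ≡ d
  g≡d = ≤-antisym g≤d (≮⇒≥ λ g<d → minP g 0<g g<d
    (per-extend {f} {a} {b} {c} {c + m} {d} {g} 0<d a≤c c+m≤b
      (lia 5 (λ c d e g m → (g ≼ e) ∷ (d ⊕ e ≼ m) ∷ [] ⊢ˡ c ⊕ d ⊕ g ≼ c ⊕ m) c d d′ g m g≤d′ long) P R))
  g≡d′ : g ≡ d′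
  g≡d′ = ≤-antisym g≤d′ (≮⇒≥ λ g<d′ → minQ g 0<g g<d′
    (per-extend {f′} {a′} {b′} {c′} {c′ + m} {d′} {g} 0<d′ a′≤c′ c′+m≤b′
      (lia 5 (λ c d e g m → (g ≼ e) ∷ (e ⊕ d ≼ m) ∷ [] ⊢ˡ c ⊕ d ⊕ g ≼ c ⊕ m) c′ d′ d g m g≤d long) Q
      (per-transport {f} {f′} {c} {c′} {m} {g} eq R)))

-- Overlaps and crossing occurrences

record Str : Set where
  constructor str
  field
    len : ℕ
    at  : ℕ → ℕ
open Str public

record Cat (X X₁ X₂ : Str) : Set where
  field
    lens   : len X ≡ len X₁ + len X₂
    fst-at : ∀ z → z < len X₁ → at X z ≡ at X₁ z
    snd-at : ∀ z → z < len X₂ → at X (len X₁ + z) ≡ at X₂ z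

record Ov (X Y : Str) (l : ℕ) : Set where
  constructor ov
  field
    off   : ℕ
    off+l : off + l ≡ len X
    l≥1   : 1 ≤ l
    l≤Y   : l ≤ len Y
    match : ∀ z → z < l → at X (off + z) ≡ at Y z

-- s counts the letters of Y that lie left of position c in X.
record Oc (X : Str) (c : ℕ) (Y : Str) (s : ℕ) : Set where
  constructor oc
  field
    off   : ℕ
    off+s : off + s ≡ c
    s≥1   : 1 ≤ s
    s<Y   : s < len Y
    inX   : off + len Y ≤ len X
    match : ∀ z → z < len Y → at X (off + z) ≡ at Y z

module _ {X X₁ X₂ : Str} (catX : Cat X X₁ X₂) where
  open Cat catX

  ov-right : ∀ {Y l} → Ov X₂ Y l → Ov X Y l
  ov-right {Y} {l} (ov o o+l l≥1 l≤Y m) = ov (len X₁ + o)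
    (trans (+-assoc (len X₁) o l) (trans (cong (len X₁ +_) o+l) (sym lens))) l≥1 l≤Y
    λ z z<l → trans (cong (at X) (+-assoc (len X₁) o z))
      (trans (snd-at (o + z) (subst (o + z <_) o+l (+-monoʳ-< o z<l))) (m z z<l))

  ov-right⁻ : ∀ {Y l} → l ≤ len X₂ → Ov X Y l → Ov X₂ Y l
  ov-right⁻ {Y} {l} l≤X₂ (ov o o+l l≥1 l≤Y m) = ov p p+l l≥1 l≤Y
    λ z z<l → trans (sym (snd-at (p + z) (subst (p + z <_) p+l (+-monoʳ-< p z<l))))
      (trans (cong (at X) (trans (sym (+-assoc (len X₁) p z)) (cong (_+ z) X₁+p≡o))) (m z z<l))
    where
    p = o ∸ len X₁
    X₁+p≡o : len X₁ + p ≡ o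
    X₁+p≡o = m+[n∸m]≡n (lia 5 (λ o l x x₁ x₂ → (o ⊕ l ≐ x) ∷ (x ≐ x₁ ⊕ x₂) ∷ (l ≼ x₂) ∷ [] ⊢ˡ x₁ ≼ o) o l
        (len X) (len X₁) (len X₂) o+l lens l≤X₂)
    p+l : p + l ≡ len X₂
    p+l = lia 6 (λ o l x x₁ x₂ p → (o ⊕ l ≐ x) ∷ (x ≐ x₁ ⊕ x₂) ∷ (x₁ ⊕ p ≐ o) ∷ [] ⊢ˡ p ⊕ l ≐ x₂) o l (len X)
        (len X₁) (len X₂) p o+l lens X₁+p≡o

  ov-drop : ∀ {Y l m} → 1 ≤ m → m + len X₂ ≡ l → Ov X Y l → Ov X₁ Y m
  ov-drop {Y} {l} {m} m≥1 m+X₂ (ov o o+l l≥1 l≤Y mt) = ov o o+m m≥1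
    (≤-trans m≤l l≤Y)
    λ z z<m → trans (sym (fst-at (o + z) (subst (o + z <_) o+m (+-monoʳ-< o z<m)))) (mt z (<-≤-trans z<m m≤l))
    where
    m≤l : m ≤ l
    m≤l = subst (m ≤_) m+X₂ (m≤m+n m (len X₂))
    o+m : o + m ≡ len X₁
    o+m = lia 6 (λ o l x x₁ x₂ m → (o ⊕ l ≐ x) ∷ (x ≐ x₁ ⊕ x₂) ∷ (m ⊕ x₂ ≐ l) ∷ [] ⊢ˡ o ⊕ m ≐ x₁) o l (len X)
        (len X₁) (len X₂) m o+l lens m+X₂

module _ {X Y Y₁ Y₂ : Str} (catY : Cat Y Y₁ Y₂) where
  open Cat catY

  ov-left : ∀ {l} → Ov X Y₁ l → Ov X Y l
  ov-left {l} (ov o o+l l≥1 l≤Y m) = ov o o+l l≥1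
    (≤-trans l≤Y (subst (len Y₁ ≤_) (sym lens) (m≤m+n (len Y₁) (len Y₂))))
    λ z z<l → trans (m z z<l) (sym (fst-at z (<-≤-trans z<l l≤Y)))

  ov-left⁻ : ∀ {l} → l ≤ len Y₁ → Ov X Y l → Ov X Y₁ l
  ov-left⁻ l≤Y₁ (ov o o+l l≥1 l≤Y m) = ov o o+l l≥1 l≤Y₁
    λ z z<l → trans (m z z<l) (fst-at z (<-≤-trans z<l l≤Y₁))

  ov-dropʳ : ∀ {l m} → 1 ≤ m → m + len Y₁ ≡ l → Ov X Y l → Ov X Y₂ m
  ov-dropʳ {l} {m} m≥1 m+Y₁ (ov o o+l l≥1 l≤Y mt) = ov (o + len Y₁)
    (lia 5 (λ o l x y₁ m → (o ⊕ l ≐ x) ∷ (m ⊕ y₁ ≐ l) ∷ [] ⊢ˡ o ⊕ y₁ ⊕ m ≐ x) o l (len X) (len Y₁) m o+l m+Y₁)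
    m≥1 m≤Y₂
    λ z z<m → trans (cong (at X) (+-assoc o (len Y₁) z))
      (trans (mt (len Y₁ + z) (lia 4 (λ l m y₁ z → (m ⊕ y₁ ≐ l) ∷ (z ≺ m) ∷ [] ⊢ˡ y₁ ⊕ z ≺ l) l m
          (len Y₁) z m+Y₁ z<m))
             (snd-at z (<-≤-trans z<m m≤Y₂)))
    where
    m≤Y₂ : m ≤ len Y₂
    m≤Y₂ = lia 5 (λ l m y y₁ y₂ → (m ⊕ y₁ ≐ l) ∷ (l ≼ y) ∷ (y ≐ y₁ ⊕ y₂) ∷ [] ⊢ˡ m ≼ y₂) l m (len Y) (len Y₁)
        (len Y₂) m+Y₁ l≤Y lens

module _ {X X₁ X₂ Y Y₁ Y₂ : Str} (catX : Cat X X₁ X₂) (catY : Cat Y Y₁ Y₂) where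
  private
    module cX = Cat catX
    module cY = Cat catY

  -- The first m positions agree through X₁, and the positions from |Y₁| on agree through Y₂; |Y₁| ≤
  -- m leaves no hole between them.
  ov-join : ∀ {l m m′} → m + len X₂ ≡ l → m′ + len Y₁ ≡ l → len Y₁ ≤ m → Ov X₁ Y m → Ov X Y₂ m′ → Ov X Y l
  ov-join {l} {m} {m′} m+X₂ m′+Y₁ Y₁≤m (ov o o+m m≥1 m≤Y f) (ov o′ o′+m′ m′≥1 m′≤Y₂ f′) = ov o
    (lia 6 (λ o l x x₁ x₂ m → (o ⊕ m ≐ x₁) ∷ (x ≐ x₁ ⊕ x₂) ∷ (m ⊕ x₂ ≐ l) ∷ [] ⊢ˡ o ⊕ l ≐ x) o l (len X)
        (len X₁) (len X₂) m o+m cX.lens m+X₂)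
    (≤-trans m≥1 (subst (m ≤_) m+X₂ (m≤m+n m (len X₂))))
    (lia 5 (λ l m y y₁ y₂ → (m ⊕ y₁ ≐ l) ∷ (m ≼ y₂) ∷ (y ≐ y₁ ⊕ y₂) ∷ [] ⊢ˡ l ≼ y) l m′ (len Y) (len Y₁)
        (len Y₂) m′+Y₁ m′≤Y₂ cY.lens)
    go
    where
    go : ∀ z → z < l → at X (o + z) ≡ at Y z
    go z z<l with z <? m
    ... | yes z<m = trans (cX.fst-at (o + z) (subst (o + z <_) o+m (+-monoʳ-< o z<m))) (f z z<m)
    ... | no z≮m with z ∸ len Y₁ | m+[n∸m]≡n (≤-trans Y₁≤m (≮⇒≥ z≮m))
    ...   | w | refl = trans (cong (at X) o+Y₁+w≡o′+w)
              (trans (f′ w w<m′) (sym (cY.snd-at w (<-≤-trans w<m′ m′≤Y₂))))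
      where
      w<m′ : w < m′
      w<m′ = lia 4 (λ l m y z → (m ⊕ y ≐ l) ∷ (y ⊕ z ≺ l) ∷ [] ⊢ˡ z ≺ m) l m′ (len Y₁) w m′+Y₁ z<l
      o+Y₁+w≡o′+w : o + (len Y₁ + w) ≡ o′ + w
      o+Y₁+w≡o′+w = lia 10 (λ o o′ m m′ l x x₁ x₂ y₁ w → (o ⊕ m ≐ x₁) ∷ (x ≐ x₁ ⊕ x₂) ∷ (o′ ⊕ m′ ≐ x) ∷
          (m ⊕ x₂ ≐ l) ∷ (m′ ⊕ y₁ ≐ l) ∷ [] ⊢ˡ o ⊕ (y₁ ⊕ w) ≐ o′ ⊕ w)
        o o′ m m′ l (len X) (len X₁) (len X₂) (len Y₁) w o+m cX.lens o′+m′ m+X₂ m′+Y₁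

  -- As l exceeds |Y₁|, all of Y₁ lies inside the overlap. Its part left of the cut of X has length
  -- l - |X₂|.
  ov-crossˡ : ∀ {l s} → 1 ≤ s → s + len X₂ ≡ l → len Y₁ < l → s < len Y₁ → Ov X Y l → Oc X (len X₁) Y₁ s
  ov-crossˡ {l} {s} s≥1 s+X₂ Y₁<l s<Y₁ (ov o o+l l≥1 l≤Y m) = oc o
    (lia 6 (λ o l x x₁ x₂ m → (o ⊕ l ≐ x) ∷ (x ≐ x₁ ⊕ x₂) ∷ (m ⊕ x₂ ≐ l) ∷ [] ⊢ˡ o ⊕ m ≐ x₁) o l (len X)
        (len X₁) (len X₂) s o+l cX.lens s+X₂)
    s≥1 s<Y₁
    (subst (o + len Y₁ ≤_) o+l (+-monoʳ-≤ o (<⇒≤ Y₁<l)))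
    λ z z<Y₁ → trans (m z (<-trans z<Y₁ Y₁<l)) (cY.fst-at z z<Y₁)

  ov-crossʳ : ∀ {l s s′} → s + len X₂ ≡ l → s + s′ ≡ len Y₁ → 1 ≤ s′ → len Y₁ < l → Ov X Y l →
      Oc Y (len Y₁) X₂ s′
  ov-crossʳ {l} {s} {s′} s+X₂ s+s′ s′≥1 Y₁<l (ov o o+l l≥1 l≤Y m) = oc s s+s′ s′≥1
    (lia 5 (λ s s′ l x₂ y₁ → (s ⊕ x₂ ≐ l) ∷ (s ⊕ s′ ≐ y₁) ∷ (y₁ ≺ l) ∷ [] ⊢ˡ s′ ≺ x₂) s s′ l (len X₂)
        (len Y₁) s+X₂ s+s′ Y₁<l)
    (subst (_≤ len Y) (sym s+X₂) l≤Y)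
    λ z z<X₂ → trans (sym (m (s + z) (subst (s + z <_) s+X₂ (+-monoʳ-< s z<X₂))))
      (trans (cong (at X) (lia 7 (λ o s z l x x₁ x₂ → (o ⊕ l ≐ x) ∷ (x ≐ x₁ ⊕ x₂) ∷ (s ⊕ x₂ ≐ l) ∷ [] ⊢ˡ
          o ⊕ (s ⊕ z) ≐ x₁ ⊕ z)
                o s z l (len X) (len X₁) (len X₂) o+l cX.lens s+X₂))
             (cX.snd-at z z<X₂))

  -- The first s positions are matched by the occurrence of Y₁ in X. The rest is X₂, which occurs in
  -- Y at position |Y₁| - s′ = s, exactly where the first part stops.
  ov-cross : ∀ {l s s′} → s + len X₂ ≡ l → s + s′ ≡ len Y₁ →
             Oc X (len X₁) Y₁ s → Oc Y (len Y₁) X₂ s′ → Ov X Y l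
  ov-cross {l} {s} {s′} s+X₂ s+s′ (oc o o+s s≥1 s<Y₁ inX f) (oc o′ o′+s′ s′≥1 s′<X₂ inY f′) = ov o
    (lia 6 (λ o l x x₁ x₂ m → (o ⊕ m ≐ x₁) ∷ (x ≐ x₁ ⊕ x₂) ∷ (m ⊕ x₂ ≐ l) ∷ [] ⊢ˡ o ⊕ l ≐ x) o l (len X)
        (len X₁) (len X₂) s o+s cX.lens s+X₂)
    (≤-trans s≥1 (subst (s ≤_) s+X₂ (m≤m+n s (len X₂))))
    (subst (_≤ len Y) (trans (cong (_+ len X₂) o′≡s) s+X₂) inY)
    go
    where
    o′≡s : o′ ≡ s
    o′≡s = +-cancelʳ-≡ s′ o′ s (trans o′+s′ (sym s+s′))
    go : ∀ z → z < l → at X (o + z) ≡ at Y z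
    go z z<l with z <? s
    ... | yes z<ˢ = trans (f z (<-trans z<ˢ s<Y₁)) (sym (cY.fst-at z (<-trans z<ˢ s<Y₁)))
    ... | no z≮s with z ∸ s | m+[n∸m]≡n (≮⇒≥ z≮s)
    ...   | w | refl = trans (cong (at X) (trans (sym (+-assoc o s w)) (cong (_+ w) o+s)))
              (trans (cX.snd-at w w<X₂) (trans (sym (f′ w w<X₂)) (cong (λ q → at Y (q + w)) o′≡s)))
      where
      w<X₂ : w < len X₂
      w<X₂ = +-cancelˡ-< s _ _ (subst (s + w <_) (sym s+X₂) z<l)

module _ {X X₁ X₂ Y : Str} (catX : Cat X X₁ X₂) where
  open Cat catX

  oc-left : ∀ {s} → Oc X (len X₁) Y s → Ov X₁ Y s
  oc-left {s} (oc o o+s s≥1 s<Y inX m) = ov o o+s s≥1 (<⇒≤ s<Y)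
    λ z z<ˢ → trans (sym (fst-at (o + z) (subst (o + z <_) o+s (+-monoʳ-< o z<ˢ)))) (m z (<-trans z<ˢ s<Y))

  oc-right : ∀ {s u} → s + u ≡ len Y → Oc X (len X₁) Y s → Ov Y X₂ u
  oc-right {s} {u} s+u (oc o o+s s≥1 s<Y inX m) = ov s s+u
    (lia 3 (λ s u y → (s ⊕ u ≐ y) ∷ (s ≺ y) ∷ [] ⊢ˡ con 1 ≼ u) s u (len Y) s+u s<Y)
    u≤X₂
    λ z z<u → trans (sym (m (s + z) (subst (s + z <_) s+u (+-monoʳ-< s z<u))))
      (trans (cong (at X) (trans (sym (+-assoc o s z)) (cong (_+ z) o+s))) (snd-at z (<-≤-trans z<u u≤X₂)))
    where
    u≤X₂ : u ≤ len X₂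
    u≤X₂ = lia 7 (λ o s u y x x₁ x₂ → (o ⊕ s ≐ x₁) ∷ (s ⊕ u ≐ y) ∷ (o ⊕ y ≼ x) ∷ (x ≐ x₁ ⊕ x₂) ∷ [] ⊢ˡ u ≼ x₂)
        o s u (len Y) (len X) (len X₁) (len X₂) o+s s+u inX lens

  oc-join : ∀ {s u} → s + u ≡ len Y → Ov X₁ Y s → Ov Y X₂ u → Oc X (len X₁) Y s
  oc-join {s} {u} s+u (ov o o+s s≥1 s≤Y f) (ov o′ o′+u u≥1 u≤X₂ f′) = oc o o+s s≥1
    (lia 3 (λ s u y → (s ⊕ u ≐ y) ∷ (con 1 ≼ u) ∷ [] ⊢ˡ s ≺ y) s u (len Y) s+u u≥1)
    (lia 7 (λ o s u y x x₁ x₂ → (o ⊕ s ≐ x₁) ∷ (s ⊕ u ≐ y) ∷ (u ≼ x₂) ∷ (x ≐ x₁ ⊕ x₂) ∷ [] ⊢ˡ o ⊕ y ≼ x) o s u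
        (len Y) (len X) (len X₁) (len X₂) o+s s+u u≤X₂ lens)
    go
    where
    o′≡s : o′ ≡ s
    o′≡s = +-cancelʳ-≡ u o′ s (trans o′+u (sym s+u))
    go : ∀ z → z < len Y → at X (o + z) ≡ at Y z
    go z z<Y with z <? s
    ... | yes z<ˢ = trans (fst-at (o + z) (subst (o + z <_) o+s (+-monoʳ-< o z<ˢ))) (f z z<ˢ)
    ... | no z≮s with z ∸ s | m+[n∸m]≡n (≮⇒≥ z≮s)
    ...   | w | refl = trans (cong (at X) (trans (sym (+-assoc o s w)) (cong (_+ w) o+s)))
              (trans (snd-at w (<-≤-trans w<u u≤X₂)) (trans (sym (f′ w w<u))
                  (cong (λ q → at Y (q + w)) o′≡s)))
      where
      w<u : w < u
      w<u = +-cancelˡ-< s _ _ (subst (s + w <_) (sym s+u) z<Y)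

-- Overlaps within a factor two, and crossing occurrences, form progressions

Gap : (ℕ → Set) → ℕ → ℕ → Set
Gap S h d = ∀ v → S v → v ≡ h ⊎ v + d ≤ h

record TopGap (S : ℕ → Set) (h d : ℕ) : Set where
  constructor topGap
  field
    next     : ℕ
    S-top    : S h
    S-next   : S next
    next+gap : next + d ≡ h
    gap>0    : 0 < d
    gap      : Gap S h d

-- Being a progression is expressed relative to the two largest elements, because their distance is
-- what a cell stores as difference. Sets with fewer than two elements satisfy it vacuously.
record Progressive (S : ℕ → Set) : Set where
  field
    spaced : ∀ {h d l e} → TopGap S h d → S l → l + e ≡ h → d ∣ e
    filled : ∀ {h d l} → TopGap S h d → S l → ∀ k v → l ≤ v → v + k * d ≡ h → S v

gap-≤ : ∀ {S h d v p} → 0 < p → v + p ≡ h → Gap S h d → S v → d ≤ p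
gap-≤ {h = h} {d} {v} {p} 0<p v+p G Sv with G v Sv
... | inj₁ refl = ⊥-elim (lia 2 (λ v p → (con 0 ≺ p) ∷ (v ⊕ p ≐ v) ∷ [] ⊢ˡ absurd) v p 0<p v+p)
... | inj₂ v+d≤h = lia 4 (λ v p h d → (v ⊕ p ≐ h) ∷ (v ⊕ d ≼ h) ∷ [] ⊢ˡ d ≼ p) v p h d v+p v+d≤h

Scale : ℕ → ℕ → Set
Scale t l = 2 ^ t ≤ l × l < 2 ^ suc t

OvScale : Str → Str → ℕ → ℕ → Set
OvScale X Y t l = Ov X Y l × Scale t l

module _ {X Y : Str} where
  -- Both overlaps end at the end of X, so the shorter one is a border of the longer one, and
  -- borders are complements of periods.
  ov-per : ∀ {h w d} → Ov X Y h → Ov X Y w → w + d ≡ h → Per (at Y) 0 h d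
  ov-per {h} {w} {d} (ov o o+h h≥1 h≤Y f) (ov o′ o′+w w≥1 w≤Y f′) w+d z _ z+d<h =
    trans (sym (f′ z z<w))
        (trans (cong (at X) (lia 7 (λ o o′ h w d x z → (o ⊕ h ≐ x) ∷ (o′ ⊕ w ≐ x) ∷ (w ⊕ d ≐ h) ∷ [] ⊢ˡ
        o′ ⊕ z ≐ o ⊕ (z ⊕ d)) o o′ h w d (len X) z o+h o′+w w+d))
      (f (z + d) z+d<h))
    where
    z<w : z < w
    z<w = lia 4 (λ z d h w → (z ⊕ d ≺ h) ∷ (w ⊕ d ≐ h) ∷ [] ⊢ˡ z ≺ w) z d h w z+d<h w+d

  per-ov : ∀ {h w d} → Ov X Y h → 1 ≤ w → w + d ≡ h → Per (at Y) 0 h d → Ov X Y w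
  per-ov {h} {w} {d} (ov o o+h h≥1 h≤Y f) w≥1 w+d P = ov (o + d)
    (lia 5 (λ o h w d x → (o ⊕ h ≐ x) ∷ (w ⊕ d ≐ h) ∷ [] ⊢ˡ o ⊕ d ⊕ w ≐ x) o h w d (len X) o+h w+d)
    w≥1 (≤-trans (subst (w ≤_) w+d (m≤m+n w d)) h≤Y)
    λ z z<w →
      let z+d<h = lia 4 (λ z d h w → (z ≺ w) ∷ (w ⊕ d ≐ h) ∷ [] ⊢ˡ z ⊕ d ≺ h) z d h w z<w w+d in
      trans (cong (at X) (lia 3 (λ o d z → [] ⊢ˡ o ⊕ d ⊕ z ≐ o ⊕ (z ⊕ d)) o d z))
        (trans (f (z + d) z+d<h) (sym (P z z≤n z+d<h)))

  scale-between : ∀ {t a b v} → Scale t a → Scale t b → a ≤ v → v ≤ b → Scale t v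
  scale-between (la , _) (_ , bu) a≤v v≤b = ≤-trans la a≤v , ≤-<-trans v≤b bu

  -- A smaller positive period p would produce the overlap h - p strictly between the two largest
  -- ones, in the same scale.
  ov-minPer : ∀ {t h d} → TopGap (OvScale X Y t) h d → MinPer (at Y) 0 h d
  ov-minPer {t} {h} {d} (topGap w (Oh , sh) (Ow , sw) w+d 0<d gap) = ov-per Oh Ow w+d , minimal
    where
    minimal : ∀ p → 0 < p → p < d → ¬ Per (at Y) 0 h p
    minimal p 0<p p<d P = <⇒≱ p<d (gap-≤ {OvScale X Y t} 0<p v+p gap (per-ov Oh v≥1 v+p P , scale-between {t}
        sw sh w≤v (m∸n≤m h p)))
      where
      v = h ∸ p
      v+p : v + p ≡ h
      v+p = m∸n+n≡m (lia 4 (λ p d w h → (p ≺ d) ∷ (w ⊕ d ≐ h) ∷ [] ⊢ˡ p ≼ h) p d w h p<d w+d)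
      w≤v : w ≤ v
      w≤v = lia 5 (λ p d w h v → (p ≺ d) ∷ (w ⊕ d ≐ h) ∷ (v ⊕ p ≐ h) ∷ [] ⊢ˡ w ≼ v) p d w h v p<d w+d v+p
      v≥1 : 1 ≤ v
      v≥1 = ≤-trans (Ov.l≥1 Ow) w≤v

  ov-progressive : ∀ t → Progressive (OvScale X Y t)
  ov-progressive t = record { spaced = spaced ; filled = filled }
    where
    spaced : ∀ {h d l e} → TopGap (OvScale X Y t) h d → OvScale X Y t l → l + e ≡ h → d ∣ e
    spaced {e = zero} _ _ _ = _ ∣0
    spaced {h} {d} {l} {e@(suc _)} (topGap w (Oh , sh) (Ow , sw) w+d 0<d gap) (Ol , sl) l+e
      with fine-wilf {at Y} {0} {h} {d} {e} 0<d z<s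
             -- Both w and l are at least 2ᵗ while h < 2ᵗ⁺¹, so the two differences fit together
             -- into h. This is what the restriction to one scale provides.
             (lia 6 (λ h w d l e L → (w ⊕ d ≐ h) ∷ (l ⊕ e ≐ h) ∷ (L ≼ w) ∷ (L ≼ l) ∷ (h ≺ 2 ⊛ L) ∷ [] ⊢ˡ
                 d ⊕ e ≼ h) h w d l e (2 ^ t) w+d l+e (proj₁ sw) (proj₁ sl) (proj₂ sh))
             (ov-per Oh Ow w+d) (ov-per Oh Ol l+e)
    ... | g , 0<g , g∣d , g∣e , P = subst (_∣ e) (≤-antisym g≤d (gap-≤ {OvScale X Y t} 0<g v+g gap
            (per-ov Oh (≤-trans (Ov.l≥1 Ow) w≤v) v+g P , scale-between {t} sw sh w≤v (m∸n≤m h g)))) g∣e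
      where
      g≤d : g ≤ d
      g≤d = ∣⇒≤ {{>-nonZero 0<d}} g∣d
      v = h ∸ g
      v+g : v + g ≡ h
      v+g = m∸n+n≡m (lia 4 (λ p d w h → (p ≼ d) ∷ (w ⊕ d ≐ h) ∷ [] ⊢ˡ p ≼ h) g d w h g≤d w+d)
      w≤v : w ≤ v
      w≤v = lia 5 (λ p d w h v → (p ≼ d) ∷ (w ⊕ d ≐ h) ∷ (v ⊕ p ≐ h) ∷ [] ⊢ˡ w ≼ v) g d w h v g≤d w+d v+g
    filled : ∀ {h d l} → TopGap (OvScale X Y t) h d → OvScale X Y t l → ∀ k v → l ≤ v →
        v + k * d ≡ h → OvScale X Y t v
    filled {h} {d} (topGap w (Oh , sh) (Ow , sw) w+d 0<d gap) (Ol , sl) k v l≤v v+kd =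
      per-ov Oh (≤-trans (Ov.l≥1 Ol) l≤v) v+kd (per-multiple {at Y} {0} {h} {d} (ov-per Oh Ow w+d) k) ,
      scale-between {t} sl sh l≤v (subst (v ≤_) v+kd (m≤m+n v (k * d)))

module _ {X : Str} {c : ℕ} {Y : Str} where
  -- More letters before c means an earlier start: occurrence h begins d positions before occurrence
  -- w, and together they cover |Y| + d positions of X.
  oc-per : ∀ {h w d} (Oh : Oc X c Y h) → Oc X c Y w → w + d ≡ h → Per (at X) (Oc.off Oh)
      (Oc.off Oh + d + len Y) d
  oc-per {h} {w} {d} (oc o o+h _ _ _ f) (oc o′ o′+w _ _ _ f′) w+d z o≤z z+d< with z ∸ o | m+[n∸m]≡n o≤z
  ... | q | refl = trans (f q q<Y) (trans (sym (f′ q q<Y))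
        (cong (at X) (lia 7 (λ o o′ h w d x q → (o ⊕ h ≐ x) ∷ (o′ ⊕ w ≐ x) ∷ (w ⊕ d ≐ h) ∷ [] ⊢ˡ
            o′ ⊕ q ≐ o ⊕ q ⊕ d) o o′ h w d c q o+h o′+w w+d)))
    where
    q<Y : q < len Y
    q<Y = lia 4 (λ o q d y → (o ⊕ q ⊕ d ≺ o ⊕ d ⊕ y) ∷ [] ⊢ˡ q ≺ y) o q d (len Y) z+d<

  -- The periodic stretch reaches from occurrence h to the end of occurrence l; the new occurrence w
  -- lies between these two and therefore inside it.
  per-oc : ∀ {h w l e} (Oh : Oc X c Y h) → Oc X c Y l → l + e ≡ h → l ≤ w → ∀ {p} → w + p ≡ h →
           Per (at X) (Oc.off Oh) (Oc.off Oh + e + len Y) p → Oc X c Y w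
  per-oc {h} {w} {l} {e} (oc o o+h h≥1 h<Y inX f) (oc o′ o′+l l≥1 l<Y inX′ f′) l+e l≤w {p} w+p P = oc (o + p)
    (lia 5 (λ o p w h c → (o ⊕ h ≐ c) ∷ (w ⊕ p ≐ h) ∷ [] ⊢ˡ o ⊕ p ⊕ w ≐ c) o p w h c o+h w+p)
    (≤-trans l≥1 l≤w)
    (≤-<-trans (subst (w ≤_) w+p (m≤m+n w p)) h<Y)
    (lia 9 (λ o o′ p w h l c y x → (o ⊕ h ≐ c) ∷ (o′ ⊕ l ≐ c) ∷ (w ⊕ p ≐ h) ∷ (l ≼ w) ∷ (o′ ⊕ y ≼ x) ∷ [] ⊢ˡ
        o ⊕ p ⊕ y ≼ x) o o′ p w h l c (len Y) (len X) o+h o′+l w+p l≤w inX′)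
    λ z z<Y → trans (cong (at X) (lia 3 (λ o p z → [] ⊢ˡ o ⊕ p ⊕ z ≐ o ⊕ z ⊕ p) o p z))
      (trans (sym (P (o + z) (m≤m+n o z)
        (lia 8 (λ o p z y w l e h → (z ≺ y) ∷ (l ⊕ e ≐ h) ∷ (w ⊕ p ≐ h) ∷ (l ≼ w) ∷ [] ⊢ˡ
            o ⊕ z ⊕ p ≺ o ⊕ e ⊕ y) o p z (len Y) w l e h z<Y l+e w+p l≤w)))
        (f z z<Y))

  oc-minPer : ∀ {h d} (G : TopGap (Oc X c Y) h d) →
              let o = Oc.off (TopGap.S-top G) in MinPer (at X) o (o + d + len Y) d
  oc-minPer {h} {d} (topGap w Oh Ow w+d 0<d gap) = oc-per Oh Ow w+d , minimal
    where
    minimal : ∀ p → 0 < p → p < d → ¬ Per (at X) (Oc.off Oh) (Oc.off Oh + d + len Y) p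
    minimal p 0<p p<d P = <⇒≱ p<d (gap-≤ {Oc X c Y} 0<p v+p gap (per-oc Oh Ow w+d w≤v v+p P))
      where
      v = h ∸ p
      v+p : v + p ≡ h
      v+p = m∸n+n≡m (lia 4 (λ p d w h → (p ≺ d) ∷ (w ⊕ d ≐ h) ∷ [] ⊢ˡ p ≼ h) p d w h p<d w+d)
      w≤v : w ≤ v
      w≤v = lia 5 (λ p d w h v → (p ≺ d) ∷ (w ⊕ d ≐ h) ∷ (v ⊕ p ≐ h) ∷ [] ⊢ˡ w ≼ v) p d w h v p<d w+d v+p

  oc-perY : ∀ {h w d} → Oc X c Y h → Oc X c Y w → w + d ≡ h → Per (at Y) 0 (len Y) d
  oc-perY {h} {w} {d} (oc o o+h _ _ _ f) (oc o′ o′+w _ _ _ f′) w+d z _ z+d<Y =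
    trans (sym (f′ z z<Y))
        (trans (cong (at X) (lia 7 (λ o o′ h w d x z → (o ⊕ h ≐ x) ∷ (o′ ⊕ w ≐ x) ∷ (w ⊕ d ≐ h) ∷ [] ⊢ˡ
        o′ ⊕ z ≐ o ⊕ (z ⊕ d)) o o′ h w d c z o+h o′+w w+d)) (f (z + d) z+d<Y))
    where
    z<Y : z < len Y
    z<Y = ≤-<-trans (m≤m+n z d) z+d<Y

  oc-progressive : Progressive (Oc X c Y)
  oc-progressive = record { spaced = spaced ; filled = filled }
    where
    spaced : ∀ {h d l e} → TopGap (Oc X c Y) h d → Oc X c Y l → l + e ≡ h → d ∣ e
    spaced {h} {d} {l} {e} G@(topGap w Oh Ow w+d 0<d gap) Ol l+e with gap l Ol
    ... | inj₁ refl = subst (d ∣_) (lia 2 (λ l e → (l ⊕ e ≐ l) ∷ [] ⊢ˡ con 0 ≐ e) l e l+e) (d ∣0)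
    ... | inj₂ l+d≤h with e ∸ d | m+[n∸m]≡n {d} {e} (lia 4 (λ l d h e → (l ⊕ d ≼ h) ∷ (l ⊕ e ≐ h) ∷ [] ⊢ˡ
        d ≼ e) l d h e l+d≤h l+e)
    ...   | zero  | refl = subst (d ∣_) (sym (+-identityʳ d)) ∣-refl
    ...   | r@(suc _) | refl
      -- Y has period d, from h and w, and period r, from w and l. Their sum is h - l, which is
      -- below |Y| because all occurrences cross the same position.
      with fine-wilf {at Y} {0} {len Y} {d} {r} 0<d z<s
             (lia 5 (λ d r l h y → (l ⊕ (d ⊕ r) ≐ h) ∷ (h ≺ y) ∷ [] ⊢ˡ d ⊕ r ≼ y) d r l h
                 (len Y) l+e (Oc.s<Y Oh))
             (oc-perY Oh Ow w+d)
             (oc-perY Ow Ol (lia 5 (λ d r l h w → (l ⊕ (d ⊕ r) ≐ h) ∷ (w ⊕ d ≐ h) ∷ [] ⊢ˡ l ⊕ r ≐ w)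
                 d r l h w l+e w+d))
    ...     | g , 0<g , g∣d , g∣r , P = subst (_∣ d + r) g≡d (∣m∣n⇒∣m+n g∣d g∣r)
      where
      o = Oc.off Oh
      g≤d : g ≤ d
      g≤d = ∣⇒≤ {{>-nonZero 0<d}} g∣d
      g≤r : g ≤ r
      g≤r = ∣⇒≤ g∣r
      R : Per (at X) o (o + len Y) g
      R = per-transport {at Y} {at X} {0} {o} {len Y} {g} (λ z z<Y → sym (Oc.match Oh z z<Y)) P
      R′ : Per (at X) o (o + d + len Y) g
      R′ = per-extend {at X} {o} {o + d + len Y} {o} {o + len Y} {d} {g} 0<d ≤-refl
             (+-monoˡ-≤ (len Y) (m≤m+n o d))
             (lia 7 (λ o d r l h y g → (l ⊕ (d ⊕ r) ≐ h) ∷ (h ≺ y) ∷ (g ≼ r) ∷ [] ⊢ˡ o ⊕ d ⊕ g ≼ o ⊕ y) o d r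
                 l h (len Y) g l+e (Oc.s<Y Oh) g≤r)
             (oc-per Oh Ow w+d) R
      v = h ∸ g
      v+g : v + g ≡ h
      v+g = m∸n+n≡m (lia 4 (λ p d w h → (p ≼ d) ∷ (w ⊕ d ≐ h) ∷ [] ⊢ˡ p ≼ h) g d w h g≤d w+d)
      w≤v : w ≤ v
      w≤v = lia 5 (λ p d w h v → (p ≼ d) ∷ (w ⊕ d ≐ h) ∷ (v ⊕ p ≐ h) ∷ [] ⊢ˡ w ≼ v) g d w h v g≤d w+d v+g
      g≡d : g ≡ d
      g≡d = ≤-antisym g≤d (gap-≤ {Oc X c Y} 0<g v+g gap (per-oc Oh Ow w+d w≤v v+g R′))
    filled : ∀ {h d l} → TopGap (Oc X c Y) h d → Oc X c Y l → ∀ k v → l ≤ v → v + k * d ≡ h → Oc X c Y v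
    filled {h} {d} {l} (topGap w Oh Ow w+d 0<d gap) Ol k v l≤v v+kd =
      per-oc Oh Ol l+e l≤v v+kd (per-multiple {at X} {o} {o + e + len Y} {d} P k)
      where
      o = Oc.off Oh
      e = h ∸ l
      l≤h : l ≤ h
      l≤h = ≤-trans l≤v (subst (v ≤_) v+kd (m≤m+n v (k * d)))
      l+e : l + e ≡ h
      l+e = m+[n∸m]≡n l≤h
      P : Per (at X) o (o + e + len Y) d
      P with gap l Ol
      ... | inj₁ refl = per-restrict {at X} {o} {o + d + len Y} {o} {o + (l ∸ l) + len Y} {d} ≤-refl
              (+-monoˡ-≤ (len Y) (+-monoʳ-≤ o (subst (_≤ d) (sym (n∸n≡0 l)) z≤n))) (oc-per Oh Ow w+d)
      -- The roles are reversed: the stretch from occurrence h to occurrence l has period e = h - l,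
      -- and the period d of the top two occurrences extends over it, because |Y| + d exceeds e + d.
      ... | inj₂ l+d≤h = per-extend {at X} {o} {o + e + len Y} {o} {o + d + len Y} {e} {d}
              (lia 4 (λ l d h e → (l ⊕ d ≼ h) ∷ (l ⊕ e ≐ h) ∷ (con 0 ≺ d) ∷ [] ⊢ˡ con 0 ≺ e) l d h e
                  l+d≤h l+e 0<d) ≤-refl
              (lia 6 (λ l d h e o y → (l ⊕ d ≼ h) ∷ (l ⊕ e ≐ h) ∷ [] ⊢ˡ o ⊕ d ⊕ y ≼ o ⊕ e ⊕ y) l d h e o
                  (len Y) l+d≤h l+e)
              (lia 6 (λ l d h e o y → (l ⊕ e ≐ h) ∷ (h ≺ y) ∷ [] ⊢ˡ o ⊕ e ⊕ d ≼ o ⊕ d ⊕ y) l d h e o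
                  (len Y) l+e (Oc.s<Y Oh))
              (oc-per Oh Ol l+e) (oc-per Oh Ow w+d)

-- Minimum, maximum and quotient in the arithmetic of the machine

open import Defs using (applyOp; div)

≡ᵇ-reflects-≡ : ∀ m n → Reflects (m ≡ n) (m ≡ᵇ n)
≡ᵇ-reflects-≡ m n = fromEquivalence (≡ᵇ⇒≡ m n) (≡⇒≡ᵇ m n)

if-elim : ∀ {A : Set} (P : A → Set) b {x y} → (b ≡ true → P x) → (b ≡ false → P y) → P (if b then x else y)
if-elim P true  p q = p refl
if-elim P false p q = q refl

<ᵇ-true : ∀ m n → (m <ᵇ n) ≡ true → m < n
<ᵇ-true m n eq = <ᵇ⇒< m n (subst T (sym eq) tt)

<ᵇ-false : ∀ m n → (m <ᵇ n) ≡ false → n ≤ m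
<ᵇ-false m n eq = ≮⇒≥ λ m<n → subst T eq (<⇒<ᵇ m<n)

-- Written with truncated subtraction, so that the machine expressions `maxE` and `minE` evaluate to
-- them definitionally.
maxˢ minˢ quot : ℕ → ℕ → ℕ
maxˢ a b = a + (b ∸ a)
minˢ a b = a ∸ (a ∸ b)
quot = applyOp div

data MaxView (a b : ℕ) : ℕ → Set where
  maxˡ : b ≤ a → MaxView a b a
  maxʳ : a ≤ b → MaxView a b b

maxView : ∀ a b → MaxView a b (maxˢ a b)
maxView a b with ≤-total a b
... | inj₁ a≤b = subst (MaxView a b) (sym (m+[n∸m]≡n a≤b)) (maxʳ a≤b)
... | inj₂ b≤a = subst (MaxView a b) (sym (trans (cong (a +_) (m≤n⇒m∸n≡0 b≤a)) (+-identityʳ a))) (maxˡ b≤a)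

data MinView (a b : ℕ) : ℕ → Set where
  minˡ : a ≤ b → MinView a b a
  minʳ : b ≤ a → MinView a b b

minView : ∀ a b → MinView a b (minˢ a b)
minView a b with ≤-total a b
... | inj₁ a≤b = subst (MinView a b) (sym (cong (a ∸_) (m≤n⇒m∸n≡0 a≤b))) (minˡ a≤b)
... | inj₂ b≤a = subst (MinView a b) (sym (m∸[m∸n]≡n b≤a)) (minʳ b≤a)

max≥ˡ : ∀ a b → a ≤ maxˢ a b
max≥ˡ a b = m≤m+n a (b ∸ a)

max≥ʳ : ∀ a b → b ≤ maxˢ a b
max≥ʳ a b with maxˢ a b | maxView a b
... | _ | maxˡ b≤a = b≤a
... | _ | maxʳ _   = ≤-refl

max-lub : ∀ {a b c} → a ≤ c → b ≤ c → maxˢ a b ≤ c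
max-lub {a} {b} a≤c b≤c with maxˢ a b | maxView a b
... | _ | maxˡ _ = a≤c
... | _ | maxʳ _ = b≤c

min≤ˡ : ∀ a b → minˢ a b ≤ a
min≤ˡ a b = m∸n≤m a (a ∸ b)

min≤ʳ : ∀ a b → minˢ a b ≤ b
min≤ʳ a b with minˢ a b | minView a b
... | _ | minˡ a≤b = a≤b
... | _ | minʳ _   = ≤-refl

min-glb : ∀ {a b c} → c ≤ a → c ≤ b → c ≤ minˢ a b
min-glb {a} {b} c≤a c≤b with minˢ a b | minView a b
... | _ | minˡ _ = c≤a
... | _ | minʳ _ = c≤b

min-elim : ∀ (P : ℕ → Set) {a b} → P a → P b → P (minˢ a b)
min-elim P {a} {b} Pa Pb with minˢ a b | minView a b
... | _ | minˡ _ = Pa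
... | _ | minʳ _ = Pb

-- Table cells: arithmetical progressions given by largest element,
-- difference (0 for at most one element) and least element; 0 0 0 is empty.

record Cell : Set where
  constructor cell
  field
    hi gap lo : ℕ
open Cell public

-- Values may arrive in any order: `gap` is kept equal to the distance of the two largest distinct
-- values seen. A largest element 0 marks the empty cell, as the values inserted by the algorithm
-- are positive.
ins : ℕ → Cell → Cell
ins v (cell h g l) =
  if h ≡ᵇ 0 then cell v 0 v
  else if h <ᵇ v then cell v (v ∸ h) l
  else if v ≡ᵇ h then cell h g l
  else if (0 <ᵇ g) ∧ (g <ᵇ (h ∸ v)) then cell h g (minˢ l v)
  else cell h (h ∸ v) (minˢ l v)

data InsView (v : ℕ) : Cell → Cell → Set where
  into-empty : ∀ {g l} → InsView v (cell 0 g l) (cell v 0 v)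
  above      : ∀ {h g l} → 0 < h → h < v → InsView v (cell h g l) (cell v (v ∸ h) l)
  present    : ∀ {h g l} → 0 < h → v ≡ h → InsView v (cell h g l) (cell h g l)
  below-next : ∀ {h g l} → 0 < h → v < h → 0 < g → g < h ∸ v → InsView v (cell h g l) (cell h g (minˢ l v))
  above-next : ∀ {h g l} → 0 < h → v < h → (0 < g → h ∸ v ≤ g) → InsView v (cell h g l)
      (cell h (h ∸ v) (minˢ l v))

insView : ∀ v c → InsView v c (ins v c)
insView v (cell zero g l) = into-empty
insView v (cell h@(suc _) g l) with h <ᵇ v | <ᵇ-reflects-< h v
... | true  | ofʸ h<v = above z<s h<v
... | false | ofⁿ h≮v with v ≡ᵇ h | ≡ᵇ-reflects-≡ v h
...   | true  | ofʸ v≡h = present z<s v≡h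
...   | false | ofⁿ v≢h with 0 <ᵇ g | <ᵇ-reflects-< 0 g | g <ᵇ (h ∸ v) | <ᵇ-reflects-< g (h ∸ v)
...     | true  | ofʸ 0<g | true  | ofʸ lt = below-next z<s (≤∧≢⇒< (≮⇒≥ h≮v) v≢h) 0<g lt
...     | true  | ofʸ 0<g | false | ofⁿ ≮ = above-next z<s (≤∧≢⇒< (≮⇒≥ h≮v) v≢h) λ _ → ≮⇒≥ ≮
...     | false | ofⁿ 0≮g | _     | _      = above-next z<s (≤∧≢⇒< (≮⇒≥ h≮v) v≢h) λ 0<g → ⊥-elim (0≮g 0<g)

-- v does not lie strictly between the two largest elements of the cell.
record Covers (c : Cell) (v : ℕ) : Set where
  constructor covers
  field
    v≥1   : 1 ≤ v
    lo≤v  : lo c ≤ v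
    v≤hi  : v ≤ hi c
    apart : v ≡ hi c ⊎ (0 < gap c × v + gap c ≤ hi c)

record Filled (c : Cell) (S : ℕ → Set) : Set where
  constructor filled
  field
    lo≤hi : lo c ≤ hi c
    S-hi  : S (hi c)
    S-lo  : S (lo c)
    S-gap : gap c ≡ 0 ⊎ (0 < gap c × ∃ λ w → w + gap c ≡ hi c × S w)

-- The sound half of the invariant: the recorded numbers come from S. Nothing is said of elements
-- not yet inserted; `Complete` is the other half.
Valid : Cell → (ℕ → Set) → Set
Valid c S = c ≡ cell 0 0 0 ⊎ Filled c S

valid-map : ∀ {c} {S S′ : ℕ → Set} → (∀ v → S v → S′ v) → Valid c S → Valid c S′
valid-map f (inj₁ e) = inj₁ e
valid-map f (inj₂ (filled a b c (inj₁ e))) = inj₂ (filled a (f _ b) (f _ c) (inj₁ e))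
valid-map f (inj₂ (filled a b c (inj₂ (g , w , e , s)))) =
  inj₂ (filled a (f _ b) (f _ c) (inj₂ (g , w , e , f _ s)))

∸-pos : ∀ {m n} → m < n → 0 < n ∸ m
∸-pos = m<n⇒0<n∸m

ins-covers : ∀ {v c S} → 1 ≤ v → Valid c S → Covers (ins v c) v
ins-covers {v} {c} v≥1 V with ins v c | insView v c
... | _ | into-empty = covers v≥1 ≤-refl ≤-refl (inj₁ refl)
... | _ | present 0<h refl = covers v≥1 (lo≤hi V) ≤-refl (inj₁ refl)
  where
  lo≤hi : ∀ {h g l S} → Valid (cell h g l) S → l ≤ h
  lo≤hi (inj₁ refl) = ≤-refl
  lo≤hi (inj₂ F) = Filled.lo≤hi F
ins-covers {c = cell h g l} v≥1 (inj₁ refl) | _ | above () _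
ins-covers {c = cell h g l} v≥1 (inj₂ (filled l≤h _ _ _)) | _ | above 0<h h<v =
    covers v≥1 (≤-trans l≤h (<⇒≤ h<v)) ≤-refl (inj₁ refl)
ins-covers {v} {c = cell h g l} v≥1 V | _ | below-next 0<h v<h 0<g g< = covers v≥1 (min≤ʳ l v) (<⇒≤ v<h)
  (inj₂ (0<g , ≤-trans (+-monoʳ-≤ v (<⇒≤ g<)) (≤-reflexive (m+[n∸m]≡n (<⇒≤ v<h)))))
ins-covers {v} {c = cell h g l} v≥1 V | _ | above-next 0<h v<h g≥ = covers v≥1 (min≤ʳ l v) (<⇒≤ v<h)
  (inj₂ (∸-pos v<h , ≤-reflexive (m+[n∸m]≡n (<⇒≤ v<h))))

-- While the largest element stays, a known gap can only shrink. If the largest element rises from h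
-- to v, the new gap v - h still leaves every u ≤ h below it.
ins-mono : ∀ {v c u} → Covers c u → Covers (ins v c) u
ins-mono {v} {c} (covers u≥1 l≤u u≤h ap) with ins v c | insView v c
... | _ | into-empty = ⊥-elim (<⇒≱ u≥1 u≤h)
... | _ | present _ _ = covers u≥1 l≤u u≤h ap
ins-mono {v} {cell h g l} {u} (covers u≥1 l≤u u≤h ap) | _ | above 0<h h<v =
    covers u≥1 l≤u (≤-trans u≤h (<⇒≤ h<v))
  (inj₂ (∸-pos h<v , ≤-trans (+-monoˡ-≤ (v ∸ h) u≤h) (≤-reflexive (m+[n∸m]≡n (<⇒≤ h<v)))))
ins-mono {v} {cell h g l} {u} (covers u≥1 l≤u u≤h ap) | _ | below-next 0<h v<h 0<g g< =
  covers u≥1 (≤-trans (min≤ˡ l v) l≤u) u≤h ap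
ins-mono {v} {cell h g l} {u} (covers u≥1 l≤u u≤h (inj₁ u≡h)) | _ | above-next 0<h v<h g≥ =
  covers u≥1 (≤-trans (min≤ˡ l v) l≤u) u≤h (inj₁ u≡h)
ins-mono {v} {cell h g l} {u} (covers u≥1 l≤u u≤h (inj₂ (0<g , u+g≤h))) | _ | above-next 0<h v<h g≥ =
  covers u≥1 (≤-trans (min≤ˡ l v) l≤u) u≤h (inj₂ (∸-pos v<h , ≤-trans (+-monoʳ-≤ u (g≥ 0<g)) u+g≤h))

ins-valid : ∀ {v c S} → S v → Valid c S → Valid (ins v c) S
ins-valid {v} {c} Sv V with ins v c | insView v c
... | _ | into-empty = inj₂ (filled ≤-refl Sv Sv (inj₁ refl))
... | _ | present _ _ = V
ins-valid Sv (inj₁ refl) | _ | above () _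
ins-valid Sv (inj₁ refl) | _ | below-next () _ _ _
ins-valid Sv (inj₁ refl) | _ | above-next () _ _
ins-valid {v} {cell h g l} Sv (inj₂ (filled l≤h Sh Sl Sg)) | _ | above 0<h h<v =
  inj₂ (filled (≤-trans l≤h (<⇒≤ h<v)) Sv Sl (inj₂ (∸-pos h<v , h , m+[n∸m]≡n (<⇒≤ h<v) , Sh)))
ins-valid {v} {cell h g l} {S} Sv (inj₂ (filled l≤h Sh Sl Sg)) | _ | below-next 0<h v<h 0<g g< =
  inj₂ (filled (≤-trans (min≤ˡ l v) l≤h) Sh (min-elim S Sl Sv) Sg)
ins-valid {v} {cell h g l} {S} Sv (inj₂ (filled l≤h Sh Sl Sg)) | _ | above-next 0<h v<h g≥ =
  inj₂ (filled (≤-trans (min≤ˡ l v) l≤h) Sh (min-elim S Sl Sv)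
      (inj₂ (∸-pos v<h , v , m+[n∸m]≡n (<⇒≤ v<h) , Sv)))

infix 4 _∈ᶜ_
_∈ᶜ_ : ℕ → Cell → Set
x ∈ᶜ cell h g l = l ≤ x × x ≤ h × ∃ λ k → x + k * g ≡ h

Complete : Cell → (ℕ → Set) → Set
Complete c S = ∀ v → S v → Covers c v

module _ {S : ℕ → Set} (prog : Progressive S) where
  open Progressive prog using (spaced)

  cell-top : ∀ {c} → Valid c S → Complete c S → 0 < gap c → TopGap S (hi c) (gap c)
  cell-top (inj₁ refl) complete 0<g = ⊥-elim (n≮0 0<g)
  cell-top (inj₂ (filled _ _ _ (inj₁ g≡0))) complete 0<g = ⊥-elim (<⇒≢ 0<g (sym g≡0))
  cell-top {c} (inj₂ (filled _ Sh _ (inj₂ (_ , w , w+g , Sw)))) complete 0<g = topGap w Sh Sw w+g 0<g gap′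
    where
    gap′ : Gap S (hi c) (gap c)
    gap′ v Sv with Covers.apart (complete v Sv)
    ... | inj₁ e = inj₁ e
    ... | inj₂ (_ , le) = inj₂ le

  -- For a complete cell the stored gap is the true top gap, so `Progressive` fills in the elements
  -- between. The empty cell 0 0 0 formally contains 0, which 1 ≤ x excludes.
  cell-sound : ∀ {c x} → Valid c S → Complete c S → 1 ≤ x → x ∈ᶜ c → S x
  cell-sound (inj₁ refl) complete x≥1 (l≤x , x≤h , _) = ⊥-elim (<⇒≱ x≥1 x≤h)
  cell-sound {x = x} (inj₂ (filled _ Sh Sl (inj₁ g≡0))) complete x≥1 (l≤x , x≤h , k , eq) =
    subst S (trans (sym eq) (trans (cong (λ g → x + k * g) g≡0) (trans (cong (x +_) (*-zeroʳ k))
        (+-identityʳ x)))) Sh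
  cell-sound {x = x} V@(inj₂ (filled _ Sh Sl (inj₂ (0<g , _)))) complete x≥1 (l≤x , x≤h , k , eq) =
    Progressive.filled prog (cell-top V complete 0<g) Sl k x l≤x eq

  cell-complete : ∀ {c x} → Valid c S → Complete c S → S x → x ∈ᶜ c
  cell-complete {c} {x} V complete Sx with complete x Sx
  ... | covers _ l≤x x≤h (inj₁ refl) = l≤x , x≤h , 0 , +-identityʳ x
  ... | covers _ l≤x x≤h (inj₂ (0<g , _)) with spaced (cell-top V complete 0<g) Sx (m+[n∸m]≡n x≤h)
  ...   | divides q eq = l≤x , x≤h , q , trans (cong (x +_) (sym eq)) (m+[n∸m]≡n x≤h)

  cell-aligned : ∀ {c} → Valid c S → Complete c S → ∃ λ k → lo c + k * gap c ≡ hi c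
  cell-aligned (inj₁ refl) complete = 0 , refl
  cell-aligned V@(inj₂ F) complete with cell-complete V complete (Filled.S-lo F)
  ... | _ , _ , k , eq = k , eq

single : ∀ {c} → (∃ λ k → lo c + k * gap c ≡ hi c) → gap c ≡ 0 → lo c ≡ hi c
single {c} (k , eq) g≡0 =
  trans (sym (trans (cong (λ g → lo c + k * g) g≡0) (trans (cong (lo c +_) (*-zeroʳ k))
      (+-identityʳ (lo c))))) eq

-- Intersection of two progressions through at most three candidates

-- Since w lies below another covered value w′, it is not the largest element of the cell, hence at
-- least one gap below it; so is everything from u up to w.
covers-between : ∀ {c u w w′ x} → Covers c u → Covers c w → Covers c w′ → w < w′ → u ≤ x → x ≤ w → Covers c x
covers-between {c} {u} {w} {w′} {x} (covers u≥1 lo≤u _ _) (covers _ _ _ (inj₁ w≡h))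
    (covers _ _ w′≤h _) w<w′ u≤x x≤w =
  ⊥-elim (<⇒≱ w<w′ (subst (w′ ≤_) (sym w≡h) w′≤h))
covers-between {c} {u} {w} {w′} {x} (covers u≥1 lo≤u _ _) (covers _ _ w≤h (inj₂ (0<g , w+g≤h))) _ w<w′ u≤x
    x≤w =
  covers (≤-trans u≥1 u≤x) (≤-trans lo≤u u≤x) (≤-trans x≤w w≤h)
      (inj₂ (0<g , ≤-trans (+-monoˡ-≤ (gap c) x≤w) w+g≤h))

quot-≤ : ∀ m g → quot m g * g ≤ m
quot-≤ m zero    = z≤n
quot-≤ m (suc g) = m/n*n≤m m (suc g)

quot-max : ∀ {m g} k → 0 < g → k * g ≤ m → k ≤ quot m g
quot-max {m} {suc g} k _ le = subst (_≤ m / suc g) (m*n/n≡m k (suc g)) (/-monoˡ-≤ (suc g) le)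

quot-exact : ∀ {m g} k → k * g ≡ m → quot m g * g ≡ m
quot-exact {m} {zero}  k eq = trans (sym (*-zeroʳ k)) eq
quot-exact {m} {suc g} k eq = trans (cong (λ m → m / suc g * suc g) (sym eq))
    (trans (cong (_* suc g) (m*n/n≡m k (suc g))) eq)

-- The number v is the last term up to hi of the progression that starts at l, so x lies below it in
-- the same residue class. For g = 0 the quotient is 0 and v = l = x.
top-candidate : ∀ {l g hi x} k → l + k * g ≡ x → x ≤ hi →
                let v = l + quot (hi ∸ l) g * g in v ≤ hi × ∃ λ j → x + j * g ≡ v
top-candidate {l} {zero} {hi} {x} k eq x≤hi = subst (_≤ hi) (sym v≡x) x≤hi , 0 ,
    trans (+-identityʳ x) (sym v≡x)
  where
  v≡x : l + 0 ≡ x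
  v≡x = trans (cong (l +_) (sym (*-zeroʳ k))) eq
top-candidate {l} {g@(suc _)} {hi} {x} k refl x≤hi = v≤hi , q ∸ k , (begin
    l + k * g + (q ∸ k) * g   ≡⟨ +-assoc l _ _ ⟩
    l + (k * g + (q ∸ k) * g) ≡⟨ cong (l +_) (*-distribʳ-+ g k (q ∸ k)) ⟨
    l + (k + (q ∸ k)) * g     ≡⟨ cong (λ i → l + i * g) (m+[n∸m]≡n k≤q) ⟩
    l + q * g                 ∎)
  where
  open ≡-Reasoning
  q = quot (hi ∸ l) g
  l≤hi : l ≤ hi
  l≤hi = ≤-trans (m≤m+n l (k * g)) x≤hi
  k≤q : k ≤ q
  k≤q = quot-max k z<s (subst (_≤ hi ∸ l) (m+n∸m≡n l (k * g)) (∸-monoˡ-≤ l x≤hi))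
  v≤hi : l + q * g ≤ hi
  v≤hi = ≤-trans (+-monoʳ-≤ l (quot-≤ (hi ∸ l) g)) (≤-reflexive (m+[n∸m]≡n l≤hi))

bottom-candidate : ∀ {h g lo x} k → x + k * g ≡ h → lo ≤ x →
                   let v = h ∸ quot (h ∸ lo) g * g in lo ≤ v × ∃ λ j → v + j * g ≡ x
bottom-candidate {h} {zero} {lo} {x} k eq lo≤x = subst (lo ≤_) x≡h lo≤x , 0 , trans (+-identityʳ h) (sym x≡h)
  where
  x≡h : x ≡ h
  x≡h = trans (sym (trans (cong (x +_) (*-zeroʳ k)) (+-identityʳ x))) eq
bottom-candidate {h} {g@(suc _)} {lo} {x} k eq lo≤x = lo≤v , q ∸ k , +-cancelʳ-≡ (k * g) _ _ (begin
    v + (q ∸ k) * g + k * g   ≡⟨ +-assoc v _ _ ⟩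
    v + ((q ∸ k) * g + k * g) ≡⟨ cong (v +_) (*-distribʳ-+ g (q ∸ k) k) ⟨
    v + (q ∸ k + k) * g       ≡⟨ cong (λ i → v + i * g) (m∸n+n≡m k≤q) ⟩
    v + q * g                 ≡⟨ m∸n+n≡m qg≤h ⟩
    h                         ≡⟨ eq ⟨
    x + k * g                 ∎)
  where
  open ≡-Reasoning
  q = quot (h ∸ lo) g
  v = h ∸ q * g
  x≤h : x ≤ h
  x≤h = subst (x ≤_) eq (m≤m+n x (k * g))
  k≤q : k ≤ q
  k≤q = quot-max k z<s (≤-trans (≤-reflexive (trans (sym (m+n∸m≡n x (k * g))) (cong (_∸ x) eq)))
      (∸-monoʳ-≤ h lo≤x))
  qg≤ : q * g ≤ h ∸ lo
  qg≤ = quot-≤ (h ∸ lo) g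
  qg≤h : q * g ≤ h
  qg≤h = ≤-trans qg≤ (m∸n≤m h lo)
  lo≤v : lo ≤ v
  lo≤v = ≤-trans (≤-reflexive (sym (m∸[m∸n]≡n (≤-trans lo≤x x≤h)))) (∸-monoʳ-≤ h qg≤)

realign : ∀ {x j g v k h} → x + j * g ≡ v → x + k * g ≡ h → v ≤ h → ∃ λ i → v + i * g ≡ h
realign {x} {j} {g} {v} {k} {h} refl refl v≤h with ≤-total j k
... | inj₁ j≤k = k ∸ j , trans (+-assoc x _ _) (cong (x +_) (trans (sym (*-distribʳ-+ g j (k ∸ j)))
    (cong (_* g) (m+[n∸m]≡n j≤k))))
... | inj₂ k≤j = 0 , trans (+-identityʳ _) (≤-antisym v≤h (+-monoʳ-≤ x (*-monoˡ-≤ g k≤j)))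

record Range : Set where
  constructor range
  field
    c₁ c₂ : Cell
    rl rh : ℕ

  lowest highest : ℕ
  lowest  = maxˢ (maxˢ (lo c₁) (lo c₂)) rl
  highest = minˢ (minˢ (hi c₁) (hi c₂)) rh

  Target : ℕ → Set
  Target x = 1 ≤ x × rl ≤ x × x ≤ rh × x ∈ᶜ c₁ × x ∈ᶜ c₂

  -- Divisibility of m by g is tested as quot m g * g = m. For g = 0 this reads m = 0, so singletons
  -- need no separate test.
  passes : ℕ → Bool
  passes v = not (v <ᵇ lowest) ∧ not (highest <ᵇ v) ∧
             (quot (hi c₁ ∸ v) (gap c₁) * gap c₁ ≡ᵇ hi c₁ ∸ v) ∧
             (quot (hi c₂ ∸ v) (gap c₂) * gap c₂ ≡ᵇ hi c₂ ∸ v)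

  tryIns : ℕ → Cell → Cell
  tryIns v c = if passes v then ins v c else c

  -- Inside the common range these are the largest term of the progression of C, the term before it,
  -- and the least term.
  cand₁ cand₂ cand₃ : Cell → ℕ
  cand₁ C = lo C + quot (highest ∸ lo C) (gap C) * gap C
  cand₂ C = cand₁ C ∸ gap C
  cand₃ C = hi C ∸ quot (hi C ∸ lowest) (gap C) * gap C

  meetFrom : Cell → Cell → Cell
  meetFrom C c = tryIns (cand₃ C) (tryIns (cand₂ C) (tryIns (cand₁ C) c))

  -- At most two elements of the progression with the larger difference lie in
  -- the common range unless the differences agree.
  meet : Cell → Cell
  meet c = if gap c₁ <ᵇ gap c₂ then meetFrom c₂ c else meetFrom c₁ c

module _ (R : Range) where
  open Range R

  target-lowest : ∀ {x} → Target x → lowest ≤ x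
  target-lowest (_ , rl≤x , _ , (l₁≤x , _) , (l₂≤x , _)) = max-lub {maxˢ (lo c₁) (lo c₂)}
      (max-lub {lo c₁} l₁≤x l₂≤x) rl≤x

  target-highest : ∀ {x} → Target x → x ≤ highest
  target-highest (_ , _ , x≤rh , (_ , x≤h₁ , _) , (_ , x≤h₂ , _)) = min-glb {minˢ (hi c₁) (hi c₂)}
      (min-glb {hi c₁} x≤h₁ x≤h₂) x≤rh

  lo₁≤ : lo c₁ ≤ lowest
  lo₁≤ = ≤-trans (max≥ˡ (lo c₁) (lo c₂)) (max≥ˡ _ rl)
  lo₂≤ : lo c₂ ≤ lowest
  lo₂≤ = ≤-trans (max≥ʳ (lo c₁) (lo c₂)) (max≥ˡ _ rl)
  rl≤ : rl ≤ lowest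
  rl≤ = max≥ʳ (maxˢ (lo c₁) (lo c₂)) rl
  ≤hi₁ : highest ≤ hi c₁
  ≤hi₁ = ≤-trans (min≤ˡ _ rh) (min≤ˡ (hi c₁) (hi c₂))
  ≤hi₂ : highest ≤ hi c₂
  ≤hi₂ = ≤-trans (min≤ˡ _ rh) (min≤ʳ (hi c₁) (hi c₂))
  ≤rh : highest ≤ rh
  ≤rh = min≤ʳ (minˢ (hi c₁) (hi c₂)) rh

  target-intro : ∀ {v} k₁ k₂ → 1 ≤ v → lowest ≤ v → v ≤ highest →
                 v + k₁ * gap c₁ ≡ hi c₁ → v + k₂ * gap c₂ ≡ hi c₂ → Target v
  target-intro k₁ k₂ v≥1 l≤v v≤h e₁ e₂ = v≥1 , ≤-trans rl≤ l≤v , ≤-trans v≤h ≤rh ,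
    (≤-trans lo₁≤ l≤v , ≤-trans v≤h ≤hi₁ , k₁ , e₁) , (≤-trans lo₂≤ l≤v , ≤-trans v≤h ≤hi₂ , k₂ , e₂)

  passes-sound : ∀ {v} → 1 ≤ lowest → passes v ≡ true → Target v
  passes-sound {v} l≥1 eq
    with v <ᵇ lowest | <ᵇ-reflects-< v lowest | highest <ᵇ v | <ᵇ-reflects-< highest v
       | (quot (hi c₁ ∸ v) (gap c₁) * gap c₁ ≡ᵇ hi c₁ ∸ v) | ≡ᵇ-reflects-≡
           (quot (hi c₁ ∸ v) (gap c₁) * gap c₁) (hi c₁ ∸ v)
       | (quot (hi c₂ ∸ v) (gap c₂) * gap c₂ ≡ᵇ hi c₂ ∸ v) | ≡ᵇ-reflects-≡
           (quot (hi c₂ ∸ v) (gap c₂) * gap c₂) (hi c₂ ∸ v)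
  ... | false | ofⁿ ≮l | false | ofⁿ h≮ | true | ofʸ e₁ | true | ofʸ e₂ =
    target-intro (quot (hi c₁ ∸ v) (gap c₁)) (quot (hi c₂ ∸ v) (gap c₂)) (≤-trans l≥1 l≤v) l≤v v≤h
      (trans (cong (v +_) e₁) (m+[n∸m]≡n (≤-trans v≤h ≤hi₁)))
      (trans (cong (v +_) e₂) (m+[n∸m]≡n (≤-trans v≤h ≤hi₂)))
    where
    l≤v = ≮⇒≥ ≮l
    v≤h = ≮⇒≥ h≮

  passes-complete : ∀ {v} → Target v → passes v ≡ true
  passes-complete {v} t@(_ , _ , _ , (_ , v≤h₁ , k₁ , e₁) , (_ , v≤h₂ , k₂ , e₂))
    with v <ᵇ lowest | <ᵇ-reflects-< v lowest | highest <ᵇ v | <ᵇ-reflects-< highest v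
       | (quot (hi c₁ ∸ v) (gap c₁) * gap c₁ ≡ᵇ hi c₁ ∸ v) | ≡ᵇ-reflects-≡
           (quot (hi c₁ ∸ v) (gap c₁) * gap c₁) (hi c₁ ∸ v)
       | (quot (hi c₂ ∸ v) (gap c₂) * gap c₂ ≡ᵇ hi c₂ ∸ v) | ≡ᵇ-reflects-≡
           (quot (hi c₂ ∸ v) (gap c₂) * gap c₂) (hi c₂ ∸ v)
  ... | true | ofʸ v<l | _ | _ | _ | _ | _ | _ = ⊥-elim (<⇒≱ v<l (target-lowest t))
  ... | false | _ | true | ofʸ h<v | _ | _ | _ | _ = ⊥-elim (<⇒≱ h<v (target-highest t))
  ... | false | _ | false | _ | false | ofⁿ ¬e | _ | _ =
      ⊥-elim (¬e (quot-exact k₁ (+-cancelˡ-≡ v _ _ (trans e₁ (sym (m+[n∸m]≡n v≤h₁))))))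
  ... | false | _ | false | _ | true | _ | false | ofⁿ ¬e =
      ⊥-elim (¬e (quot-exact k₂ (+-cancelˡ-≡ v _ _ (trans e₂ (sym (m+[n∸m]≡n v≤h₂))))))
  ... | false | _ | false | _ | true | _ | true | _ = refl

  module _ {S : ℕ → Set} (l≥1 : 1 ≤ lowest) (sound : ∀ v → Target v → S v) where
    tryIns-valid : ∀ v {c} → Valid c S → Valid (tryIns v c) S
    tryIns-valid v V = if-elim (λ d → Valid d S) (passes v) (λ eq →
        ins-valid (sound v (passes-sound l≥1 eq)) V) (λ _ → V)

    meetFrom-valid : ∀ C {c} → Valid c S → Valid (meetFrom C c) S
    meetFrom-valid C V = tryIns-valid (cand₃ C) (tryIns-valid (cand₂ C) (tryIns-valid (cand₁ C) V))

    meet-valid : ∀ {c} → Valid c S → Valid (meet c) S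
    meet-valid V = if-elim (λ d → Valid d S) (gap c₁ <ᵇ gap c₂) (λ _ → meetFrom-valid c₂ V) (λ _ →
        meetFrom-valid c₁ V)

    tryIns-covers : ∀ v {c} → Valid c S → Target v → Covers (tryIns v c) v
    tryIns-covers v V t rewrite passes-complete t = ins-covers (proj₁ t) V

  tryIns-mono : ∀ v {c u} → Covers c u → Covers (tryIns v c) u
  tryIns-mono v {u = u} C = if-elim (λ d → Covers d u) (passes v) (λ _ → ins-mono C) (λ _ → C)

  meet-mono : ∀ {c u} → Covers c u → Covers (meet c) u
  meet-mono {u = u} C = if-elim (λ d → Covers d u) (gap c₁ <ᵇ gap c₂) (λ _ → from c₂) (λ _ → from c₁)
    where
    from : ∀ D → Covers (meetFrom D _) u
    from D = tryIns-mono (cand₃ D) (tryIns-mono (cand₂ D) (tryIns-mono (cand₁ D) C))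

  Aligned : Cell → Set
  Aligned c = ∃ λ k → lo c + k * gap c ≡ hi c

  Separated : Set
  Separated = gap c₁ ≢ gap c₂ → highest < lowest + (gap c₁ + gap c₂)

  module _ (C D : Cell) (larger : gap D ≤ gap C) (alignedC : Aligned C)
           (C-lo : lo C ≤ lowest) (C-hi : highest ≤ hi C) (D-hi : highest ≤ hi D)
           (separated : gap C ≢ gap D → highest < lowest + (gap C + gap D)) where
    private
      g = gap C
      v₁ = lo C + quot (highest ∸ lo C) g * g
      v₂ = v₁ ∸ g
      v₃ = hi C ∸ quot (hi C ∸ lowest) g * g

    -- Let x be j steps below v₁. If j = 0 or the step is 0, x is v₁. If the differences disagree,
    -- the range is shorter than two steps, so j = 1 and x is v₂. If they agree, one residue class
    -- serves both progressions, all three candidates are common elements, and x lies between v₃ and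
    -- v₂.
    candidates-cover : ∀ {c x} → 1 ≤ lowest → lowest ≤ x → x ≤ highest → x ∈ᶜ C → x ∈ᶜ D →
      (∀ v → v ≡ v₁ ⊎ v ≡ v₂ ⊎ v ≡ v₃ → lowest ≤ v → v ≤ highest →
        (∃ λ k → v + k * g ≡ hi C) → (∃ λ k → v + k * gap D ≡ hi D) → Covers c v) →
      Covers c x
    candidates-cover {c} {x} l≥1 l≤x x≤h (lo≤x , x≤hi , k , ek) (_ , _ , kD , ekD) cov
      with realign {lo C} {0} {g} {lo C} {proj₁ alignedC} {hi C} (+-identityʳ (lo C)) (proj₂ alignedC)
          (≤-trans lo≤x x≤hi)
    ... | K , eK
      with top-candidate {lo C} {g} {highest} {x} (K ∸ k) lo+ x≤h
      where
      kg≤Kg : k * g ≤ K * g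
      kg≤Kg = lia 5 (λ l x h a b → (x ⊕ a ≐ h) ∷ (l ⊕ b ≐ h) ∷ (l ≼ x) ∷ [] ⊢ˡ a ≼ b) (lo C) x (hi C) (k * g)
          (K * g) ek eK lo≤x
      lo+ : lo C + (K ∸ k) * g ≡ x
      lo+ = +-cancelʳ-≡ (k * g) _ _ (begin
        lo C + (K ∸ k) * g + k * g       ≡⟨ cong (λ y → lo C + y + k * g) (*-distribʳ-∸ g K k) ⟩
        lo C + (K * g ∸ k * g) + k * g   ≡⟨ +-assoc (lo C) _ _ ⟩
        lo C + (K * g ∸ k * g + k * g)   ≡⟨ cong (lo C +_) (m∸n+n≡m kg≤Kg) ⟩
        lo C + K * g                     ≡⟨ trans eK (sym ek) ⟩
        x + k * g                        ∎)
        where open ≡-Reasoning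
    ... | v₁≤h , zero , ej = cov-x
      where
      x≡v₁ : x ≡ v₁
      x≡v₁ = trans (sym (+-identityʳ x)) ej
      cov-x : Covers c x
      cov-x = cov x (inj₁ x≡v₁) l≤x x≤h (k , ek) (kD , ekD)
    ... | v₁≤h , suc j , ej with g ≟ gap D
    ...   | no g≢gD = cov x (inj₂ (inj₁ x≡v₂)) l≤x x≤h (k , ek) (kD , ekD)
      where
      one : ∀ j → x + (g + j * g) ≡ v₁ → x + g ≡ v₁
      one zero    e = trans (cong (x +_) (sym (+-identityʳ g))) e
      one (suc j) e = ⊥-elim (lia 7 (λ H L g d x v jg →
            (H ≺ L ⊕ (g ⊕ d)) ∷ (d ≼ g) ∷ (L ≼ x) ∷ (v ≼ H) ∷ (x ⊕ (g ⊕ (g ⊕ jg)) ≐ v) ∷ [] ⊢ˡ absurd)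
          highest lowest g (gap D) x v₁ (j * g) (separated g≢gD) larger l≤x v₁≤h e)
      x≡v₂ : x ≡ v₂
      x≡v₂ = trans (sym (m+n∸n≡m x g)) (cong (_∸ g) (one j ej))
    ...   | yes g≡gD with m≤n⇒m<n∨m≡n (z≤n {g})
    ...     | inj₂ 0≡g = cov x
        (inj₁ (trans (sym (trans (cong (λ g → x + suc j * g) (sym 0≡g)) (trans (cong (x +_) (*-zeroʳ (suc j)))
        (+-identityʳ x)))) ej)) l≤x x≤h (k , ek) (kD , ekD)
    ...     | inj₁ 0<g = cov-x
      where
      both : ∀ v i → x + i * g ≡ v → v ≤ highest → (∃ λ k → v + k * g ≡ hi C) × (∃ λ k → v + k * gap D ≡ hi D)
      both v i e v≤h = realign {x} {i} {g} {v} {k} e ek (≤-trans v≤h C-hi) ,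
                       realign {x} {i} {gap D} {v} {kD} (subst (λ g → x + i * g ≡ v) g≡gD e) ekD
                           (≤-trans v≤h D-hi)
      v₂≡ : x + j * g ≡ v₂
      v₂≡ = trans (sym (m+n∸n≡m (x + j * g) g))
          (cong (_∸ g) (trans (trans (+-assoc x (j * g) g) (cong (x +_) (+-comm (j * g) g))) ej))
      x≤v₂ : x ≤ v₂
      x≤v₂ = subst (x ≤_) v₂≡ (m≤m+n x (j * g))
      v₁≡v₂+g : v₂ + g ≡ v₁
      v₁≡v₂+g = trans (cong (_+ g) (sym v₂≡)) (trans (+-assoc x (j * g) g)
          (trans (cong (x +_) (+-comm (j * g) g)) ej))
      v₂<v₁ : v₂ < v₁
      v₂<v₁ = lia 3 (λ a b g → (a ⊕ g ≐ b) ∷ (con 0 ≺ g) ∷ [] ⊢ˡ a ≺ b) v₂ v₁ g v₁≡v₂+g 0<g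
      v₂≤h : v₂ ≤ highest
      v₂≤h = ≤-trans (<⇒≤ v₂<v₁) v₁≤h
      cov-x : Covers c x
      cov-x with bottom-candidate {hi C} {g} {lowest} {x} k ek l≤x
      ... | l≤v₃ , i , ei = covers-between
          (cov v₃ (inj₂ (inj₂ refl)) l≤v₃ (≤-trans v₃≤x x≤h) (i + k , up g k ei ek) (i + kD ,
              up (gap D) kD (subst (λ g → v₃ + i * g ≡ x) g≡gD ei) ekD))
          (cov v₂ (inj₂ (inj₁ refl)) (≤-trans l≤x x≤v₂) v₂≤h (proj₁ (both v₂ j v₂≡ v₂≤h))
              (proj₂ (both v₂ j v₂≡ v₂≤h)))
          (cov v₁ (inj₁ refl) (≤-trans l≤x (≤-trans x≤v₂ (<⇒≤ v₂<v₁))) v₁≤h (proj₁ (both v₁ (suc j) ej v₁≤h))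
              (proj₂ (both v₁ (suc j) ej v₁≤h)))
          v₂<v₁ v₃≤x x≤v₂
        where
        v₃≤x : v₃ ≤ x
        v₃≤x = subst (v₃ ≤_) ei (m≤m+n v₃ (i * g))
        up : ∀ g k {h} → v₃ + i * g ≡ x → x + k * g ≡ h → v₃ + (i + k) * g ≡ h
        up g k e e′ = trans (cong (v₃ +_) (*-distribʳ-+ g i k)) (trans (sym (+-assoc v₃ _ _))
            (trans (cong (_+ k * g) e) e′))

  module _ {S : ℕ → Set} (l≥1 : 1 ≤ lowest) (sound : ∀ v → Target v → S v)
           (aligned₁ : Aligned c₁) (aligned₂ : Aligned c₂) (separated : Separated) where

    private
      tried : ∀ C {c} → Valid c S → ∀ v → v ≡ cand₁ C ⊎ v ≡ cand₂ C ⊎ v ≡ cand₃ C → Target v →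
          Covers (meetFrom C c) v
      tried C V v (inj₁ refl) t =
        tryIns-mono (cand₃ C) (tryIns-mono (cand₂ C) (tryIns-covers l≥1 sound (cand₁ C) V t))
      tried C V v (inj₂ (inj₁ refl)) t =
        tryIns-mono (cand₃ C) (tryIns-covers l≥1 sound (cand₂ C) (tryIns-valid l≥1 sound (cand₁ C) V) t)
      tried C V v (inj₂ (inj₂ refl)) t =
        tryIns-covers l≥1 sound (cand₃ C) (tryIns-valid l≥1 sound (cand₂ C)
            (tryIns-valid l≥1 sound (cand₁ C) V)) t

      from₁ : ∀ {c x} → Valid c S → gap c₂ ≤ gap c₁ → Target x → Covers (meetFrom c₁ c) x
      from₁ V g₂≤g₁ t@(_ , _ , _ , x∈₁ , x∈₂) =
        candidates-cover c₁ c₂ g₂≤g₁ aligned₁ lo₁≤ ≤hi₁ ≤hi₂ separated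
          l≥1 (target-lowest t) (target-highest t) x∈₁ x∈₂
          λ v w l≤v v≤h (k₁ , e₁) (k₂ , e₂) →
              tried c₁ V v w (target-intro k₁ k₂ (≤-trans l≥1 l≤v) l≤v v≤h e₁ e₂)

      from₂ : ∀ {c x} → Valid c S → gap c₁ ≤ gap c₂ → Target x → Covers (meetFrom c₂ c) x
      from₂ V g₁≤g₂ t@(_ , _ , _ , x∈₁ , x∈₂) =
        candidates-cover c₂ c₁ g₁≤g₂ aligned₂ lo₂≤ ≤hi₂ ≤hi₁
          (λ ne → subst (λ y → highest < lowest + y) (+-comm (gap c₁) (gap c₂))
              (separated (λ e → ne (sym e))))
          l≥1 (target-lowest t) (target-highest t) x∈₂ x∈₁
          λ v w l≤v v≤h (k₂ , e₂) (k₁ , e₁) →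
              tried c₂ V v w (target-intro k₁ k₂ (≤-trans l≥1 l≤v) l≤v v≤h e₁ e₂)

    meet-covers : ∀ {c x} → Valid c S → Target x → Covers (meet c) x
    meet-covers {x = x} V t = if-elim (λ d → Covers d x) (gap c₁ <ᵇ gap c₂)
      (λ lt → from₂ V (<⇒≤ (<ᵇ-true (gap c₁) (gap c₂) lt)) t)
      (λ ge → from₁ V (<ᵇ-false (gap c₁) (gap c₂) ge) t)

record Rep (c : Cell) (S : ℕ → Set) : Set where
  constructor rep
  field
    positive    : ∀ {v} → S v → 1 ≤ v
    progressive : Progressive S
    valid       : Valid c S
    complete    : Complete c S

  sound : ∀ {x} → 1 ≤ x → x ∈ᶜ c → S x
  sound = cell-sound progressive valid complete

  member : ∀ {x} → S x → x ∈ᶜ c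
  member = cell-complete progressive valid complete

  aligned : ∃ λ k → lo c + k * gap c ≡ hi c
  aligned = cell-aligned progressive valid complete

  top : 0 < gap c → TopGap S (hi c) (gap c)
  top = cell-top progressive valid complete

  hi-bound : ∀ {b} → (∀ v → S v → v ≤ b) → hi c ≤ b
  hi-bound {b} f = go valid
    where
    go : Valid c S → hi c ≤ b
    go (inj₁ e) = subst (_≤ b) (sym (cong hi e)) z≤n
    go (inj₂ F) = f _ (Filled.S-hi F)

shift reflect : ℕ → Cell → Cell
shift a (cell h g l)   = cell (h + a) g (l + a)
reflect a (cell h g l) = cell (a ∸ l) g (a ∸ h)

shift-aligned : ∀ a c → (∃ λ k → lo c + k * gap c ≡ hi c) → ∃ λ k → lo (shift a c) + k * gap
    c ≡ hi (shift a c)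
shift-aligned a (cell h g l) (k , e) =
  k , lia 4 (λ l a h x → (l ⊕ x ≐ h) ∷ [] ⊢ˡ l ⊕ a ⊕ x ≐ h ⊕ a) l a h (k * g) e

reflect-aligned : ∀ a c → hi c ≤ a → (∃ λ k → lo c + k * gap c ≡ hi c) →
                  ∃ λ k → lo (reflect a c) + k * gap c ≡ hi (reflect a c)
reflect-aligned a (cell h g l) h≤a (k , e) = k , +-cancelʳ-≡ l _ _ (begin
  a ∸ h + k * g + l   ≡⟨ lia 3 (λ x y z → [] ⊢ˡ x ⊕ y ⊕ z ≐ x ⊕ (z ⊕ y)) (a ∸ h) (k * g) l ⟩
  a ∸ h + (l + k * g) ≡⟨ cong (a ∸ h +_) e ⟩
  a ∸ h + h           ≡⟨ m∸n+n≡m h≤a ⟩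
  a                   ≡⟨ m∸n+n≡m (≤-trans (subst (l ≤_) e (m≤m+n l (k * g))) h≤a) ⟨
  a ∸ l + l           ∎)
  where open ≡-Reasoning

shift-∈ : ∀ {a c x x′} → x′ + a ≡ x → x′ ∈ᶜ c → x ∈ᶜ shift a c
shift-∈ {a} {cell h g l} {x} {x′} refl (l≤ , ≤h , k , e) =
  +-monoˡ-≤ a l≤ , +-monoˡ-≤ a ≤h , k , lia 4 (λ x a h y → (x ⊕ y ≐ h) ∷ [] ⊢ˡ x ⊕ a ⊕ y ≐ h ⊕ a) x′ a h
      (k * g) e

shift-∈⁻ : ∀ {a c x} → x ∈ᶜ shift a c → ∃ λ x′ → x′ + a ≡ x × x′ ∈ᶜ c
shift-∈⁻ {a} {cell h g l} {x} (l≤ , ≤h , k , e) =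
  x ∸ a , x′+a , +-cancelʳ-≤ a _ _ (subst (l + a ≤_) (sym x′+a) l≤) , +-cancelʳ-≤ a _ _
      (subst (_≤ h + a) (sym x′+a) ≤h) ,
  k , lia 5 (λ x x′ a h y → (x ⊕ y ≐ h ⊕ a) ∷ (x′ ⊕ a ≐ x) ∷ [] ⊢ˡ x′ ⊕ y ≐ h) x (x ∸ a) a h (k * g) e x′+a
  where
  x′+a : x ∸ a + a ≡ x
  x′+a = m∸n+n≡m (≤-trans (m≤n+m a l) l≤)

align-below : ∀ {l K h g x k} → l + K * g ≡ h → x + k * g ≡ h → l ≤ x → ∃ λ i → l + i * g ≡ x
align-below {l} {K} {h} {g} {x} {k} e e′ l≤x = K ∸ k , +-cancelʳ-≡ (k * g) _ _ (begin
    l + (K ∸ k) * g + k * g       ≡⟨ cong (λ y → l + y + k * g) (*-distribʳ-∸ g K k) ⟩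
    l + (K * g ∸ k * g) + k * g   ≡⟨ +-assoc l _ _ ⟩
    l + (K * g ∸ k * g + k * g)   ≡⟨ cong (l +_)
        (m∸n+n≡m (lia 5 (λ l x h a b → (x ⊕ a ≐ h) ∷ (l ⊕ b ≐ h) ∷ (l ≼ x) ∷ [] ⊢ˡ a ≼ b) l x h (k * g)
        (K * g) e′ e l≤x)) ⟩
    l + K * g                     ≡⟨ trans e (sym e′) ⟩
    x + k * g                     ∎)
  where open ≡-Reasoning

reflect-∈ : ∀ {a c x x′} → hi c ≤ a → (∃ λ k → lo c + k * gap c ≡ hi c) → x + x′ ≡ a →
    x′ ∈ᶜ c → x ∈ᶜ reflect a c
reflect-∈ {a} {cell h g l} {x} {x′} h≤a (K , eK) x+x′ (l≤ , ≤h , k , e) with align-below {K =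
    K} {k = k} eK e l≤
... | i , ei =
  lia 4 (λ y h a x → (y ⊕ h ≐ a) ∷ (a ≼ x ⊕ h) ∷ [] ⊢ˡ y ≼ x) (a ∸ h) h a x (m∸n+n≡m h≤a)
      (subst (_≤ x + h) x+x′ (+-monoʳ-≤ x ≤h)) ,
  lia 4 (λ y l a x → (y ⊕ l ≐ a) ∷ (x ⊕ l ≼ a) ∷ [] ⊢ˡ x ≼ y) (a ∸ l) l a x a∸l+l (subst (x + l ≤_) x+x′
      (+-monoʳ-≤ x l≤)) ,
  i , lia 6 (λ y l a x x′ ig → (y ⊕ l ≐ a) ∷ (x ⊕ x′ ≐ a) ∷ (l ⊕ ig ≐ x′) ∷ [] ⊢ˡ x ⊕ ig ≐ y) (a ∸ l) l a x x′
      (i * g) a∸l+l x+x′ ei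
  where
  a∸l+l : a ∸ l + l ≡ a
  a∸l+l = m∸n+n≡m (≤-trans l≤ (≤-trans ≤h h≤a))

reflect-∈⁻ : ∀ {a c x} → hi c ≤ a → (∃ λ k → lo c + k * gap c ≡ hi c) → x ∈ᶜ reflect a c → ∃ λ x′ →
    x + x′ ≡ a × x′ ∈ᶜ c
reflect-∈⁻ {a} {cell h g l} {x} h≤a (K , eK) (l≤ , ≤h , k , e) = x′ , x+x′ ,
  l≤x′ , x′≤h , realign {l} {k} {g} {x′} {K} l+kg eK x′≤h
  where
  l≤a : l ≤ a
  l≤a = ≤-trans (subst (l ≤_) eK (m≤m+n l (K * g))) h≤a
  x′ = a ∸ x
  x+x′ : x + x′ ≡ a
  x+x′ = m+[n∸m]≡n (≤-trans ≤h (m∸n≤m a l))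
  l+kg : l + k * g ≡ x′
  l+kg = lia 6 (λ y l a x x′ kg → (y ⊕ l ≐ a) ∷ (x ⊕ x′ ≐ a) ∷ (x ⊕ kg ≐ y) ∷ [] ⊢ˡ l ⊕ kg ≐ x′) (a ∸ l) l a x
      x′ (k * g) (m∸n+n≡m l≤a) x+x′ e
  l≤x′ : l ≤ x′
  l≤x′ = subst (l ≤_) l+kg (m≤m+n l (k * g))
  x′≤h : x′ ≤ h
  x′≤h = lia 5 (λ y h a x x′ → (y ⊕ h ≐ a) ∷ (x ⊕ x′ ≐ a) ∷ (y ≼ x) ∷ [] ⊢ˡ x′ ≼ h) (a ∸ h) h a x x′
      (m∸n+n≡m h≤a) x+x′ l≤

-- A cell with gap 0 has one element, which squeezes the common range to at most one point. Hence
-- only two positive differences have to be compared.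
separated-intro : ∀ {R} → let open Range R in Aligned R c₁ → Aligned R c₂ →
  (0 < gap c₁ → 0 < gap c₂ → lowest + (gap c₁ + gap c₂) ≤ highest → gap c₁ ≡ gap c₂) → Separated R
separated-intro {R} al₁ al₂ f ne = ≰⇒> λ long → go long (m≤n⇒m<n∨m≡n (z≤n {gap c₁}))
    (m≤n⇒m<n∨m≡n (z≤n {gap c₂}))
  where
  open Range R
  go : lowest + (gap c₁ + gap c₂) ≤ highest → 0 < gap c₁ ⊎ 0 ≡ gap c₁ → 0 < gap c₂ ⊎ 0 ≡ gap c₂ → ⊥
  go long (inj₁ p) (inj₁ q) = ne (f p q long)
  go long (inj₂ p) (inj₂ q) = ne (trans (sym p) q)
  go long (inj₂ p) (inj₁ q) =
    lia 5 (λ L H g₁ g₂ h → (L ⊕ (g₁ ⊕ g₂) ≼ H) ∷ (con 0 ≺ g₂) ∷ (H ≼ h) ∷ (h ≼ L) ∷ [] ⊢ˡ absurd) lowest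
        highest (gap c₁) (gap c₂) (hi c₁)
      long q (≤hi₁ R) (subst (_≤ lowest) (single al₁ (sym p)) (lo₁≤ R))
  go long (inj₁ p) (inj₂ q) =
    lia 5 (λ L H g₁ g₂ h → (L ⊕ (g₁ ⊕ g₂) ≼ H) ∷ (con 0 ≺ g₁) ∷ (H ≼ h) ∷ (h ≼ L) ∷ [] ⊢ˡ absurd) lowest
        highest (gap c₁) (gap c₂) (hi c₂)
      long p (≤hi₂ R) (subst (_≤ lowest) (single al₂ (sym q)) (lo₂≤ R))

module _ {X X₁ Y Y₁ Y₂ : Str} {x₂ i j : ℕ} (catY : Cat Y Y₁ Y₂) {a b : Cell}
         (A : Rep a (OvScale X₁ Y i)) (B : Rep b (OvScale X Y₂ j)) where
  -- The differences are the least periods of prefixes of Y and of Y₂. Values from |X₂| + |Y₁| on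
  -- force the prefix of Y to reach that far beyond its cut, so the common range becomes a common
  -- factor at the start of Y₂.
  separated-long : ∀ rl rh → x₂ + len Y₁ ≤ rl → Separated (range (shift x₂ a) (shift (len Y₁) b) rl rh)
  separated-long rl rh s≤rl = separated-intro {R} (shift-aligned x₂ a (Rep.aligned A)) (shift-aligned (len Y₁)
      b (Rep.aligned B)) go
    where
    R = range (shift x₂ a) (shift (len Y₁) b) rl rh
    open Range R using (lowest; highest)
    go : 0 < gap a → 0 < gap b → lowest + (gap a + gap b) ≤ highest → gap a ≡ gap b
    go 0<a 0<b long = common-factor {at Y} {0} {hi a} {gap a} {at Y₂} {0} {hi b} {gap b} {len Y₁}
        {0} {gap a + gap b}
      (ov-minPer {t = i} (Rep.top A 0<a)) (ov-minPer {t = j} (Rep.top B 0<b)) 0<a 0<b z≤n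
      (lia 7 (λ x y g h L H rl → (x ⊕ y ≼ rl) ∷ (rl ≼ L) ∷ (L ⊕ g ≼ H) ∷ (H ≼ h ⊕ x) ∷ [] ⊢ˡ y ⊕ g ≼ h)
        x₂ (len Y₁) (gap a + gap b) (hi a) lowest highest rl s≤rl (rl≤ R) long (≤hi₁ R))
      z≤n g≤
      (λ z z< → Cat.snd-at catY z (<-≤-trans z< (≤-trans g≤ (Ov.l≤Y (proj₁ (TopGap.S-top (Rep.top B 0<b)))))))
      ≤-refl
      where
      g≤ : gap a + gap b ≤ hi b
      g≤ = lia 7 (λ x y g h L H rl → (x ⊕ y ≼ rl) ∷ (rl ≼ L) ∷ (L ⊕ g ≼ H) ∷ (H ≼ h ⊕ y) ∷ [] ⊢ˡ g ≼ h)
        x₂ (len Y₁) (gap a + gap b) (hi b) lowest highest rl s≤rl (rl≤ R) long (≤hi₂ R)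

module _ {X Y Y₁ Y₂ X₂ : Str} {x₁ : ℕ} (catY : Cat Y Y₁ Y₂) {a b : Cell}
         (A : Rep a (Oc X x₁ Y₁)) (B : Rep b (Oc Y (len Y₁) X₂)) where
  -- The periodic stretch of X begins with a copy of Y₁, and that of Y begins hi b letters before
  -- the end of Y₁. These hi b letters belong to both, and a long common range forces hi b to be at
  -- least the sum of the differences.
  separated-cross : ∀ rl rh → hi b ≤ len X₂ + len Y₁ →
    Separated (range (shift (len X₂) a) (reflect (len X₂ + len Y₁) b) rl rh)
  separated-cross rl rh hb≤ = separated-intro {R} (shift-aligned (len X₂) a (Rep.aligned A))
      (reflect-aligned (len X₂ + len Y₁) b hb≤ (Rep.aligned B)) go
    where
    s = len X₂ + len Y₁
    R = range (shift (len X₂) a) (reflect s b) rl rh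
    open Range R using (lowest; highest)
    go : 0 < gap a → 0 < gap b → lowest + (gap a + gap b) ≤ highest → gap a ≡ gap b
    go 0<a 0<b long = common-factor {at X} {oA} {oA + gap a + len Y₁} {gap a} {at Y} {oB}
        {oB + gap b + len X₂} {gap b} {oA + oB} {oB} {m}
      (oc-minPer TA) (oc-minPer TB) 0<a 0<b (m≤m+n oA oB)
      (lia 6 (λ oA oB m h y g → (oB ⊕ h ≐ y) ∷ (m ≼ h) ∷ [] ⊢ˡ oA ⊕ oB ⊕ m ≼ oA ⊕ g ⊕ y) oA oB m (hi b)
          (len Y₁) (gap a) (Oc.off+s OB) m≤h)
      ≤-refl
      (lia 5 (λ o m h g x → (m ≼ h) ∷ (h ≺ x) ∷ [] ⊢ˡ o ⊕ m ≼ o ⊕ g ⊕ x) oB m (hi b) (gap b)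
          (len X₂) m≤h (Oc.s<Y OB))
      (λ z z<m → let w< = lia 5 (λ o z m h y → (z ≺ m) ∷ (m ≼ h) ∷ (o ⊕ h ≐ y) ∷ [] ⊢ˡ o ⊕ z ≺ y) oB z m (hi b) (len Y₁) z<m m≤h (Oc.off+s OB) in
        trans (cong (at X) (+-assoc oA oB z)) (trans (Oc.match OA (oB + z) w<)
            (sym (Cat.fst-at catY (oB + z) w<))))
      ≤-refl
      where
      TA = Rep.top A 0<a
      TB = Rep.top B 0<b
      OA = TopGap.S-top TA
      OB = TopGap.S-top TB
      oA = Oc.off OA
      oB = Oc.off OB
      m = gap a + gap b
      m≤h : m ≤ hi b
      m≤h = lia 8 (λ x y m ha hb L H u → (u ⊕ hb ≐ x ⊕ y) ∷ (u ≼ L) ∷ (L ⊕ m ≼ H) ∷ (H ≼ ha ⊕ x) ∷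
          (ha ≺ y) ∷ [] ⊢ˡ m ≼ hb)
        (len X₂) (len Y₁) m (hi a) (hi b) lowest highest (s ∸ hi b) (m∸n+n≡m hb≤) (lo₂≤ R) long
            (≤hi₁ R) (Oc.s<Y OA)

module _ {X₁ X₂ Y : Str} {i j : ℕ} {a b : Cell}
         (A : Rep a (OvScale X₁ Y i)) (B : Rep b (OvScale Y X₂ j)) where
  -- The periodic prefix of X₂ is also a suffix of Y, starting at |Y| - hi b. The common range
  -- measures how far it meets the periodic prefix of Y of length hi a.
  separated-ends : ∀ rl rh → hi b ≤ len Y → Separated (range (shift 0 a) (reflect (len Y) b) rl rh)
  separated-ends rl rh hb≤ = separated-intro {R} (shift-aligned 0 a (Rep.aligned A)) (reflect-aligned (len Y)
      b hb≤ (Rep.aligned B)) go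
    where
    R = range (shift 0 a) (reflect (len Y) b) rl rh
    open Range R using (lowest; highest)
    go : 0 < gap a → 0 < gap b → lowest + (gap a + gap b) ≤ highest → gap a ≡ gap b
    go 0<a 0<b long = common-factor {at Y} {0} {hi a} {gap a} {at X₂} {0} {hi b} {gap b} {o} {0} {m}
      (ov-minPer {t = i} TA) (ov-minPer {t = j} TB) 0<a 0<b z≤n o+m≤ z≤n m≤ (λ z z<m →
          Ov.match OB z (<-≤-trans z<m m≤)) ≤-refl
      where
      TA = Rep.top A 0<a
      TB = Rep.top B 0<b
      OB = proj₁ (TopGap.S-top TB)
      o = Ov.off OB
      m = gap a + gap b
      o+m≤ : o + m ≤ hi a
      o+m≤ = lia 8 (λ o m ha hb y u L H → (o ⊕ hb ≐ y) ∷ (u ⊕ hb ≐ y) ∷ (u ≼ L) ∷ (L ⊕ m ≼ H) ∷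
          (H ≼ ha ⊕ con 0) ∷ [] ⊢ˡ o ⊕ m ≼ ha)
        o m (hi a) (hi b) (len Y) (len Y ∸ hi b) lowest highest (Ov.off+l OB) (m∸n+n≡m hb≤)
            (lo₂≤ R) long (≤hi₁ R)
      m≤ : m ≤ hi b
      m≤ = lia 5 (λ o m ha hb y → (o ⊕ m ≼ ha) ∷ (ha ≼ y) ∷ (o ⊕ hb ≐ y) ∷ [] ⊢ˡ m ≼ hb) o m
          (hi a) (hi b) (len Y)
        o+m≤ (Ov.l≤Y (proj₁ (TopGap.S-top TA))) (Ov.off+l OB)

open import Defs

-- Total correctness with time bounds

Run : ℕ → Program → State → ℕ → (State → Set) → Set
Run B P s t Q = ∃ λ u → ∃ λ s′ → B ⊢ P , s ⇓[ u ] s′ × u ≤ t × Q s′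

run-weaken : ∀ {B P s t t′ Q Q′} → t ≤ t′ → (∀ s′ → Q s′ → Q′ s′) → Run B P s t Q → Run B P s t′ Q′
run-weaken t≤t′ f (u , s′ , d , u≤t , q) = u , s′ , d , ≤-trans u≤t t≤t′ , f s′ q

run-seq : ∀ {B P P′ s t t′ Q Q′} → Run B P s t Q → (∀ s′ → Q s′ → Run B P′ s′ t′ Q′) →
    Run B (P ⨾ P′) s (t + t′) Q′
run-seq (u , s′ , d , u≤t , q) f with f s′ q
... | u′ , s″ , d′ , u′≤t′ , q′ = u + u′ , s″ , seq d d′ , +-mono-≤ u≤t u′≤t′ , q′

update-same : ∀ {A : Set} (f : ℕ → A) i v → update f i v i ≡ v
update-same f i v with i ≡ᵇ i | ≡⇒≡ᵇ i i refl
... | true | _ = refl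

update-other : ∀ {A : Set} (f : ℕ → A) i v j → j ≢ i → update f i v j ≡ f j
update-other f i v j j≢i with j ≡ᵇ i | ≡ᵇ⇒≡ j i
... | true  | e = ⊥-elim (j≢i (e tt))
... | false | _ = refl

forLoop : ℕ → Exp → Program → Program
forLoop r e P = set r (lit 0) ⨾ while (lt (reg r) e) (P ⨾ set r (op add (reg r) (lit 1)))

module _ {B r e P} (I : ℕ → State → Set) (b t : ℕ) (b<B : b < B)
  (bound : ∀ k s → I k s → eval e s ≡ b × Fits B e s)
  (body : ∀ k s → k < b → I k s → regs s r ≡ k →
          Run B P s t (λ s′ → regs s′ r ≡ k × I (suc k) (setReg r (suc k) s′))) where

  private
    while-run : ∀ m k s → k + m ≡ b → I k s → regs s r ≡ k →
                Run B (while (lt (reg r) e) (P ⨾ set r (op add (reg r) (lit 1)))) s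
                  (m * (t + cost e + 7) + (3 + cost e)) (I b)
    while-run zero k s k+0≡b Ik rk =
      _ , s , while-false (tt , proj₂ (bound k s Ik)) (test-false) , ≤-refl , subst (λ k → I k s)
          (trans (sym (+-identityʳ k)) k+0≡b) Ik
      where
      test-false : (regs s r <ᵇ eval e s) ≡ false
      test-false = subst₂ (λ u v → (u <ᵇ v) ≡ false) (sym rk)
          (sym (trans (proj₁ (bound k s Ik)) (trans (sym k+0≡b) (+-identityʳ k)))) (irr k)
        where
        irr : ∀ k → (k <ᵇ k) ≡ false
        irr zero = refl
        irr (suc k) = irr k
    while-run (suc m) k s k+m≡b Ik rk with body k s k<b Ik rk
      where
      k<b : k < b
      k<b = subst (k <_) k+m≡b (m<m+n k z<s)
    ... | u , s₁ , d , u≤t , rk₁ , Ik₁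
      with while-run m (suc k) (setReg r (suc k) s₁) (trans (sym (+-suc k m)) k+m≡b) Ik₁
          (update-same (regs s₁) r (suc k))
    ... | v , s₂ , d′ , v≤ , Ib =
      _ , s₂ , while-true (tt , proj₂ (bound k s Ik)) test-true (seq d step)
          (subst (λ s → B ⊢ while (lt (reg r) e) (P ⨾ set r (op add (reg r) (lit 1))) , s ⇓[ v ] s₂) s≡ d′) ,
      lia 5 (λ u t c v x → (u ≼ t) ∷ (v ≼ x ⊕ (con 3 ⊕ c)) ∷ [] ⊢ˡ con 3 ⊕ c ⊕ (u ⊕ con 4) ⊕ v ≼ t ⊕ c ⊕ con
          7 ⊕ x ⊕ (con 3 ⊕ c))
        u t (cost e) v (m * (t + cost e + 7)) u≤t v≤ , Ib
      where
      k<b : k < b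
      k<b = subst (k <_) k+m≡b (m<m+n k z<s)
      test-true : (regs s r <ᵇ eval e s) ≡ true
      test-true = subst₂ (λ u v → (u <ᵇ v) ≡ true) (sym rk) (sym (proj₁ (bound k s Ik))) (lt-true k<b)
        where
        lt-true : ∀ {m n} → m < n → (m <ᵇ n) ≡ true
        lt-true {m} {n} p with m <ᵇ n | <⇒<ᵇ p
        ... | true | _ = refl
      s≡ : setReg r (suc k) s₁ ≡ setReg r (regs s₁ r + 1) s₁
      s≡ = cong (λ v → setReg r v s₁) (sym (trans (cong (_+ 1) rk₁) (+-comm k 1)))
      r≤B : regs s₁ r + 1 ≤ B
      r≤B = subst (_≤ B) (sym (trans (cong (_+ 1) rk₁) (+-comm k 1))) (≤-trans k<b (<⇒≤ b<B))
      step : B ⊢ set r (op add (reg r) (lit 1)) , s₁ ⇓[ 4 ] setReg r (regs s₁ r + 1) s₁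
      step = set (tt , tt , ≤-trans (m≤m+n _ 1) r≤B , ≤-trans (s≤s z≤n) b<B , r≤B)

  -- Each pass costs t for the body, 3 + cost e for the test and 4 for the increment; setting the
  -- counter takes 2 and the failing test 3 + cost e.
  for-run : ∀ s → I 0 (setReg r 0 s) → Run B (forLoop r e P) s (b * (t + cost e + 7) + (5 + cost e)) (I b)
  for-run s I₀ with while-run b 0 (setReg r 0 s) refl I₀ (update-same (regs s) r 0)
  ... | u , s′ , d , u≤ , Ib = 2 + u , s′ , seq (set tt) d ,
    lia 3 (λ u x c → (u ≼ x ⊕ (con 3 ⊕ c)) ∷ [] ⊢ˡ con 2 ⊕ u ≼ x ⊕ (con 5 ⊕ c)) u
        (b * (t + cost e + 7)) (cost e) u≤ , Ib

-- Loop-free programs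

-- The clause for `while` is a dummy: `FitsP`, `Frame` and `OkP` are empty on loops, which are
-- treated by `for-run`.
exec : Program → State → State
exec skip           s = s
exec (set x e)      s = setReg x (eval e s) s
exec (store a e f)  s = setCell a (eval e s) (eval f s) s
exec (emit e)       s = write (eval e s) s
exec (P ⨾ Q)        s = exec Q (exec P s)
exec (branch b P Q) s = if test b s then exec P s else exec Q s
exec (while b P)    s = s

-- An upper bound: both branches are added, which keeps the time of a program a plain sum of its
-- parts.
time : Program → ℕ
time skip           = 1
time (set x e)      = 1 + cost e
time (store a e f)  = 1 + cost e + cost f
time (emit e)       = 1 + cost e
time (P ⨾ Q)        = time P + time Q
time (branch b P Q) = 1 + costTest b + (time P + time Q)
time (while b P)    = 0

FitsP : ℕ → Program → State → Set
FitsP B skip           s = ⊤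
FitsP B (set x e)      s = Fits B e s
FitsP B (store a e f)  s = Fits B e s × eval e s ≤ B × Fits B f s
FitsP B (emit e)       s = Fits B e s
FitsP B (P ⨾ Q)        s = FitsP B P s × FitsP B Q (exec P s)
FitsP B (branch b P Q) s = FitsTest B b s × (test b s ≡ true → FitsP B P s) × (test b s ≡ false → FitsP B Q s)
FitsP B (while b P)    s = ⊥

run-branch : ∀ {B b P P′ s t t′ Q} → FitsTest B b s →
  (test b s ≡ true → Run B P s t Q) → (test b s ≡ false → Run B P′ s t′ Q) →
  Run B (branch b P P′) s (1 + costTest b + (t + t′)) Q
run-branch {B} {b} {P} {P′} {s} {t} {t′} {Q} fits f g = go (test b s) refl
  where
  go : ∀ v → test b s ≡ v → Run B (branch b P P′) s (1 + costTest b + (t + t′)) Q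
  go true e≡ with f e≡
  ... | u , s′ , d , u≤ , q = _ , s′ , branch-true fits e≡ d , +-monoʳ-≤ (1 + costTest b) (m≤n⇒m≤n+o t′ u≤) ,
      q
  go false e≡ with g e≡
  ... | u , s′ , d , u≤ , q = _ , s′ , branch-false fits e≡ d , +-monoʳ-≤ (1 + costTest b) (m≤n⇒m≤o+n t u≤) ,
      q

run-exec : ∀ {B} P s → FitsP B P s → Run B P s (time P) (λ s′ → s′ ≡ exec P s)
run-exec skip           s f = _ , _ , skip , ≤-refl , refl
run-exec (set x e)      s f = _ , _ , set f , ≤-refl , refl
run-exec (store a e g)  s (f , i , f′) = _ , _ , store f i f′ , ≤-refl , refl
run-exec (emit e)       s f = _ , _ , emit f , ≤-refl , refl
run-exec (P ⨾ Q)        s (f , g) = run-seq (run-exec P s f) λ { _ refl → run-exec Q (exec P s) g }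
run-exec (branch b P Q) s (f , g , h) = run-branch f
  (λ e≡ → run-weaken ≤-refl (λ s′ e → trans e (cong (λ v → if v then exec P s else exec Q s) (sym e≡)))
      (run-exec P s (g e≡)))
  (λ e≡ → run-weaken ≤-refl (λ s′ e → trans e (cong (λ v → if v then exec P s else exec Q s) (sym e≡)))
      (run-exec Q s (h e≡)))

-- A syntactic check that only registers from k and arrays from m are written and nothing is
-- printed. On a concrete program it normalizes to unit types and proves itself.
Frame : ℕ → ℕ → Program → Set
Frame k m skip           = ⊤
Frame k m (set x e)      = T (k ≤ᵇ x)
Frame k m (store a e f)  = T (m ≤ᵇ a)
Frame k m (emit e)       = ⊥
Frame k m (P ⨾ Q)        = Frame k m P × Frame k m Q
Frame k m (branch b P Q) = Frame k m P × Frame k m Q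
Frame k m (while b P)    = ⊥

record Same (k m : ℕ) (s s′ : State) : Set where
  constructor same
  field
    sameRegs   : ∀ r → r < k → regs s′ r ≡ regs s r
    sameArrays : ∀ a → a < m → arrays s′ a ≡ arrays s a
    sameOutput : output s′ ≡ output s
open Same public

same-refl : ∀ {k m s} → Same k m s s
same-refl = same (λ _ _ → refl) (λ _ _ → refl) refl

same-trans : ∀ {k m s s′ s″} → Same k m s s′ → Same k m s′ s″ → Same k m s s″
same-trans (same a b c) (same a′ b′ c′) =
  same (λ r l → trans (a′ r l) (a r l)) (λ x l → trans (b′ x l) (b x l)) (trans c′ c)

frame : ∀ {k m} P s → Frame k m P → Same k m s (exec P s)
frame skip           s f = same-refl
frame {k} (set x e)  s f = same (λ r r<k → update-other (regs s) x _ r (<⇒≢ (<-≤-trans r<k (≤ᵇ⇒≤ k x f))))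
    (λ _ _ → refl) refl
frame {m = m} (store a e g) s f =
  same (λ _ _ → refl) (λ b b<m → update-other (arrays s) a _ b (<⇒≢ (<-≤-trans b<m (≤ᵇ⇒≤ m a f)))) refl
frame (P ⨾ Q)        s (f , g) = same-trans (frame P s f) (frame Q (exec P s) g)
frame {k} {m} (branch b P Q) s (f , g) =
  if-elim (Same k m s) (test b s) (λ _ → frame P s f) (λ _ → frame Q s g)

-- Static bounds M ^ degree on the contents of registers and arrays

module Degrees (M w : ℕ) (4≤M : 4 ≤ M) (Γ : ℕ → ℕ) (Δ : ℕ → Maybe ℕ) where
  degOp : Op → ℕ → ℕ → ℕ
  degOp add d e = suc (d ⊔ e)
  degOp sub d e = d
  degOp mul d e = d + e
  degOp div d e = d

  degOp′ : Op → Maybe ℕ → Maybe ℕ → Maybe ℕ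
  degOp′ o (just d) (just e) = just (degOp o d e)
  degOp′ o _        _        = nothing

  -- The value `nothing` means that no static bound is available, as for letter codes; such values
  -- may be moved and compared but not computed with.
  deg : Exp → Maybe ℕ
  deg (lit m)    = if m ≤ᵇ 4 then just 1 else nothing
  deg (reg x)    = just (Γ x)
  deg (a ⟦ e ⟧)  = Δ a
  deg (op o e f) = degOp′ o (deg e) (deg f)

  Below : Maybe ℕ → ℕ → Set
  Below (just d) k = T (d ≤ᵇ k)
  Below nothing  k = ⊥

  Ok : Exp → Set
  Ok (lit m)    = ⊤
  Ok (reg x)    = ⊤
  Ok (a ⟦ e ⟧)  = Ok e × Below (deg e) w
  Ok (op o e f) = Ok e × Ok f × Below (deg e) w × Below (deg f) w × Below (deg (op o e f)) w

  OkTest : Test → Set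
  OkTest (eq e f)  = Ok e × Ok f
  OkTest (lt e f)  = Ok e × Ok f
  OkTest (neg b)   = OkTest b
  OkTest (and b c) = OkTest b × OkTest c

  Below′ : Maybe ℕ → Maybe ℕ → Set
  Below′ d nothing  = ⊤
  Below′ d (just k) = Below d k

  OkP : Program → Set
  OkP skip           = ⊤
  OkP (set x e)      = Ok e × Below (deg e) (Γ x)
  OkP (store a e f)  = Ok e × Below (deg e) w × Ok f × Below′ (deg f) (Δ a)
  OkP (emit e)       = Ok e
  OkP (P ⨾ Q)        = OkP P × OkP Q
  OkP (branch b P Q) = OkTest b × OkP P × OkP Q
  OkP (while b P)    = ⊥

  record Bounded (s : State) : Set where
    constructor bounded
    field
      boundedRegs   : ∀ r → regs s r ≤ M ^ Γ r
      boundedArrays : ∀ a d → Δ a ≡ just d → ∀ i → arrays s a i ≤ M ^ d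
  open Bounded public

  private
    instance
      nonZeroM : NonZero M
      nonZeroM = >-nonZero (≤-trans (s≤s z≤n) 4≤M)

    up : ∀ {x d e} → x ≤ M ^ d → d ≤ e → x ≤ M ^ e
    up x≤ d≤e = ≤-trans x≤ (^-monoʳ-≤ M d≤e)

  degOp-sound : ∀ o {m n d e} → m ≤ M ^ d → n ≤ M ^ e → applyOp o m n ≤ M ^ degOp o d e
  degOp-sound add {m} {n} {d} {e} p q = begin
    m + n                         ≤⟨ +-mono-≤ (up p (m≤m⊔n d e)) (up q (m≤n⊔m d e)) ⟩
    M ^ (d ⊔ e) + M ^ (d ⊔ e)     ≡⟨ cong (M ^ (d ⊔ e) +_) (+-identityʳ _) ⟨
    2 * M ^ (d ⊔ e)               ≤⟨ *-monoˡ-≤ (M ^ (d ⊔ e)) (≤-trans (s≤s (s≤s z≤n)) 4≤M) ⟩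
    M * M ^ (d ⊔ e)               ∎
    where open ≤-Reasoning
  degOp-sound sub {m} {n} p q = ≤-trans (m∸n≤m m n) p
  degOp-sound mul {d = d} {e} p q = ≤-trans (*-mono-≤ p q) (≤-reflexive (sym (^-distribˡ-+-* M d e)))
  degOp-sound div {m} {zero}  p q = z≤n
  degOp-sound div {m} {suc n} p q = ≤-trans (m/n≤m m (suc n)) p

  module _ {s : State} (bd : Bounded s) where
    deg-sound : ∀ e {d} → deg e ≡ just d → eval e s ≤ M ^ d
    deg-sound (lit m) e≡ with m ≤ᵇ 4 in le
    deg-sound (lit m) refl | true = subst (m ≤_) (sym (^-identityʳ M))
        (≤-trans (≤ᵇ⇒≤ m 4 (subst T (sym le) tt)) 4≤M)
    deg-sound (reg x) refl = boundedRegs bd x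
    deg-sound (a ⟦ e ⟧) e≡ = boundedArrays bd a _ e≡ (eval e s)
    deg-sound (op o e f) e≡ with deg e in e≡₁ | deg f in e≡₂
    deg-sound (op o e f) refl | just d | just d′ = degOp-sound o (deg-sound e e≡₁) (deg-sound f e≡₂)

    below-sound : ∀ e {k} → Below (deg e) k → eval e s ≤ M ^ k
    below-sound e {k} b with deg e in e≡
    ... | just d = up (deg-sound e e≡) (≤ᵇ⇒≤ d k b)

    ok-sound : ∀ e → Ok e → Fits (M ^ w) e s
    ok-sound (lit m)    _ = tt
    ok-sound (reg x)    _ = tt
    ok-sound (a ⟦ e ⟧)  (o , b) = ok-sound e o , below-sound e b
    ok-sound (op x e f) (o , o′ , b , b′ , b″) =
      ok-sound e o , ok-sound f o′ , below-sound e b , below-sound f b′ , below-sound (op x e f) b″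

    okTest-sound : ∀ b → OkTest b → FitsTest (M ^ w) b s
    okTest-sound (eq e f)  (o , o′) = ok-sound e o , ok-sound f o′
    okTest-sound (lt e f)  (o , o′) = ok-sound e o , ok-sound f o′
    okTest-sound (neg b)   o        = okTest-sound b o
    okTest-sound (and b c) (o , o′) = okTest-sound b o , okTest-sound c o′

    bounded-set : ∀ x {v} → v ≤ M ^ Γ x → Bounded (setReg x v s)
    bounded-set x {v} v≤ = bounded go (boundedArrays bd)
      where
      go : ∀ r → update (regs s) x v r ≤ M ^ Γ r
      go r with r ≡ᵇ x | ≡ᵇ⇒≡ r x
      ... | true  | e = subst (λ y → v ≤ M ^ Γ y) (sym (e tt)) v≤
      ... | false | _ = boundedRegs bd r

    bounded-store : ∀ a i {v} → (∀ d → Δ a ≡ just d → v ≤ M ^ d) → Bounded (setCell a i v s)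
    bounded-store a i {v} v≤ = bounded (boundedRegs bd) go
      where
      go : ∀ b d → Δ b ≡ just d → ∀ j → update (arrays s) a (update (arrays s a) i v) b j ≤ M ^ d
      go b d e≡ j with b ≡ᵇ a | ≡ᵇ⇒≡ b a
      ... | false | _ = boundedArrays bd b d e≡ j
      ... | true  | e with refl ← e tt with j ≡ᵇ i
      ...   | true  = v≤ d e≡
      ...   | false = boundedArrays bd b d e≡ j

  okP-sound : ∀ P {s} → OkP P → Bounded s → FitsP (M ^ w) P s × Bounded (exec P s)
  okP-sound skip o bd = tt , bd
  okP-sound (set x e) (o , b) bd = ok-sound bd e o , bounded-set bd x (below-sound bd e b)
  okP-sound (store a e f) {s} (o , b , o′ , b′) bd =
    (ok-sound bd e o , below-sound bd e b , ok-sound bd f o′) , bounded-store bd a (eval e s) value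
    where
    value : ∀ d → Δ a ≡ just d → eval f s ≤ M ^ d
    value d e≡ = below-sound bd f (subst (Below′ (deg f)) e≡ b′)
  okP-sound (emit e) o bd = ok-sound bd e o , bounded (boundedRegs bd) (boundedArrays bd)
  okP-sound (P ⨾ Q) (o , o′) bd with okP-sound P o bd
  ... | f , bd′ with okP-sound Q o′ bd′
  ...   | g , bd″ = (f , g) , bd″
  okP-sound (branch b P Q) {s} (o , o′ , o″) bd =
    (okTest-sound bd b o , (λ _ → proj₁ (okP-sound P o′ bd)) , (λ _ → proj₁ (okP-sound Q o″ bd))) ,
    if-elim Bounded (test b s) (λ _ → proj₂ (okP-sound P o′ bd)) (λ _ → proj₂ (okP-sound Q o″ bd))

  -- For a concrete program the typing premise normalizes to unit types, so the word bound of all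
  -- its operations is verified by computation.
  run-typed : ∀ P {s} {_ : OkP P} → Bounded s → Run (M ^ w) P s (time P) (λ s′ → s′ ≡ exec P s × Bounded s′)
  run-typed P {s} {o} bd with okP-sound P o bd
  ... | f , bd′ = run-weaken ≤-refl (λ { s′ refl → refl , bd′ }) (run-exec P s f)

-- The program

-- Registers: 0–2 hold n, lg and |T|; 3–6 are loop counters; 20–27 describe
-- the current pair of nonterminals; 30–38 hold a Range (with its upper end
-- in 36); 41 addresses the target cell and 45 holds the candidate.
-- Arrays: 3 reachability, 4 lengths, 5 powers of two, 6 left children,
-- 8–10 the table.

maxE minE : Exp → Exp → Exp
maxE a b = op add a (op sub b a)
minE a b = op sub a (op sub a b)

ιE : Exp → Exp → Exp → Exp
ιE x y t = op add (op mul (op add (op mul x (reg 0)) y) (op add (reg 1) (lit 1))) t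

-- The gap is written first and the largest element last, because the new gap is computed from the
-- old largest element.
putP : Exp → Exp → Exp → Program
putP h g l = store 9 (reg 41) g ⨾ store 10 (reg 41) l ⨾ store 8 (reg 41) h

insertP : Program
insertP =
  branch (eq H (lit 0)) (putP V (lit 0) V)
  (branch (lt H V) (putP V (op sub V H) L)
  (branch (eq V H) (putP H G L)
  (branch (and (lt (lit 0) G) (lt G (op sub H V))) (putP H G (minE L V))
          (putP H (op sub H V) (minE L V)))))
  where
  H = 8 ⟦ reg 41 ⟧
  G = 9 ⟦ reg 41 ⟧
  L = 10 ⟦ reg 41 ⟧
  V = reg 45

passT : Test
passT = and (neg (lt (reg 45) (reg 40))) (and (neg (lt (reg 36) (reg 45)))
        (and (eq (op mul (op div (op sub (reg 30) (reg 45)) (reg 31)) (reg 31)) (op sub (reg 30) (reg 45)))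
             (eq (op mul (op div (op sub (reg 33) (reg 45)) (reg 34)) (reg 34)) (op sub (reg 33) (reg 45)))))

tryP : Exp → Program
tryP e = set 45 e ⨾ branch passT insertP skip

meetFromP : Exp → Exp → Exp → Program
meetFromP H G L =
  tryP (op add L (op mul (op div (op sub (reg 36) L) G) G)) ⨾
  -- Register 45 still holds the first candidate.
  tryP (op sub (reg 45) G) ⨾
  tryP (op sub H (op mul (op div (op sub H (reg 40)) G) G))

meetP : Program
meetP =
  set 36 (minE (minE (reg 30) (reg 33)) (reg 38)) ⨾
  set 40 (maxE (maxE (reg 32) (reg 35)) (reg 37)) ⨾
  branch (lt (reg 31) (reg 34)) (meetFromP (reg 33) (reg 34) (reg 35)) (meetFromP (reg 30) (reg 31) (reg 32))

-- Effect of the insertion and intersection programs on the table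

tabs : State → ℕ → Cell
tabs s i = cell (arrays s 8 i) (arrays s 9 i) (arrays s 10 i)

Effect : State → State → ℕ → Cell → Set
Effect s s′ i c = ∀ j → tabs s′ j ≡ (if j ≡ᵇ i then c else tabs s j)

effect-at : ∀ {s s′ c} i → Effect s s′ i c → tabs s′ i ≡ c
effect-at {s} {s′} {c} i E = trans (E i) (lemma (i ≡ᵇ i) (≡⇒≡ᵇ i i refl))
  where
  lemma : ∀ b → T b → (if b then c else tabs s i) ≡ c
  lemma true _ = refl

effect-none : ∀ {s} i → Effect s s i (tabs s i)
effect-none {s} i j = lemma (j ≡ᵇ i) (≡ᵇ⇒≡ j i)
  where
  lemma : ∀ b → (T b → j ≡ i) → tabs s j ≡ (if b then tabs s i else tabs s j)
  lemma true  f = cong (tabs s) (f tt)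
  lemma false f = refl

effect-trans : ∀ {s s′ s″ i c d} → Effect s s′ i c → Effect s′ s″ i d → Effect s s″ i d
effect-trans {s} {i = i} {c} {d} E F j = trans (F j) (lemma (j ≡ᵇ i) (E j))
  where
  lemma : ∀ b {t} → t ≡ (if b then c else tabs s j) → (if b then d else t) ≡ (if b then d else tabs s j)
  lemma true  _ = refl
  lemma false e = e

effect-if : ∀ {s s₁ s₂ i c₁ c₂} b → Effect s s₁ i c₁ → Effect s s₂ i c₂ →
            Effect s (if b then s₁ else s₂) i (if b then c₁ else c₂)
effect-if true  E F = E
effect-if false E F = F

effect-put : ∀ h g l s → let s₁ = exec (store 9 (reg 41) g) s; s₂ = exec (store 10 (reg 41) l) s₁ in
             Effect s (exec (putP h g l) s) (regs s 41) (cell (eval h s₂) (eval g s) (eval l s₁))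
effect-put h g l s j = lemma (j ≡ᵇ regs s 41)
  where
  lemma : ∀ {h g l h′ g′ l′ : ℕ} b → cell (if b then h else h′) (if b then g else g′) (if b then l else l′) ≡
          (if b then cell h g l else cell h′ g′ l′)
  lemma true  = refl
  lemma false = refl

effect-insert : ∀ s → Effect s (exec insertP s) (regs s 41) (ins (regs s 45) (tabs s (regs s 41)))
effect-insert s =
  effect-if {s} (h ≡ᵇ 0) (effect-put V (lit 0) V s)
  (effect-if {s} (h <ᵇ v) (effect-put V (op sub V H) L s)
  (effect-if {s} (v ≡ᵇ h) (effect-put H G L s)
  (effect-if {s} ((0 <ᵇ g) ∧ (g <ᵇ (h ∸ v))) (effect-put H G (minE L V) s)
      (effect-put H (op sub H V) (minE L V) s))))
  where
  H = 8 ⟦ reg 41 ⟧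
  G = 9 ⟦ reg 41 ⟧
  L = 10 ⟦ reg 41 ⟧
  V = reg 45
  h = eval H s
  g = eval G s
  v = eval V s

rangeOf : State → Range
rangeOf s = range (cell (regs s 30) (regs s 31) (regs s 32)) (cell (regs s 33) (regs s 34) (regs s 35))
    (regs s 37) (regs s 38)

record Prepared (R : Range) (i : ℕ) (s : State) : Set where
  constructor prepared
  field
    isRange   : rangeOf s ≡ R
    isHighest : regs s 36 ≡ Range.highest R
    isLowest  : regs s 40 ≡ Range.lowest R
    isTarget  : regs s 41 ≡ i

range-same : ∀ {s s′} → Same 39 8 s s′ → rangeOf s′ ≡ rangeOf s
range-same S
  rewrite sameRegs S 30 (<ᵇ⇒< 30 39 tt) | sameRegs S 31 (<ᵇ⇒< 31 39 tt) | sameRegs S 32 (<ᵇ⇒< 32 39 tt)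
        | sameRegs S 33 (<ᵇ⇒< 33 39 tt) | sameRegs S 34 (<ᵇ⇒< 34 39 tt) | sameRegs S 35 (<ᵇ⇒< 35 39 tt)
        | sameRegs S 37 (<ᵇ⇒< 37 39 tt) | sameRegs S 38 (<ᵇ⇒< 38 39 tt) = refl

same-≤ : ∀ {k k′ m s s′} → k ≤ k′ → Same k′ m s s′ → Same k m s s′
same-≤ k≤k′ (same a b c) = same (λ r r<k → a r (<-≤-trans r<k k≤k′)) b c

prepared-same : ∀ {R i s s′} → Same 45 8 s s′ → Prepared R i s → Prepared R i s′
prepared-same S (prepared r h l t) = prepared (trans (range-same (same-≤ (≤ᵇ⇒≤ 39 45 tt) S)) r)
  (trans (sameRegs S 36 (<ᵇ⇒< 36 45 tt)) h) (trans (sameRegs S 40 (<ᵇ⇒< 40 45 tt)) l)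
      (trans (sameRegs S 41 (<ᵇ⇒< 41 45 tt)) t)

effect-try : ∀ {R i s} e → Prepared R i s → ∀ {v c} → eval e s ≡ v → tabs s i ≡ c →
             let s′ = exec (tryP e) s in
             Effect s s′ i (Range.tryIns R v c) × Prepared R i s′ × regs s′ 45 ≡ v
effect-try {R} {i} {s} e P@(prepared refl h l refl) refl refl =
  subst (λ b → Effect s s′ i (if b then ins v (tabs s i) else tabs s i)) passes≡
    (effect-if {s} (test passT s₁) (effect-insert s₁) (effect-none {s} i)) ,
  prepared-same (frame {45} {8} (tryP e) s _) P ,
  sameRegs (frame {46} {8} (branch passT insertP skip) s₁ _) 45 (<ᵇ⇒< 45 46 tt)
  where
  v = eval e s
  s₁ = setReg 45 v s
  s′ = exec (tryP e) s
  rest : Bool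
  rest = (quot (regs s 30 ∸ v) (regs s 31) * regs s 31 ≡ᵇ regs s 30 ∸ v) ∧
         (quot (regs s 33 ∸ v) (regs s 34) * regs s 34 ≡ᵇ regs s 33 ∸ v)
  passes≡ : test passT s₁ ≡ Range.passes R v
  passes≡ = cong₂ (λ hi lo → not (v <ᵇ lo) ∧ not (hi <ᵇ v) ∧ rest) h l

effect-meetFrom : ∀ {R i s} (H G L : ℕ) (C : Cell) →
  (∀ s → Prepared R i s → cell (regs s H) (regs s G) (regs s L) ≡ C) → Prepared R i s → ∀ {c} → tabs s i ≡ c →
  Effect s (exec (meetFromP (reg H) (reg G) (reg L)) s) i (Range.meetFrom R C c)
effect-meetFrom {R} {i} {s} H G L C isC P₀ {c} c≡ =
  effect-trans {s} {s₁} {s₃} {i} (proj₁ t₁) (effect-trans {s₁} {s₂} {s₃} {i} (proj₁ t₂) (proj₁ t₃))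
  where
  e₁ e₂ e₃ : Exp
  e₁ = op add (reg L) (op mul (op div (op sub (reg 36) (reg L)) (reg G)) (reg G))
  e₂ = op sub (reg 45) (reg G)
  e₃ = op sub (reg H) (op mul (op div (op sub (reg H) (reg 40)) (reg G)) (reg G))
  s₁ s₂ s₃ : State
  s₁ = exec (tryP e₁) s
  s₂ = exec (tryP e₂) s₁
  s₃ = exec (tryP e₃) s₂
  c₁ c₂ c₃ : Cell
  c₁ = Range.tryIns R (Range.cand₁ R C) c
  c₂ = Range.tryIns R (Range.cand₂ R C) c₁
  c₃ = Range.tryIns R (Range.cand₃ R C) c₂
  t₁ : Effect s s₁ i c₁ × Prepared R i s₁ × regs s₁ 45 ≡ Range.cand₁ R C
  t₁ = effect-try {R} {i} {s} e₁ P₀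
         (cong₂ (λ C h → lo C + quot (h ∸ lo C) (gap C) * gap C) (isC s P₀) (Prepared.isHighest P₀)) c≡
  P₁ = proj₁ (proj₂ t₁)
  t₂ : Effect s₁ s₂ i c₂ × Prepared R i s₂ × regs s₂ 45 ≡ Range.cand₂ R C
  t₂ = effect-try {R} {i} {s₁} e₂ P₁
         (cong₂ (λ v C → v ∸ gap C) (proj₂ (proj₂ t₁)) (isC s₁ P₁)) (effect-at {s} {s₁} i (proj₁ t₁))
  P₂ = proj₁ (proj₂ t₂)
  t₃ : Effect s₂ s₃ i c₃ × Prepared R i s₃ × regs s₃ 45 ≡ Range.cand₃ R C
  t₃ = effect-try {R} {i} {s₂} e₃ P₂
         (cong₂ (λ C l → hi C ∸ quot (hi C ∸ l) (gap C) * gap C) (isC s₂ P₂) (Prepared.isLowest P₂))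
             (effect-at {s₁} {s₂} i (proj₁ t₂))

effect-meet : ∀ s → Effect s (exec meetP s) (regs s 41) (Range.meet (rangeOf s) (tabs s (regs s 41)))
effect-meet s = effect-if {s} {exec P₂ s₂} {exec P₁ s₂} {i} {Range.meetFrom R (Range.c₂ R) c}
    {Range.meetFrom R (Range.c₁ R) c}
                  (regs s 31 <ᵇ regs s 34) E₂ E₁
  where
  s₂ : State
  s₂ = exec (set 40 (maxE (maxE (reg 32) (reg 35)) (reg 37)))
      (exec (set 36 (minE (minE (reg 30) (reg 33)) (reg 38))) s)
  R = rangeOf s
  i = regs s 41
  c = tabs s i
  P₁ P₂ : Program
  P₁ = meetFromP (reg 30) (reg 31) (reg 32)
  P₂ = meetFromP (reg 33) (reg 34) (reg 35)
  P : Prepared R i s₂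
  P = prepared refl refl refl refl
  E₁ : Effect s₂ (exec P₁ s₂) i (Range.meetFrom R (Range.c₁ R) c)
  E₁ = effect-meetFrom {R} {i} {s₂} 30 31 32 (Range.c₁ R) (λ s P → cong Range.c₁ (Prepared.isRange P)) P refl
  E₂ : Effect s₂ (exec P₂ s₂) i (Range.meetFrom R (Range.c₂ R) c)
  E₂ = effect-meetFrom {R} {i} {s₂} 33 34 35 (Range.c₂ R) (λ s P → cong Range.c₂ (Prepared.isRange P)) P refl

-- Array 1 holds letters, whose codes are not bounded.

-- Control data is bounded by M²; the ends of a moved cell are sums of two such numbers; 37 and 38
-- hold limits formed by maxima of the shape a + (b ∸ a); a table address has degree 9. All these
-- degrees lie below the exponent 12 of the word bound.
Γ : ℕ → ℕ
Γ r = if r <ᵇ 30 then 2 else if r <ᵇ 37 then 3 else if r <ᵇ 40 then 6 else 9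

-- The parameter τ is the degree granted to table entries: 2 between operations, where validity
-- bounds them by N, and 9 during an insertion, whose candidate is typed with degree 9 only.
Δ : ℕ → ℕ → Maybe ℕ
Δ τ a = if a ≡ᵇ 1 then nothing else if a <ᵇ 8 then just 2 else if a <ᵇ 11 then just τ else nothing

-- Table addresses and the invariant of the table phase

radix-injective : ∀ {m a b a′ b′} → b < m → b′ < m → a * m + b ≡ a′ * m + b′ → a ≡ a′ × b ≡ b′
radix-injective {m} {a} {b} {a′} {b′} b<m b′<m e with <-cmp a a′
... | tri< a<a′ _ _ = ⊥-elim (lia 5 (λ m am b am′ b′ → (b ≺ m) ∷ (am ⊕ b ≐ am′ ⊕ b′) ∷
    (m ⊕ am ≼ am′) ∷ [] ⊢ˡ absurd)
                        m (a * m) b (a′ * m) b′ b<m e (*-monoˡ-≤ m a<a′))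
... | tri> _ _ a′<a = ⊥-elim (lia 5 (λ m am b am′ b′ → (b′ ≺ m) ∷ (am ⊕ b ≐ am′ ⊕ b′) ∷
    (m ⊕ am′ ≼ am) ∷ [] ⊢ˡ absurd)
                        m (a * m) b (a′ * m) b′ b′<m e (*-monoˡ-≤ m a′<a))
... | tri≈ _ refl _ = refl , +-cancelˡ-≡ (a * m) b b′ e

-- F is the contents of the arrays below 8 after preprocessing, W the word of
-- each nonterminal.
record Layout : Set where
  field
    n lg N : ℕ
    F      : ℕ → ℕ → ℕ
    W      : ℕ → Str

  M B : ℕ
  M = n + N
  B = M ^ 12

  Live : ℕ → Set
  Live x = x < n × F 3 x ≡ 1

  left right : ℕ → ℕ
  left  = F 6
  right = F 2

  record IsPair (x : ℕ) : Set where
    field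
      kind       : F 0 x ≡ 1
      live-left  : Live (left x)
      live-right : Live (right x)
      left<      : left x < x
      right<     : right x < x
      cat        : Cat (W x) (W (left x)) (W (right x))

  record IsLetter (x : ℕ) : Set where
    field
      kind   : F 0 x ≡ 0
      len≡1  : len (W x) ≡ 1
      code   : at (W x) 0 ≡ F 1 x

record Model : Set where
  field
    layout : Layout

  open Layout layout public

  field
    4≤M     : 4 ≤ M
    lg≤M    : lg ≤ M
    F-bound : ∀ a → a ≢ 1 → a < 8 → ∀ i → F a i ≤ M ^ 2
    N<2^lg  : N < 2 ^ lg
    powers  : ∀ t → t ≤ lg → F 5 t ≡ 2 ^ t
    len-F   : ∀ {x} → Live x → F 4 x ≡ len (W x)
    len≥1   : ∀ {x} → Live x → 1 ≤ len (W x)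
    len≤N   : ∀ {x} → Live x → len (W x) ≤ N
    shape   : ∀ {x} → Live x → IsPair x ⊎ IsLetter x

module Table (model : Model) where
  open Model model

  ι : ℕ → ℕ → ℕ → ℕ
  ι x y t = (x * n + y) * (lg + 1) + t

  -- Scale t of the overlaps for t < lg; the crossing occurrences for t = lg.
  Entry : ℕ → ℕ → ℕ → ℕ → Set
  Entry x y t l = (t < lg × OvScale (W x) (W y) t l) ⊎
                  (t ≡ lg × IsPair x × Oc (W x) (len (W (left x))) (W y) l)

  data Sat (i l : ℕ) : Set where
    sat : ∀ x y t → Live x → Live y → t ≤ lg → i ≡ ι x y t → Entry x y t l → Sat i l

  ι-injective : ∀ {x y t x′ y′ t′} → y < n → t ≤ lg → y′ < n → t′ ≤ lg → ι x y t ≡ ι x′ y′ t′ →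
                x ≡ x′ × y ≡ y′ × t ≡ t′
  ι-injective {x} {y} {t} {x′} {y′} {t′} y<n t≤ y′<n t′≤ e
    with radix-injective {lg + 1} {x * n + y} {t} {x′ * n + y′} {t′} (subst (t <_) (+-comm 1 lg) (s≤s t≤))
        (subst (t′ <_) (+-comm 1 lg) (s≤s t′≤)) e
  ... | e₁ , e₂ with radix-injective {n} {x} {y} {x′} {y′} y<n y′<n e₁
  ...   | e₃ , e₄ = e₃ , e₄ , e₂

  sat-entry : ∀ {x y t l} → Live x → Live y → t ≤ lg → Sat (ι x y t) l → Entry x y t l
  sat-entry {x} {y} {t} lx ly t≤ (sat x′ y′ t′ lx′ ly′ t′≤ e E)
    with ι-injective {x} {y} {t} {x′} {y′} {t′} (proj₁ ly) t≤ (proj₁ ly′) t′≤ e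
  ... | refl , refl , refl = E

  sat-bound : ∀ {i l} → Sat i l → l ≤ N
  sat-bound (sat x y t lx ly _ _ (inj₁ (_ , O , _))) = ≤-trans (Ov.l≤Y O) (len≤N ly)
  sat-bound (sat x y t lx ly _ _ (inj₂ (_ , _ , O))) = ≤-trans (<⇒≤ (Oc.s<Y O)) (len≤N ly)

  module D (τ : ℕ) = Degrees M 12 4≤M Γ (Δ τ)

  record Inv (s : State) : Set where
    constructor inv
    field
      reg-n    : regs s 0 ≡ n
      reg-lg   : regs s 1 ≡ lg
      reg-N    : regs s 2 ≡ N
      fixed    : ∀ a → a < 8 → arrays s a ≡ F a
      in-range : ∀ r → regs s r ≤ M ^ Γ r
      valid    : ∀ i → Valid (tabs s i) (Sat i)
      silent   : output s ≡ []

  Mono : State → State → Set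
  Mono s s′ = ∀ i v → Covers (tabs s i) v → Covers (tabs s′ i) v

  -- Completeness is claimed for single pairs, while soundness is part of `Inv` and concerns every
  -- cell at all times.
  Done : ℕ → ℕ → State → Set
  Done x y s = ∀ t l → t ≤ lg → Entry x y t l → Covers (tabs s (ι x y t)) l

  done-mono : ∀ {x y s s′} → Mono s s′ → Done x y s → Done x y s′
  done-mono m d t l t≤ E = m _ l (d t l t≤ E)

  1≤M : 1 ≤ M
  1≤M = ≤-trans (s≤s z≤n) 4≤M

  M^mono : ∀ {d e} → d ≤ e → M ^ d ≤ M ^ e
  M^mono = ^-monoʳ-≤ M {{>-nonZero 1≤M}}

  N≤M² : N ≤ M ^ 2
  N≤M² = ≤-trans (m≤n+m N n) (subst (_≤ M ^ 2) (^-identityʳ M) (M^mono {1} {2} (s≤s z≤n)))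

  valid-bound : ∀ {c i} → Valid c (Sat i) → hi c ≤ N × gap c ≤ N × lo c ≤ N
  valid-bound (inj₁ refl) = z≤n , z≤n , z≤n
  valid-bound (inj₂ (filled l≤h h l (inj₁ e))) = sat-bound h , subst (_≤ N) (sym e) z≤n , sat-bound l
  valid-bound {c} (inj₂ (filled l≤h h l (inj₂ (_ , w , e , _)))) =
    sat-bound h , ≤-trans (subst (gap c ≤_) e (m≤n+m (gap c) w)) (sat-bound h) , sat-bound l

  inv-bounded : ∀ {s} → Inv s → D.Bounded 2 s
  inv-bounded {s} I = record { boundedRegs = Inv.in-range I ; boundedArrays = go }
    where
    fixed-bound : ∀ a → a ≢ 1 → a < 8 → ∀ i → arrays s a i ≤ M ^ 2
    fixed-bound a a≢1 a<8 i = subst (λ f → f i ≤ M ^ 2) (sym (Inv.fixed I a a<8)) (F-bound a a≢1 a<8 i)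
    table-bound : ∀ i → hi (tabs s i) ≤ N × gap (tabs s i) ≤ N × lo (tabs s i) ≤ N
    table-bound i = valid-bound (Inv.valid I i)
    go : ∀ a d → Δ 2 a ≡ just d → ∀ i → arrays s a i ≤ M ^ d
    go 0 d refl i = fixed-bound 0 (λ ()) (<ᵇ⇒< 0 8 tt) i
    go 1 d () i
    go 2 d refl i = fixed-bound 2 (λ ()) (<ᵇ⇒< 2 8 tt) i
    go 3 d refl i = fixed-bound 3 (λ ()) (<ᵇ⇒< 3 8 tt) i
    go 4 d refl i = fixed-bound 4 (λ ()) (<ᵇ⇒< 4 8 tt) i
    go 5 d refl i = fixed-bound 5 (λ ()) (<ᵇ⇒< 5 8 tt) i
    go 6 d refl i = fixed-bound 6 (λ ()) (<ᵇ⇒< 6 8 tt) i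
    go 7 d refl i = fixed-bound 7 (λ ()) (<ᵇ⇒< 7 8 tt) i
    go 8 d refl i = ≤-trans (proj₁ (table-bound i)) N≤M²
    go 9 d refl i = ≤-trans (proj₁ (proj₂ (table-bound i))) N≤M²
    go 10 d refl i = ≤-trans (proj₂ (proj₂ (table-bound i))) N≤M²
    go (suc (suc (suc (suc (suc (suc (suc (suc (suc (suc (suc _))))))))))) d () i

  bounded-loosen : ∀ {s} → D.Bounded 2 s → D.Bounded 9 s
  bounded-loosen {s} bd = record { boundedRegs = D.boundedRegs bd ; boundedArrays = go }
    where
    boundedArrays = D.boundedArrays bd
    go : ∀ a d → Δ 9 a ≡ just d → ∀ i → arrays s a i ≤ M ^ d
    go 0 d refl i = boundedArrays 0 2 refl i
    go 1 d () i
    go 2 d refl i = boundedArrays 2 2 refl i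
    go 3 d refl i = boundedArrays 3 2 refl i
    go 4 d refl i = boundedArrays 4 2 refl i
    go 5 d refl i = boundedArrays 5 2 refl i
    go 6 d refl i = boundedArrays 6 2 refl i
    go 7 d refl i = boundedArrays 7 2 refl i
    go 8 d refl i = ≤-trans (boundedArrays 8 2 refl i) (M^mono (≤ᵇ⇒≤ 2 9 tt))
    go 9 d refl i = ≤-trans (boundedArrays 9 2 refl i) (M^mono (≤ᵇ⇒≤ 2 9 tt))
    go 10 d refl i = ≤-trans (boundedArrays 10 2 refl i) (M^mono (≤ᵇ⇒≤ 2 9 tt))
    go (suc (suc (suc (suc (suc (suc (suc (suc (suc (suc (suc _))))))))))) d () i

  effect-elim : ∀ {s s′ i c} (P : ℕ → Cell → Set) → Effect s s′ i c → P i c → (∀ j → P j (tabs s j)) →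
      ∀ j → P j (tabs s′ j)
  effect-elim {s} {s′} {i} {c} P E Pi Pj j = subst (P j) (sym (E j)) (go (j ≡ᵇ i) (≡ᵇ⇒≡ j i))
    where
    go : ∀ b → (T b → j ≡ i) → P j (if b then c else tabs s j)
    go true  f = subst (λ j → P j c) (sym (f tt)) Pi
    go false f = Pj j

  record Progress (s s′ : State) : Set where
    constructor progress
    field
      still-inv : Inv s′
      mono      : Mono s s′
      unchanged : Same 30 8 s s′
  open Progress public

  progress-refl : ∀ {s} → Inv s → Progress s s
  progress-refl I = progress I (λ _ _ c → c) same-refl

  progress-trans : ∀ {s s′ s″} → Progress s s′ → Progress s′ s″ → Progress s s″
  progress-trans (progress _ m u) (progress I m′ u′) = progress I (λ i v c →
      m′ i v (m i v c)) (same-trans u u′)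

  inv-same : ∀ {s s′} → Inv s → Same 3 8 s s′ → (∀ r → regs s′ r ≤ M ^ Γ r) →
      (∀ i → Valid (tabs s′ i) (Sat i)) → Inv s′
  inv-same I S b v = inv
    (trans (sameRegs S 0 (s≤s z≤n)) (Inv.reg-n I))
    (trans (sameRegs S 1 (s≤s (s≤s z≤n))) (Inv.reg-lg I))
    (trans (sameRegs S 2 (s≤s (s≤s (s≤s z≤n)))) (Inv.reg-N I))
    (λ a a<8 → trans (sameArrays S a a<8) (Inv.fixed I a a<8)) b v (trans (sameOutput S) (Inv.silent I))

  same-tabs : ∀ {k s s′} → Same k 11 s s′ → ∀ i → tabs s′ i ≡ tabs s i
  same-tabs S i
    rewrite sameArrays S 8 (<ᵇ⇒< 8 11 tt) | sameArrays S 9 (<ᵇ⇒< 9 11 tt) | sameArrays S 10 (<ᵇ⇒< 10 11 tt) =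
        refl

  same-arrays-≤ : ∀ {k m m′ s s′} → m ≤ m′ → Same k m′ s s′ → Same k m s s′
  same-arrays-≤ m≤m′ (same a b c) = same a (λ x x< → b x (<-≤-trans x< m≤m′)) c

  load-run : ∀ P {_ : D.OkP 2 P} {_ : Frame 3 11 P} s → Inv s →
             Run B P s (time P) (λ s′ → s′ ≡ exec P s × Inv s′)
  load-run P {o} {f} s I = run-weaken ≤-refl
    (λ { s′ (refl , bd) → refl , inv-same I (same-arrays-≤ (≤ᵇ⇒≤ 8 11 tt) S) (D.boundedRegs bd)
        (λ i → subst (λ c → Valid c (Sat i)) (sym (same-tabs S i)) (Inv.valid I i)) })
    (D.run-typed 2 P {s} {o} (inv-bounded I))
    where
    S : Same 3 11 s (exec P s)
    S = frame P s f

  -- The static bound on the table deteriorates from degree 2 to 9 while Q runs. Afterwards `Inv` is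
  -- rebuilt from validity, which bounds the entries by N again, so the loss does not accumulate.
  step-run : ∀ Ld Q {_ : D.OkP 2 Ld} {_ : Frame 30 11 Ld} {_ : D.OkP 9 Q} {_ : Frame 30 8 Q} s → Inv s →
    let s₁ = exec Ld s in ∀ i c →
    Effect s₁ (exec Q s₁) i c → (Valid (tabs s i) (Sat i) → Valid c (Sat i)) →
    (∀ v → Covers (tabs s i) v → Covers c v) →
    Run B (Ld ⨾ Q) s (time Ld + time Q) (λ s′ → Progress s s′ × tabs s′ i ≡ c)
  step-run Ld Q {o} {f} {o′} {f′} s I i c E V C = run-seq (D.run-typed 2 Ld {s} {o} (inv-bounded I)) second
    where
    s₁ = exec Ld s
    S₁ : Same 30 11 s s₁
    S₁ = frame Ld s f
    second : ∀ s′ → s′ ≡ s₁ × D.Bounded 2 s′ → Run B Q s′ (time Q) (λ s′ → Progress s s′ × tabs s′ i ≡ c)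
    second s′ (refl , bd) = run-weaken ≤-refl third (D.run-typed 9 Q {s₁} {o′} (bounded-loosen bd))
      where
      third : ∀ s″ → s″ ≡ exec Q s₁ × D.Bounded 9 s″ → Progress s s″ × tabs s″ i ≡ c
      third s″ (e , bd′) = progress
          (inv-same I (same-≤ (≤ᵇ⇒≤ 3 30 tt) S) (D.boundedRegs bd′)
            (effect-elim {s₁} {s″} (λ j d → Valid d (Sat j)) E′ (V (Inv.valid I i)) λ j →
                subst (λ d → Valid d (Sat j)) (sym (same-tabs S₁ j)) (Inv.valid I j)))
          (effect-elim {s₁} {s″} (λ j d → ∀ v → Covers (tabs s j) v → Covers d v) E′ C
            λ j v → subst (λ d → Covers d v) (sym (same-tabs S₁ j)))
          S
        , effect-at {s₁} {s″} i E′
        where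
        E′ : Effect s₁ s″ i c
        E′ = subst (λ s″ → Effect s₁ s″ i c) (sym e) E
        S : Same 30 8 s s″
        S = same-trans (same-arrays-≤ (≤ᵇ⇒≤ 8 11 tt) S₁) (subst (Same 30 8 s₁) (sym e) (frame Q s₁ f′))

  meet-run : ∀ Ld {_ : D.OkP 2 Ld} {_ : Frame 30 11 Ld} s → Inv s → ∀ R i →
    rangeOf (exec Ld s) ≡ R → regs (exec Ld s) 41 ≡ i →
    1 ≤ Range.rl R → (∀ v → Range.Target R v → Sat i v) →
    Aligned R (Range.c₁ R) → Aligned R (Range.c₂ R) → Separated R →
    Run B (Ld ⨾ meetP) s (time Ld + time meetP)
      (λ s′ → Progress s s′ × (∀ v → Range.Target R v → Covers (tabs s′ i) v))
  meet-run Ld {o} {f} s I R i refl refl rl≥1 sound al₁ al₂ sep = run-weaken ≤-refl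
    (λ s′ (p , e) → p , λ v t → subst (λ c → Covers c v) (sym e) (meet-covers R l≥1 sound al₁ al₂ sep
        (Inv.valid I i) t))
    (step-run Ld meetP {o} {f} s I i (Range.meet R (tabs s i))
      (subst (λ c → Effect s₁ (exec meetP s₁) i (Range.meet R c)) (same-tabs (frame {30} {11} Ld s f)
          i) (effect-meet s₁))
      (meet-valid R l≥1 sound) (λ v → meet-mono R))
    where
    s₁ = exec Ld s
    l≥1 : 1 ≤ Range.lowest R
    l≥1 = ≤-trans rl≥1 (rl≤ R)

  module _ {s} (I : Inv s) {x y} (lx : Live x) (ly : Live y) (d : Done x y s) where
    rep-ov : ∀ {t} → t < lg → Rep (tabs s (ι x y t)) (OvScale (W x) (W y) t)
    rep-ov {t} t< = rep (λ (O , _) → Ov.l≥1 O) (ov-progressive t)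
      (valid-map (λ v S → from (sat-entry lx ly (<⇒≤ t<) S)) (Inv.valid I (ι x y t)))
      (λ v O → d t v (<⇒≤ t<) (inj₁ (t< , O)))
      where
      from : ∀ {v} → Entry x y t v → OvScale (W x) (W y) t v
      from (inj₁ (_ , O)) = O
      from (inj₂ (refl , _)) = ⊥-elim (<-irrefl refl t<)

    rep-oc : IsPair x → Rep (tabs s (ι x y lg)) (Oc (W x) (len (W (left x))) (W y))
    rep-oc px = rep Oc.s≥1 oc-progressive
      (valid-map (λ v S → from (sat-entry lx ly ≤-refl S)) (Inv.valid I (ι x y lg)))
      (λ v O → d lg v ≤-refl (inj₂ (refl , px , O)))
      where
      from : ∀ {v} → Entry x y lg v → Oc (W x) (len (W (left x))) (W y) v
      from (inj₁ (lg<lg , _)) = ⊥-elim (<-irrefl refl lg<lg)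
      from (inj₂ (_ , _ , O)) = O

-- A loader evaluates its operands one after another while overwriting registers from 30 on.
-- Operands made of control data keep the values they had in the initial state.
Control : Exp → Set
Control (lit m)    = ⊤
Control (reg x)    = T (x <ᵇ 30)
Control (a ⟦ e ⟧)  = T (a <ᵇ 8) × Control e
Control (op o e f) = Control e × Control f

eval-control : ∀ e {s s′} → Control e → Same 30 8 s s′ → eval e s′ ≡ eval e s
eval-control (lit m)    c S = refl
eval-control (reg x)    c S = sameRegs S x (<ᵇ⇒< x 30 c)
eval-control (a ⟦ e ⟧)  (c , d) S = cong₂ (λ f i → f i) (sameArrays S a (<ᵇ⇒< a 8 c)) (eval-control e d S)
eval-control (op o e f) (c , d) S = cong₂ (applyOp o) (eval-control e c S) (eval-control f d S)


-- The two cells of a Range are loaded from addresses e₁ and e₂ and moved by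
-- a and b; the second one is reflected by the second loader.
loadUp loadDown : (e₁ a e₂ b rl rh d : Exp) → Program
loadUp e₁ a e₂ b rl rh d =
  set 42 e₁ ⨾ set 43 e₂ ⨾
  set 30 (op add (8 ⟦ reg 42 ⟧) a) ⨾ set 31 (9 ⟦ reg 42 ⟧) ⨾ set 32 (op add (10 ⟦ reg 42 ⟧) a) ⨾
  set 33 (op add (8 ⟦ reg 43 ⟧) b) ⨾ set 34 (9 ⟦ reg 43 ⟧) ⨾ set 35 (op add (10 ⟦ reg 43 ⟧) b) ⨾
  set 37 rl ⨾ set 38 rh ⨾ set 41 d
loadDown e₁ a e₂ b rl rh d =
  set 42 e₁ ⨾ set 43 e₂ ⨾
  set 30 (op add (8 ⟦ reg 42 ⟧) a) ⨾ set 31 (9 ⟦ reg 42 ⟧) ⨾ set 32 (op add (10 ⟦ reg 42 ⟧) a) ⨾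
  set 33 (op sub b (10 ⟦ reg 43 ⟧)) ⨾ set 34 (9 ⟦ reg 43 ⟧) ⨾ set 35 (op sub b (8 ⟦ reg 43 ⟧)) ⨾
  set 37 rl ⨾ set 38 rh ⨾ set 41 d

cell≡ : ∀ {h h′ g g′ l l′} → h ≡ h′ → g ≡ g′ → l ≡ l′ → cell h g l ≡ cell h′ g′ l′
cell≡ refl refl refl = refl

range≡ : ∀ {c c′ d d′ l l′ h h′} → c ≡ c′ → d ≡ d′ → l ≡ l′ → h ≡ h′ → range c d l h ≡ range c′ d′ l′ h′
range≡ refl refl refl refl = refl

module _ (e₁ a e₂ b rl rh d : Exp) (c₂ : Control e₂) (ca : Control a) (cb : Control b)
         (cl : Control rl) (ch : Control rh) (cd : Control d) (s : State) where
  private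
    i₁ = eval e₁ s
    s₁ s₂ s₃ s₄ : State
    s₁ = setReg 42 i₁ s
    s₂ = setReg 43 (eval e₂ s₁) s₁
    s₃ = exec (set 30 (op add (8 ⟦ reg 42 ⟧) a)) s₂
    s₄ = exec (set 31 (9 ⟦ reg 42 ⟧)) s₃
    S₁ : Same 30 8 s s₁
    S₁ = frame (set 42 e₁) s _
    S₂ : Same 30 8 s s₂
    S₂ = same-trans S₁ (frame (set 43 e₂) s₁ _)
    S₃ : Same 30 8 s s₃
    S₃ = same-trans S₂ (frame (set 30 (op add (8 ⟦ reg 42 ⟧) a)) s₂ _)
    S₄ : Same 30 8 s s₄
    S₄ = same-trans S₃ (frame (set 31 (9 ⟦ reg 42 ⟧)) s₃ _)
    s₅ : State
    s₅ = exec (set 32 (op add (10 ⟦ reg 42 ⟧) a)) s₄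
    S₅ : Same 30 8 s s₅
    S₅ = same-trans S₄ (frame (set 32 (op add (10 ⟦ reg 42 ⟧) a)) s₄ _)
    i₂≡ : eval e₂ s₁ ≡ eval e₂ s
    i₂≡ = eval-control e₂ c₂ S₁
    first≡ : cell (arrays s 8 i₁ + eval a s₂) (arrays s 9 i₁) (arrays s 10 i₁ + eval a s₄) ≡ shift
        (eval a s) (tabs s i₁)
    first≡ = cell≡ (cong (arrays s 8 i₁ +_) (eval-control a ca S₂)) refl (cong (arrays s 10 i₁ +_)
        (eval-control a ca S₄))

  loadUp-range : let s′ = exec (loadUp e₁ a e₂ b rl rh d) s in
    rangeOf s′ ≡ range (shift (eval a s) (tabs s (eval e₁ s))) (shift (eval b s) (tabs s (eval e₂ s)))
        (eval rl s) (eval rh s)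
    × regs s′ 41 ≡ eval d s
  loadUp-range = range≡ first≡
      (cell≡ (cong₂ (λ i b → arrays s 8 i + b) i₂≡ (eval-control b cb S₅)) (cong (arrays s 9) i₂≡)
             (cong₂ (λ i b → arrays s 10 i + b) i₂≡ (eval-control b cb S₇)))
      (eval-control rl cl S₈) (eval-control rh ch S₉) , eval-control d cd S₁₀
    where
    s₆ s₇ s₈ s₉ : State
    s₆ = exec (set 33 (op add (8 ⟦ reg 43 ⟧) b)) s₅
    s₇ = exec (set 34 (9 ⟦ reg 43 ⟧)) s₆
    s₈ = exec (set 35 (op add (10 ⟦ reg 43 ⟧) b)) s₇
    s₉ = exec (set 37 rl) s₈
    S₇ : Same 30 8 s s₇
    S₇ = same-trans S₅ (frame (set 33 (op add (8 ⟦ reg 43 ⟧) b) ⨾ set 34 (9 ⟦ reg 43 ⟧)) s₅ _)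
    S₈ : Same 30 8 s s₈
    S₈ = same-trans S₇ (frame (set 35 (op add (10 ⟦ reg 43 ⟧) b)) s₇ _)
    S₉ : Same 30 8 s s₉
    S₉ = same-trans S₈ (frame (set 37 rl) s₈ _)
    S₁₀ : Same 30 8 s (exec (set 38 rh) s₉)
    S₁₀ = same-trans S₉ (frame (set 38 rh) s₉ _)

  loadDown-range : let s′ = exec (loadDown e₁ a e₂ b rl rh d) s in
    rangeOf s′ ≡ range (shift (eval a s) (tabs s (eval e₁ s))) (reflect (eval b s) (tabs s (eval e₂ s)))
        (eval rl s) (eval rh s)
    × regs s′ 41 ≡ eval d s
  loadDown-range = range≡ first≡
      (cell≡ (cong₂ (λ i b → b ∸ arrays s 10 i) i₂≡ (eval-control b cb S₅)) (cong (arrays s 9) i₂≡)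
             (cong₂ (λ i b → b ∸ arrays s 8 i) i₂≡ (eval-control b cb S₇)))
      (eval-control rl cl S₈) (eval-control rh ch S₉) , eval-control d cd S₁₀
    where
    s₆ s₇ s₈ s₉ : State
    s₆ = exec (set 33 (op sub b (10 ⟦ reg 43 ⟧))) s₅
    s₇ = exec (set 34 (9 ⟦ reg 43 ⟧)) s₆
    s₈ = exec (set 35 (op sub b (8 ⟦ reg 43 ⟧))) s₇
    s₉ = exec (set 37 rl) s₈
    S₇ : Same 30 8 s s₇
    S₇ = same-trans S₅ (frame (set 33 (op sub b (10 ⟦ reg 43 ⟧)) ⨾ set 34 (9 ⟦ reg 43 ⟧)) s₅ _)
    S₈ : Same 30 8 s s₈
    S₈ = same-trans S₇ (frame (set 35 (op sub b (8 ⟦ reg 43 ⟧))) s₇ _)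
    S₉ : Same 30 8 s s₉
    S₉ = same-trans S₈ (frame (set 37 rl) s₈ _)
    S₁₀ : Same 30 8 s (exec (set 38 rh) s₉)
    S₁₀ = same-trans S₉ (frame (set 38 rh) s₉ _)

-- The program for one pair of nonterminals and one pair of scales

xE iE jE yE x₁E x₂E y₁E y₂E lx₂E ly₁E lyE : Exp
xE   = reg 4
iE   = reg 5
jE   = reg 6
yE   = reg 20
x₁E  = reg 21
x₂E  = reg 22
y₁E  = reg 23
y₂E  = reg 24
lx₂E = reg 25
ly₁E = reg 26
lyE  = reg 27

nodeP : Program
nodeP = set 21 (6 ⟦ xE ⟧) ⨾ set 22 (2 ⟦ xE ⟧) ⨾ set 23 (6 ⟦ yE ⟧) ⨾ set 24 (2 ⟦ yE ⟧) ⨾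
        set 25 (4 ⟦ x₂E ⟧) ⨾ set 26 (4 ⟦ y₁E ⟧) ⨾ set 27 (4 ⟦ yE ⟧)

-- A copy is the intersection of a cell with itself, so `meetP` and its correctness serve here as
-- well.
copyL : Exp → Program
copyL e = loadUp e (lit 0) e (lit 0) (lit 1) (reg 2) (ιE xE yE jE)

-- The reflections express the complements |Y| - s and |X₂| + |Y₁| - l. The limits 1 and |Y| - 1 of
-- `endsL` leave a letter of Y on each side of the cut; those of `crossL` cut out the middle case
-- within scale j.
endsL crossL : Program
endsL  = loadDown (ιE x₁E yE iE) (lit 0) (ιE yE x₂E jE) lyE (lit 1) (op sub lyE (lit 1)) (ιE xE yE (reg 1))
crossL = loadDown (ιE xE y₁E (reg 1)) lx₂E (ιE yE x₂E (reg 1)) (op add lx₂E ly₁E)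
           (maxE (maxE (op add lx₂E (lit 1)) (op add ly₁E (lit 1))) (5 ⟦ jE ⟧))
           (minE (op sub (op add lx₂E ly₁E) (lit 1)) (op sub (5 ⟦ op add jE (lit 1) ⟧) (lit 1)))
           (ιE xE yE jE)

-- The target scale is always i; α and β are the scales of l - |X₂| and l - |Y₁|.
longL : Exp → Exp → Program
longL α β = loadUp (ιE x₁E yE α) lx₂E (ιE xE y₂E β) ly₁E
              (maxE (op add lx₂E ly₁E) (5 ⟦ iE ⟧)) (op sub (5 ⟦ op add iE (lit 1) ⟧) (lit 1)) (ιE xE yE iE)

letterL : Program
letterL = set 41 (ιE xE yE (lit 0)) ⨾ set 45 (lit 1)

copyYP copyXP endsP crossP letterP : Program
copyYP = copyL (ιE xE y₁E jE) ⨾ meetP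
copyXP = copyL (ιE x₂E yE jE) ⨾ meetP
endsP  = endsL ⨾ meetP
crossP = crossL ⨾ meetP
letterP = letterL ⨾ insertP

longP : Exp → Exp → Program
longP α β = longL α β ⨾ meetP

kindT : Exp → ℕ → Test
kindT e k = eq (0 ⟦ e ⟧) (lit k)

partY partX partXY partL bodyP blockP : Program
partY = branch (kindT yE 1) copyYP skip
partX = branch (kindT xE 1) (copyXP ⨾ endsP) skip
partXY = branch (and (kindT xE 1) (kindT yE 1))
           -- One of l - |X₂| and l - |Y₁| is at least l / 2 and so has scale i or i - 1, while j
           -- runs over the scales of the other one. For i = 0 the truncated i - 1 only repeats a
           -- step.
           (crossP ⨾ longP iE jE ⨾ longP (op sub iE (lit 1)) jE ⨾ longP jE iE ⨾ longP jE (op sub iE (lit 1)))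
               skip
partL = branch (and (and (kindT xE 0) (kindT yE 0)) (eq (1 ⟦ xE ⟧) (1 ⟦ yE ⟧))) letterP skip
bodyP = nodeP ⨾ partY ⨾ partX ⨾ partXY ⨾ partL
blockP = set 20 (op sub (reg 3) xE) ⨾
  branch (and (neg (lt (reg 3) xE)) (and (lt yE (reg 0)) (and (eq (3 ⟦ xE ⟧) (lit 1))
      (eq (3 ⟦ yE ⟧) (lit 1))))) bodyP skip

-- Correctness of the single steps for a pair of nonterminals

module Block (model : Model) where
  open Model model
  open Table model

  Earlier : ℕ → State → Set
  Earlier k s = ∀ x y → Live x → Live y → x + y < k → Done x y s

  record At (x y i j : ℕ) (s : State) : Set where
    field
      invariant : Inv s
      earlier   : Earlier (x + y) s
      live-x    : Live x
      live-y    : Live y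
      i<lg      : i < lg
      j<lg      : j < lg
      r4  : regs s 4 ≡ x
      r5  : regs s 5 ≡ i
      r6  : regs s 6 ≡ j
      r20 : regs s 20 ≡ y
      r21 : regs s 21 ≡ left x
      r22 : regs s 22 ≡ right x
      r23 : regs s 23 ≡ left y
      r24 : regs s 24 ≡ right y
      r25 : regs s 25 ≡ F 4 (right x)
      r26 : regs s 26 ≡ F 4 (left y)
      r27 : regs s 27 ≡ F 4 y

  at-step : ∀ {x y i j s s′} → At x y i j s → Progress s s′ → At x y i j s′
  at-step {s = s} {s′} A P = record
    { invariant = still-inv P
    ; earlier   = λ x y lx ly smaller → done-mono {x} {y} {s} {s′} (mono P) (At.earlier A x y lx ly smaller)
    ; live-x = At.live-x A ; live-y = At.live-y A ; i<lg = At.i<lg A ; j<lg = At.j<lg A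
    ; r4 = keep 4 _ (At.r4 A) ; r5 = keep 5 _ (At.r5 A) ; r6 = keep 6 _ (At.r6 A)
    ; r20 = keep 20 _ (At.r20 A) ; r21 = keep 21 _ (At.r21 A) ; r22 = keep 22 _ (At.r22 A) ; r23 =
        keep 23 _ (At.r23 A)
    ; r24 = keep 24 _ (At.r24 A) ; r25 = keep 25 _ (At.r25 A) ; r26 = keep 26 _ (At.r26 A) ; r27 =
        keep 27 _ (At.r27 A) }
    where
    keep : ∀ r {v} → T (r <ᵇ 30) → _ ≡ v → _ ≡ v
    keep r t e = trans (sameRegs (unchanged P) r (<ᵇ⇒< r 30 t)) e

  Seg : Program → State → (State → Set) → Set
  Seg P s Q = Run B P s (time P) (λ s′ → Progress s s′ × Q s′)

  ι≡ : ∀ {x x′ n′ y y′ l′ t t′} → x ≡ x′ → n′ ≡ n → y ≡ y′ → l′ ≡ lg → t ≡ t′ →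
      (x * n′ + y) * (l′ + 1) + t ≡ ι x′ y′ t′
  ι≡ refl refl refl refl refl = refl

  Cov : ℕ → ℕ → State → ℕ → ℕ → Set
  Cov x y s t l = Covers (tabs s (ι x y t)) l

  module Segments {x y i j : ℕ} {s : State} (A : At x y i j s) where
    open At A
    open Inv invariant using (reg-n; reg-lg; reg-N; fixed)

    ιE≡ : ∀ a b c {a′ b′ c′} → eval a s ≡ a′ → eval b s ≡ b′ → eval c s ≡ c′ → eval (ιE a b c) s ≡ ι a′ b′ c′
    ιE≡ a b c e f g = ι≡ e reg-n f reg-lg g

    power : ∀ e {t} → eval e s ≡ t → t ≤ lg → eval (5 ⟦ e ⟧) s ≡ 2 ^ t
    power e {t} e≡ t≤ = trans (cong₂ (λ f k → f k) (fixed 5 (<ᵇ⇒< 5 8 tt)) e≡) (powers t t≤)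

    done : ∀ {x′ y′} → Live x′ → Live y′ → x′ + y′ < x + y → Done x′ y′ s
    done = earlier _ _

    OvCov : (X Y : Str) → ℕ → State → Set
    OvCov X Y t s′ = ∀ l → OvScale X Y t l → Cov x y s′ t l

    copy-run : ∀ e {_ : D.OkP 2 (copyL e)} → Control e → ∀ {x′ y′} → Live x′ → Live y′ → x′ + y′ < x + y →
        eval e s ≡ ι x′ y′ j →
      (∀ l → Ov (W x′) (W y′) l → Ov (W x) (W y) l) →
      Seg (copyL e ⨾ meetP) s (OvCov (W x′) (W y′) j)
    copy-run e {ok} ce {x′} {y′} lx′ ly′ smaller e≡ widen = run-weaken ≤-refl
      (λ s′ (P , C) → P , λ l O → C l (Ov.l≥1 (proj₁ O) , Ov.l≥1 (proj₁ O) , ≤-trans (Ov.l≤Y (proj₁ O))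
          (len≤N ly′) , moved O , moved O))
      (meet-run (copyL e) {ok} s invariant R (ι x y j)
        (trans (proj₁ ranges) (range≡ (cong (λ k → shift 0 (tabs s k)) e≡)
            (cong (λ k → shift 0 (tabs s k)) e≡) refl reg-N))
        (trans (proj₂ ranges) (ιE≡ xE yE jE r4 r20 r6))
        ≤-refl
        (λ v t → sat x y j live-x live-y (<⇒≤ j<lg) refl (inj₁ (j<lg , target t)))
        al al (λ ne → ⊥-elim (ne refl)))
      where
      c = tabs s (ι x′ y′ j)
      R = range (shift 0 c) (shift 0 c) 1 N
      rp : Rep c (OvScale (W x′) (W y′) j)
      rp = rep-ov invariant lx′ ly′ (done lx′ ly′ smaller) j<lg
      ranges = loadUp-range e (lit 0) e (lit 0) (lit 1) (reg 2) (ιE xE yE jE) ce _ _ _ _ _ s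
      al : Aligned R (shift 0 c)
      al = shift-aligned 0 c (Rep.aligned rp)
      moved : ∀ {l} → OvScale (W x′) (W y′) j l → l ∈ᶜ shift 0 c
      moved {l} O = shift-∈ {0} {c} (+-identityʳ l) (Rep.member rp O)
      target : ∀ {v} → Range.Target R v → OvScale (W x) (W y) j v
      target {v} (v≥1 , _ , _ , v∈ , _) with shift-∈⁻ {0} {c} v∈
      ... | v′ , e′ , v′∈ with trans (sym (+-identityʳ v′)) e′
      ...   | refl with Rep.sound rp v≥1 v′∈
      ...     | O , sc = widen v O , sc

    copyY-run : IsPair y → Seg copyYP s (OvCov (W x) (W (left y)) j)
    copyY-run py = copy-run (ιE xE y₁E jE) _ live-x (IsPair.live-left py) (+-monoʳ-< x (IsPair.left< py))
      (ιE≡ xE y₁E jE r4 r23 r6) (λ l → ov-left (IsPair.cat py))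

    copyX-run : IsPair x → Seg copyXP s (OvCov (W (right x)) (W y) j)
    copyX-run px = copy-run (ιE x₂E yE jE) _ (IsPair.live-right px) live-y (+-monoˡ-< y (IsPair.right< px))
      (ιE≡ x₂E yE jE r22 r20 r6) (λ l → ov-right (IsPair.cat px))

    power⁺ : ∀ e {t} → eval e s ≡ t → t < lg → eval (5 ⟦ op add e (lit 1) ⟧) s ≡ 2 ^ suc t
    power⁺ e {t} e≡ t< = trans (power (op add e (lit 1)) {t + 1} (cong (_+ 1) e≡) (subst (_≤ lg) (+-comm 1 t)
        t<)) (cong (2 ^_) (+-comm t 1))

    below-power : ∀ {v t} → 1 ≤ v → v ≤ 2 ^ suc t ∸ 1 → v < 2 ^ suc t
    below-power {v} {t} v≥1 v≤ = subst (suc v ≤_) (m+[n∸m]≡n (≤-trans v≥1 (≤-trans v≤ (m∸n≤m _ 1)))) (s≤s v≤)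

    predecessor : ∀ {v w} → v < w → v ≤ w ∸ 1
    predecessor {v} {suc w} (s≤s v≤w) = v≤w

    module _ (px : IsPair x) where
      open IsPair px renaming (cat to catX; live-left to live-x₁; live-right to live-x₂; left< to
          x₁<x; right< to x₂<x)
      private
        X  = W x
        X₁ = W (left x)
        X₂ = W (right x)
        Y  = W y
        ly≡ : eval lyE s ≡ len Y
        ly≡ = trans r27 (len-F live-y)
        lx₂≡ : eval lx₂E s ≡ len X₂
        lx₂≡ = trans r25 (len-F live-x₂)

      ends-run : Seg endsP s (λ s′ → ∀ l u → Oc X (len X₁) Y l → l + u ≡ len Y → Scale i l →
          Scale j u → Cov x y s′ lg l)
      ends-run = run-weaken ≤-refl
        (λ s′ (P , C) → P , λ l u O l+u sl su → C l
          (Oc.s≥1 O , Oc.s≥1 O , predecessor (Oc.s<Y O) ,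
           shift-∈ {0} {a} (+-identityʳ l) (Rep.member A′ (oc-left catX O , sl)) ,
           reflect-∈ {len Y} {b} hb (Rep.aligned B′) l+u (Rep.member B′ (oc-right catX l+u O , su))))
        (meet-run endsL s invariant R (ι x y lg)
          (trans (proj₁ ranges) (range≡ (cong (λ k → shift 0 (tabs s k)) (ιE≡ x₁E yE iE r21 r20 r5))
            (cong₂ (λ c k → reflect c (tabs s k)) ly≡ (ιE≡ yE x₂E jE r20 r22 r6)) refl (cong (_∸ 1) ly≡)))
          (trans (proj₂ ranges) (ιE≡ xE yE (reg 1) r4 r20 reg-lg))
          ≤-refl
          (λ v t → sat x y lg live-x live-y ≤-refl refl (inj₂ (refl , px , target t)))
          (shift-aligned 0 a (Rep.aligned A′)) (reflect-aligned (len Y) b hb (Rep.aligned B′))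
          (separated-ends {X₁} {X₂} {Y} {i} {j} A′ B′ 1 (len Y ∸ 1) hb))
        where
        a = tabs s (ι (left x) y i)
        b = tabs s (ι y (right x) j)
        A′ : Rep a (OvScale X₁ Y i)
        A′ = rep-ov invariant live-x₁ live-y (done live-x₁ live-y (+-monoˡ-< y x₁<x)) i<lg
        B′ : Rep b (OvScale Y X₂ j)
        B′ = rep-ov invariant live-y live-x₂ (done live-y live-x₂ (subst (_< x + y) (+-comm (right x) y)
            (+-monoˡ-< y x₂<x))) j<lg
        hb : hi b ≤ len Y
        hb = Rep.hi-bound B′ λ v (O , _) → subst (v ≤_) (Ov.off+l O) (m≤n+m v (Ov.off O))
        R = range (shift 0 a) (reflect (len Y) b) 1 (len Y ∸ 1)
        ranges = loadDown-range (ιE x₁E yE iE) (lit 0) (ιE yE x₂E jE) lyE (lit 1) (op sub lyE (lit 1))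
            (ιE xE yE (reg 1)) _ _ _ _ _ _ s
        target : ∀ {v} → Range.Target R v → Oc X (len X₁) Y v
        target {v} (v≥1 , _ , v≤ , v∈a , v∈b) with shift-∈⁻ {0} {a} v∈a | reflect-∈⁻ {len Y} {b} hb
            (Rep.aligned B′) v∈b
        ... | v′ , e , v′∈ | u , v+u , u∈ with trans (sym (+-identityʳ v′)) e
        ...   | refl = oc-join catX v+u (proj₁ (Rep.sound A′ v≥1 v′∈)) (proj₁ (Rep.sound B′ u≥1 u∈))
          where
          u≥1 : 1 ≤ u
          u≥1 = lia 4 (λ v u y y′ → (v ⊕ u ≐ y) ∷ (v ≼ y′) ∷ (y′ ⊕ con 1 ≐ y) ∷ [] ⊢ˡ con 1 ≼ u) v u (len Y)
              (len Y ∸ 1) v+u v≤ (m∸n+n≡m (len≥1 live-y))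

      module _ (py : IsPair y) where
        open IsPair py using () renaming (cat to catY; live-left to live-y₁; live-right to live-y₂; left< to
            y₁<y; right< to y₂<y)
        private
          Y₁ = W (left y)
          Y₂ = W (right y)
          ly₁≡ : eval ly₁E s ≡ len Y₁
          ly₁≡ = trans r26 (len-F live-y₁)
          sum≡ : eval (op add lx₂E ly₁E) s ≡ len X₂ + len Y₁
          sum≡ = cong₂ _+_ lx₂≡ ly₁≡

        cross-run : Seg crossP s (λ s′ → ∀ l → OvScale X Y j l → len X₂ < l → len Y₁ < l → l < len X₂ + len
            Y₁ → Cov x y s′ j l)
        cross-run = run-weaken ≤-refl
          (λ s′ (P , C) → P , λ l O x₂<l y₁<l l< → C l (covered l O x₂<l y₁<l l<))
          (meet-run crossL s invariant R (ι x y j)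
            (trans (proj₁ ranges) (range≡ (cong₂ (λ c k → shift c (tabs s k)) lx₂≡
                (ιE≡ xE y₁E (reg 1) r4 r23 reg-lg))
              (cong₂ (λ c k → reflect c (tabs s k)) sum≡ (ιE≡ yE x₂E (reg 1) r20 r22 reg-lg))
              (cong₂ maxˢ (cong₂ maxˢ (cong (_+ 1) lx₂≡) (cong (_+ 1) ly₁≡)) (power jE r6 (<⇒≤ j<lg)))
              (cong₂ minˢ (cong (_∸ 1) sum≡) (cong (_∸ 1) (power⁺ jE r6 j<lg)))))
            (trans (proj₂ ranges) (ιE≡ xE yE jE r4 r20 r6))
            (≤-trans (≤-trans (m≤n+m 1 (len X₂)) (max≥ˡ (len X₂ + 1) (len Y₁ + 1))) (max≥ˡ _ (2 ^ j)))
            (λ v t → sat x y j live-x live-y (<⇒≤ j<lg) refl (inj₁ (j<lg , target t)))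
            (shift-aligned (len X₂) a (Rep.aligned A′)) (reflect-aligned (len X₂ + len Y₁) b
                hb (Rep.aligned B′))
            (separated-cross {X} {Y} {Y₁} {Y₂} {X₂} {len X₁} catY A′ B′ rl rh hb))
          where
          a = tabs s (ι x (left y) lg)
          b = tabs s (ι y (right x) lg)
          A′ : Rep a (Oc X (len X₁) Y₁)
          A′ = rep-oc invariant live-x live-y₁ (done live-x live-y₁ (+-monoʳ-< x y₁<y)) px
          B′ : Rep b (Oc Y (len Y₁) X₂)
          B′ = rep-oc invariant live-y live-x₂ (done live-y live-x₂ (subst (_< x + y) (+-comm (right x) y)
              (+-monoˡ-< y x₂<x))) py
          hb : hi b ≤ len X₂ + len Y₁
          hb = Rep.hi-bound B′ λ v O → ≤-trans (<⇒≤ (Oc.s<Y O)) (m≤m+n (len X₂) (len Y₁))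
          rl = maxˢ (maxˢ (len X₂ + 1) (len Y₁ + 1)) (2 ^ j)
          rh = minˢ (len X₂ + len Y₁ ∸ 1) (2 ^ suc j ∸ 1)
          R = range (shift (len X₂) a) (reflect (len X₂ + len Y₁) b) rl rh
          ranges = loadDown-range (ιE xE y₁E (reg 1)) lx₂E (ιE yE x₂E (reg 1)) (op add lx₂E ly₁E)
            (maxE (maxE (op add lx₂E (lit 1)) (op add ly₁E (lit 1))) (5 ⟦ jE ⟧))
            (minE (op sub (op add lx₂E ly₁E) (lit 1)) (op sub (5 ⟦ op add jE (lit 1) ⟧) (lit 1)))
            (ιE xE yE jE) _ _ _ _ _ _ s
          covered : ∀ l → OvScale X Y j l → len X₂ < l → len Y₁ < l → l < len X₂ + len Y₁ → Range.Target R l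
          covered l (O , sc) x₂<l y₁<l l< = Ov.l≥1 O ,
            max-lub {maxˢ (len X₂ + 1) (len Y₁ + 1)} (max-lub {len X₂ + 1} (subst (_≤ l) (+-comm 1 (len X₂))
                x₂<l) (subst (_≤ l) (+-comm 1 (len Y₁)) y₁<l)) (proj₁ sc) ,
            min-glb {len X₂ + len Y₁ ∸ 1} (predecessor l<) (predecessor (proj₂ sc)) ,
            shift-∈ {len X₂} {a} s₁+ (Rep.member A′ (ov-crossˡ catX catY s₁≥1 s₁+ y₁<l s₁<y₁ O)) ,
            reflect-∈ {len X₂ + len Y₁} {b} hb (Rep.aligned B′) (m+[n∸m]≡n (<⇒≤ l<))
              (Rep.member B′ (ov-crossʳ catX catY s₁+ s₁+s₂ (m<n⇒0<n∸m l<) y₁<l O))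
            where
            s₁ = l ∸ len X₂
            s₂ = len X₂ + len Y₁ ∸ l
            s₁+ : s₁ + len X₂ ≡ l
            s₁+ = m∸n+n≡m (<⇒≤ x₂<l)
            s₁≥1 : 1 ≤ s₁
            s₁≥1 = m<n⇒0<n∸m x₂<l
            s₁<y₁ : s₁ < len Y₁
            s₁<y₁ = lia 4 (λ s l x y → (s ⊕ x ≐ l) ∷ (l ≺ x ⊕ y) ∷ [] ⊢ˡ s ≺ y) s₁ l (len X₂) (len Y₁) s₁+ l<
            s₁+s₂ : s₁ + s₂ ≡ len Y₁
            s₁+s₂ = lia 5 (λ s u l x y → (s ⊕ x ≐ l) ∷ (l ⊕ u ≐ x ⊕ y) ∷ [] ⊢ˡ s ⊕ u ≐ y) s₁ s₂ l (len X₂)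
                (len Y₁) s₁+ (m+[n∸m]≡n (<⇒≤ l<))
          target : ∀ {v} → Range.Target R v → OvScale X Y j v
          target {v} (v≥1 , rl≤v , v≤rh , v∈a , v∈b)
            with shift-∈⁻ {len X₂} {a} v∈a | reflect-∈⁻ {len X₂ + len Y₁} {b} hb (Rep.aligned B′) v∈b
          ... | s₁ , s₁+ , s₁∈ | s₂ , v+s₂ , s₂∈ =
            ov-cross catX catY s₁+ (lia 5 (λ s u l x y → (s ⊕ x ≐ l) ∷ (l ⊕ u ≐ x ⊕ y) ∷ [] ⊢ˡ s ⊕ u ≐ y) s₁
                s₂ v (len X₂) (len Y₁) s₁+ v+s₂)
              (Rep.sound A′ s₁≥1 s₁∈) (Rep.sound B′ s₂≥1 s₂∈) ,
            (≤-trans (max≥ʳ (maxˢ (len X₂ + 1) (len Y₁ + 1)) (2 ^ j)) rl≤v , below-power {v} {j} v≥1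
                (≤-trans v≤rh (min≤ʳ (len X₂ + len Y₁ ∸ 1) _)))
            where
            s₁≥1 : 1 ≤ s₁
            s₁≥1 = lia 3 (λ s x v → (s ⊕ x ≐ v) ∷ (x ⊕ con 1 ≼ v) ∷ [] ⊢ˡ con 1 ≼ s) s₁ (len X₂) v s₁+
              (≤-trans (≤-trans (max≥ˡ (len X₂ + 1) (len Y₁ + 1)) (max≥ˡ _ (2 ^ j))) rl≤v)
            s₂≥1 : 1 ≤ s₂
            s₂≥1 = lia 4 (λ s v t t′ → (v ⊕ s ≐ t) ∷ (v ≼ t′) ∷ (t′ ⊕ con 1 ≐ t) ∷ [] ⊢ˡ con 1 ≼ s) s₂ v
                (len X₂ + len Y₁) (len X₂ + len Y₁ ∸ 1) v+s₂
              (≤-trans v≤rh (min≤ˡ _ (2 ^ suc j ∸ 1)))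
                  (m∸n+n≡m (≤-trans (len≥1 live-x₂) (m≤m+n (len X₂) (len Y₁))))

        LongCov : ℕ → ℕ → State → Set
        LongCov a b s′ = ∀ l m m′ → OvScale X Y i l → len X₂ + len Y₁ ≤ l → m + len X₂ ≡ l → m′ + len Y₁ ≡ l →
                         Scale a m → Scale b m′ → Cov x y s′ i l

        long-run : ∀ αE βE {α β} {_ : D.OkP 2 (longL αE βE)} → Control βE → eval αE s ≡ α →
            eval βE s ≡ β → α < lg → β < lg →
                   Seg (longP αE βE) s (LongCov α β)
        long-run αE βE {α} {β} {ok} cβ α≡ β≡ α< β< = run-weaken ≤-refl
          (λ s′ (P , C) → P , λ l m m′ (O , sc) s≤l m+ m′+ sm sm′ → C l
            (Ov.l≥1 O , max-lub {len X₂ + len Y₁} s≤l (proj₁ sc) , predecessor (proj₂ sc) ,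
             shift-∈ {len X₂} {a} m+ (Rep.member A′ (ov-drop catX (m≥1 l m m+ s≤l) m+ O , sm)) ,
             shift-∈ {len Y₁} {b} m′+ (Rep.member B′ (ov-dropʳ catY (m′≥1 l m′ m′+ s≤l) m′+ O , sm′))))
          (meet-run (longL αE βE) {ok} s invariant R (ι x y i)
            (trans (proj₁ ranges) (range≡ (cong₂ (λ c k → shift c (tabs s k)) lx₂≡ (ιE≡ x₁E yE αE r21 r20 α≡))
              (cong₂ (λ c k → shift c (tabs s k)) ly₁≡ (ιE≡ xE y₂E βE r4 r24 β≡))
              (cong₂ maxˢ sum≡ (power iE r5 (<⇒≤ i<lg)))
              (cong (_∸ 1) (power⁺ iE r5 i<lg))))
            (trans (proj₂ ranges) (ιE≡ xE yE iE r4 r20 r5))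
            (≤-trans (≤-trans (len≥1 live-x₂) (m≤m+n (len X₂) (len Y₁))) (max≥ˡ (len X₂ + len Y₁) (2 ^ i)))
            (λ v t → sat x y i live-x live-y (<⇒≤ i<lg) refl (inj₁ (i<lg , target t)))
            (shift-aligned (len X₂) a (Rep.aligned A′)) (shift-aligned (len Y₁) b (Rep.aligned B′))
            (separated-long {X} {X₁} {Y} {Y₁} {Y₂} {len X₂} {α} {β} catY A′ B′ rl rh
                (max≥ˡ (len X₂ + len Y₁) (2 ^ i))))
          where
          a = tabs s (ι (left x) y α)
          b = tabs s (ι x (right y) β)
          A′ : Rep a (OvScale X₁ Y α)
          A′ = rep-ov invariant live-x₁ live-y (done live-x₁ live-y (+-monoˡ-< y x₁<x)) α<
          B′ : Rep b (OvScale X Y₂ β)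
          B′ = rep-ov invariant live-x live-y₂ (done live-x live-y₂ (+-monoʳ-< x y₂<y)) β<
          rl = maxˢ (len X₂ + len Y₁) (2 ^ i)
          rh = 2 ^ suc i ∸ 1
          R = range (shift (len X₂) a) (shift (len Y₁) b) rl rh
          ranges = loadUp-range (ιE x₁E yE αE) lx₂E (ιE xE y₂E βE) ly₁E
              (maxE (op add lx₂E ly₁E) (5 ⟦ iE ⟧)) (op sub (5 ⟦ op add iE (lit 1) ⟧) (lit 1)) (ιE xE yE iE)
              (((((_ , _) , _) , _)) , cβ) _ _ _ _ _ s
          m≥y₁ : ∀ l m → m + len X₂ ≡ l → len X₂ + len Y₁ ≤ l → len Y₁ ≤ m
          m≥y₁ l m m+ s≤l = lia 4 (λ l m x y → (m ⊕ x ≐ l) ∷ (x ⊕ y ≼ l) ∷ [] ⊢ˡ y ≼ m) l m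
              (len X₂) (len Y₁) m+ s≤l
          m≥1 : ∀ l m → m + len X₂ ≡ l → len X₂ + len Y₁ ≤ l → 1 ≤ m
          m≥1 l m m+ s≤l = ≤-trans (len≥1 live-y₁) (m≥y₁ l m m+ s≤l)
          m′≥1 : ∀ l m → m + len Y₁ ≡ l → len X₂ + len Y₁ ≤ l → 1 ≤ m
          m′≥1 l m m+ s≤l = lia 4 (λ l m x y → (m ⊕ y ≐ l) ∷ (x ⊕ y ≼ l) ∷ (con 1 ≼ x) ∷ [] ⊢ˡ con 1 ≼ m) l m
              (len X₂) (len Y₁) m+ s≤l (len≥1 live-x₂)
          target : ∀ {v} → Range.Target R v → OvScale X Y i v
          target {v} (v≥1 , rl≤v , v≤rh , v∈a , v∈b) with shift-∈⁻ {len X₂} {a} v∈a |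
              shift-∈⁻ {len Y₁} {b} v∈b
          ... | m , m+ , m∈ | m′ , m′+ , m′∈ =
            ov-join catX catY m+ m′+ (m≥y₁ v m m+ s≤v) (proj₁ (Rep.sound A′ (m≥1 v m m+ s≤v) m∈))
                (proj₁ (Rep.sound B′ (m′≥1 v m′ m′+ s≤v) m′∈)) ,
            (≤-trans (max≥ʳ (len X₂ + len Y₁) (2 ^ i)) rl≤v , below-power {v} {i} v≥1 v≤rh)
            where
            s≤v : len X₂ + len Y₁ ≤ v
            s≤v = ≤-trans (max≥ˡ (len X₂ + len Y₁) (2 ^ i)) rl≤v

    letter-run : IsLetter x → IsLetter y → F 1 x ≡ F 1 y → 0 < lg → Seg letterP s (λ s′ → Cov x y s′ 0 1)
    letter-run qx qy codes 0<lg = run-weaken ≤-refl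
      (λ s′ (P , e) → P , subst (λ c → Covers c 1) (sym e) (ins-covers ≤-refl (Inv.valid invariant k)))
      (step-run letterL insertP s invariant k (ins 1 (tabs s k))
        (subst (λ q → Effect s₁ (exec insertP s₁) q (ins 1 (tabs s q))) (ιE≡ xE yE (lit 0) r4 r20 refl)
            (effect-insert s₁))
        (ins-valid (sat x y 0 live-x live-y (<⇒≤ 0<lg) refl (inj₁ (0<lg , O , ≤-refl , ≤-refl))))
        (λ v → ins-mono))
      where
      k = ι x y 0
      s₁ = exec letterL s
      O : Ov (W x) (W y) 1
      O = ov 0 (sym (IsLetter.len≡1 qx)) ≤-refl (≤-reflexive (sym (IsLetter.len≡1 qy)))
        λ { zero _ → trans (IsLetter.code qx) (trans codes (sym (IsLetter.code qy))) ; (suc z) (s≤s ()) }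

-- A pair is complete once all pairs of scales have been treated

≡ᵇ-true : ∀ {m n} → (m ≡ᵇ n) ≡ true → m ≡ n
≡ᵇ-true {m} {n} e = ≡ᵇ⇒≡ m n (subst T (sym e) tt)

true-≡ᵇ : ∀ {m n} → m ≡ n → (m ≡ᵇ n) ≡ true
true-≡ᵇ {m} refl with m ≡ᵇ m | ≡⇒≡ᵇ m m refl
... | true | _ = refl

true-<ᵇ : ∀ {m n} → m < n → (m <ᵇ n) ≡ true
true-<ᵇ {m} {n} p with m <ᵇ n | <⇒<ᵇ p
... | true | _ = refl

false-<ᵇ : ∀ {m n} → n ≤ m → (m <ᵇ n) ≡ false
false-<ᵇ {m} {n} p with m <ᵇ n | <ᵇ⇒< m n
... | true  | f = ⊥-elim (<⇒≱ (f tt) p)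
... | false | _ = refl

∧-true : ∀ {a b} → (a ∧ b) ≡ true → a ≡ true × b ≡ true
∧-true {true} {true} _ = refl , refl

∧-intro : ∀ {a b} → a ≡ true → b ≡ true → (a ∧ b) ≡ true
∧-intro refl refl = refl

not-true : ∀ {a} → not a ≡ true → a ≡ false
not-true {false} _ = refl

true≢false : ∀ {b : Bool} → b ≡ true → b ≡ false → ⊥
true≢false refl ()

scale-exists : ∀ {m} k → 1 ≤ m → m < 2 ^ k → ∃ λ t → t < k × Scale t m
scale-exists zero m≥1 m<1 = ⊥-elim (<⇒≱ m<1 m≥1)
scale-exists {m} (suc k) m≥1 m< with 2 ^ k ≤? m
... | yes le = k , ≤-refl , le , m<
... | no ≰ with scale-exists k m≥1 (≰⇒> ≰)
...   | t , t<k , sc = t , m<n⇒m<1+n t<k , sc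

module Body (model : Model) where
  open Model model
  open Table model
  open Block model

  -- The contribution of the pass with scales i and j. Each field mentions only coverage, so it
  -- persists through later passes by monotonicity.
  record Facts (x y i j : ℕ) (s : State) : Set where
    field
      byY   : IsPair y → ∀ l → OvScale (W x) (W (left y)) j l → Cov x y s j l
      byX   : IsPair x → ∀ l → OvScale (W (right x)) (W y) j l → Cov x y s j l
      ends  : IsPair x → ∀ l u → Oc (W x) (len (W (left x))) (W y) l → l + u ≡ len (W y) → Scale i l →
          Scale j u → Cov x y s lg l
      cross : IsPair x → IsPair y → ∀ l → OvScale (W x) (W y) j l → len (W (right x)) < l →
          len (W (left y)) < l →
              l < len (W (right x)) + len (W (left y)) → Cov x y s j l
      long  : IsPair x → IsPair y → ∀ a b → (a ≡ i ⊎ a ≡ i ∸ 1) × b ≡ j ⊎ a ≡ j × (b ≡ i ⊎ b ≡ i ∸ 1) →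
              ∀ l m m′ → OvScale (W x) (W y) i l → len (W (right x)) + len (W (left y)) ≤ l →
              m + len (W (right x)) ≡ l → m′ + len (W (left y)) ≡ l → Scale a m → Scale b m′ → Cov x y s i l
      unit  : IsLetter x → IsLetter y → F 1 x ≡ F 1 y → Cov x y s 0 1

  facts-mono : ∀ {x y i j s s′} → Mono s s′ → Facts x y i j s → Facts x y i j s′
  facts-mono m f = record
    { byY   = λ p l o → m _ l (byY p l o)
    ; byX   = λ p l o → m _ l (byX p l o)
    ; ends  = λ p l u o e a b → m _ l (ends p l u o e a b)
    ; cross = λ p q l o a b c → m _ l (cross p q l o a b c)
    ; long  = λ p q a b w l u v o c d e g h → m _ l (long p q a b w l u v o c d e g h)
    ; unit  = λ p q e → m _ 1 (unit p q e) }
    where open Facts f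

  -- For each element the scales of its two constituents single out the pass that inserted it. A
  -- crossing occurrence uses the scales of s and |Y| - s; an overlap follows the cases given by the
  -- two cuts, with letters as the base.
  facts-done : ∀ {x y s} → Live x → Live y → (∀ i j → i < lg → j < lg → Facts x y i j s) → Done x y s
  facts-done {x} {y} {s} lx ly facts t l t≤ (inj₂ (refl , px , O)) =
    Facts.ends (facts (proj₁ sl) (proj₁ su) (proj₁ (proj₂ sl)) (proj₁ (proj₂ su))) px l u O l+u
        (proj₂ (proj₂ sl)) (proj₂ (proj₂ su))
    where
    u = len (W y) ∸ l
    l+u : l + u ≡ len (W y)
    l+u = m+[n∸m]≡n (<⇒≤ (Oc.s<Y O))
    sl = scale-exists lg (Oc.s≥1 O) (≤-<-trans (≤-trans (<⇒≤ (Oc.s<Y O)) (len≤N ly)) N<2^lg)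
    su = scale-exists lg (m<n⇒0<n∸m (Oc.s<Y O)) (≤-<-trans (≤-trans (m∸n≤m (len (W y)) l) (len≤N ly)) N<2^lg)
  facts-done {x} {y} {s} lx ly facts t l t≤ (inj₁ (t<lg , O , sc)) = go (shape lx) (shape ly)
    where
    0<lg : 0 < lg
    0<lg = ≤-<-trans z≤n t<lg
    open Facts (facts t t t<lg t<lg)
    l≤X : l ≤ len (W x)
    l≤X = subst (l ≤_) (Ov.off+l O) (m≤n+m l (Ov.off O))
    viaY : (py : IsPair y) → l ≤ len (W (left y)) → Cov x y s t l
    viaY py l≤ = byY py l (ov-left⁻ (IsPair.cat py) l≤ O , sc)
    viaX : (px : IsPair x) → l ≤ len (W (right x)) → Cov x y s t l
    viaX px l≤ = byX px l (ov-right⁻ (IsPair.cat px) l≤ O , sc)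
    go : IsPair x ⊎ IsLetter x → IsPair y ⊎ IsLetter y → Cov x y s t l
    go (inj₂ qx) (inj₁ py) = viaY py (≤-trans (subst (l ≤_) (IsLetter.len≡1 qx) l≤X)
        (len≥1 (IsPair.live-left py)))
    go (inj₁ px) (inj₂ qy) = viaX px (≤-trans (subst (l ≤_) (IsLetter.len≡1 qy) (Ov.l≤Y O))
        (len≥1 (IsPair.live-right px)))
    go (inj₂ qx) (inj₂ qy) = subst₂ (λ t l → Cov x y s t l) 0≡t (sym l≡1) (unit qx qy codes)
      where
      l≡1 : l ≡ 1
      l≡1 = ≤-antisym (subst (l ≤_) (IsLetter.len≡1 qy) (Ov.l≤Y O)) (Ov.l≥1 O)
      0≡t : 0 ≡ t
      0≡t = small t (subst (2 ^ t ≤_) l≡1 (proj₁ sc))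
        where
        small : ∀ t → 2 ^ t ≤ 1 → 0 ≡ t
        small zero    _ = refl
        small (suc t) p = ⊥-elim (lia 1 (λ p → (2 ⊛ p ≼ con 1) ∷ (con 1 ≼ p) ∷ [] ⊢ˡ absurd)
            (2 ^ t) p (m^n>0 2 t))
      off≡0 : Ov.off O ≡ 0
      off≡0 = lia 3 (λ o l x → (o ⊕ l ≐ x) ∷ (x ≐ con 1) ∷ (con 1 ≼ l) ∷ [] ⊢ˡ o ≐ con 0) (Ov.off O) l
          (len (W x)) (Ov.off+l O) (IsLetter.len≡1 qx) (Ov.l≥1 O)
      codes : F 1 x ≡ F 1 y
      codes = trans (sym (IsLetter.code qx)) (trans (subst (λ o → at (W x) o ≡ at (W y) 0)
          (trans (+-identityʳ (Ov.off O)) off≡0) (Ov.match O 0 (Ov.l≥1 O))) (IsLetter.code qy))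
    go (inj₁ px) (inj₁ py) with l ≤? len (W (left y)) | l ≤? len (W (right x))
    ... | yes l≤ | _ = viaY py l≤
    ... | no _ | yes l≤ = viaX px l≤
    ... | no y₁<l | no x₂<l with l <? len (W (right x)) + len (W (left y))
    ...   | yes l< = cross px py l (O , sc) (≰⇒> x₂<l) (≰⇒> y₁<l) l<
    ...   | no l≮ = longer (≤-total m m′)
      where
      x₂ = len (W (right x))
      y₁ = len (W (left y))
      s≤l : x₂ + y₁ ≤ l
      s≤l = ≮⇒≥ l≮
      m = l ∸ x₂
      m′ = l ∸ y₁
      m+ : m + x₂ ≡ l
      m+ = m∸n+n≡m (<⇒≤ (≰⇒> x₂<l))
      m′+ : m′ + y₁ ≡ l
      m′+ = m∸n+n≡m (<⇒≤ (≰⇒> y₁<l))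
      l<2^lg : l < 2 ^ lg
      l<2^lg = ≤-<-trans (≤-trans (Ov.l≤Y O) (len≤N ly)) N<2^lg
      l≤m+m′ : l ≤ m + m′
      l≤m+m′ = lia 5 (λ l m m′ x y → (m ⊕ x ≐ l) ∷ (m′ ⊕ y ≐ l) ∷ (x ⊕ y ≼ l) ∷ [] ⊢ˡ l ≼ m ⊕ m′) l m
          m′ x₂ y₁ m+ m′+ s≤l
      -- The larger of two numbers with sum at least l is at least l / 2, which costs at most one
      -- scale.
      near : ∀ {q q′} → q ≤ q′ → q′ ≤ l → l ≤ q + q′ → ∃ λ a → (a ≡ t ⊎ a ≡ t ∸ 1) × Scale a q′
      near {q} {q′} q≤q′ q′≤l l≤ with 2 ^ t ≤? q′
      ... | yes le = t , inj₁ refl , le , ≤-<-trans q′≤l (proj₂ sc)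
      ... | no ≰ = lower t refl
        where
        lower : ∀ u → u ≡ t → ∃ λ a → (a ≡ t ⊎ a ≡ t ∸ 1) × Scale a q′
        lower zero refl = ⊥-elim (lia 3 (λ q q′ l → (q ≼ q′) ∷ (q′ ≺ con 1) ∷ (l ≼ q ⊕ q′) ∷ (con 1 ≼ l) ∷
            [] ⊢ˡ absurd) q q′ l q≤q′ (≰⇒> ≰) l≤ (Ov.l≥1 O))
        lower (suc u) refl = u , inj₂ refl ,
          lia 4 (λ q q′ l p → (q ≼ q′) ∷ (l ≼ q ⊕ q′) ∷ (2 ⊛ p ≼ l) ∷ [] ⊢ˡ p ≼ q′) q q′ l (2 ^ u) q≤q′ l≤
              (proj₁ sc) , ≰⇒> ≰
      scaleOf : ∀ {q} z → q + z ≡ l → 1 ≤ q → ∃ λ b → b < lg × Scale b q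
      scaleOf {q} z e q≥1 = scale-exists lg q≥1 (≤-<-trans (subst (q ≤_) e (m≤m+n q z)) l<2^lg)
      longer : m ≤ m′ ⊎ m′ ≤ m → Cov x y s t l
      longer (inj₁ m≤m′) with near m≤m′ (subst (m′ ≤_) m′+ (m≤m+n m′ y₁)) l≤m+m′ | scaleOf x₂ m+
          (m<n⇒0<n∸m (≰⇒> x₂<l))
      ... | b , b≡ , sb | j , j<lg , sj = Facts.long (facts t j t<lg j<lg) px py j b (inj₂ (refl , b≡)) l m m′
          (O , sc) s≤l m+ m′+ sj sb
      longer (inj₂ m′≤m) with near m′≤m (subst (m ≤_) m+ (m≤m+n m x₂)) (subst (l ≤_) (+-comm m m′) l≤m+m′) |
          scaleOf y₁ m′+ (m<n⇒0<n∸m (≰⇒> y₁<l))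
      ... | a , a≡ , sa | j , j<lg , sj = Facts.long (facts t j t<lg j<lg) px py a j (inj₁ (a≡ , refl)) l m m′
          (O , sc) s≤l m+ m′+ sa sj

  module Parts {x y i j : ℕ} {s : State} (A : At x y i j s) where
    open At A
    private
      I = invariant

    kind-x : eval (0 ⟦ xE ⟧) s ≡ F 0 x
    kind-x = cong₂ (λ f k → f k) (Inv.fixed I 0 (<ᵇ⇒< 0 8 tt)) r4

    kind-y : eval (0 ⟦ yE ⟧) s ≡ F 0 y
    kind-y = cong₂ (λ f k → f k) (Inv.fixed I 0 (<ᵇ⇒< 0 8 tt)) r20

    code-x : eval (1 ⟦ xE ⟧) s ≡ F 1 x
    code-x = cong₂ (λ f k → f k) (Inv.fixed I 1 (<ᵇ⇒< 1 8 tt)) r4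

    code-y : eval (1 ⟦ yE ⟧) s ≡ F 1 y
    code-y = cong₂ (λ f k → f k) (Inv.fixed I 1 (<ᵇ⇒< 1 8 tt)) r20

    fits : ∀ b {_ : D.OkTest 2 b} → FitsTest B b s
    fits b {o} = D.okTest-sound 2 (inv-bounded I) b o

    pair? : ∀ {z} → Live z → F 0 z ≡ 1 → IsPair z
    pair? lz e with shape lz
    ... | inj₁ p = p
    ... | inj₂ q with trans (sym e) (IsLetter.kind q)
    ...   | ()

    letter? : ∀ {z} → Live z → F 0 z ≡ 0 → IsLetter z
    letter? lz e with shape lz
    ... | inj₂ q = q
    ... | inj₁ p with trans (sym e) (IsPair.kind p)
    ...   | ()

    skip-run : ∀ {Q : State → Set} → Q s → Run B skip s 1 (λ s′ → Progress s s′ × Q s′)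
    skip-run q = run-weaken ≤-refl (λ { _ refl → progress-refl I , q }) (run-exec skip s tt)

    partY-run : Seg partY s (λ s′ → IsPair y → ∀ l → OvScale (W x) (W (left y)) j l → Cov x y s′ j l)
    partY-run = run-branch (fits (kindT yE 1))
      (λ e → run-weaken ≤-refl (λ s′ (P , C) → P , λ _ → C) (Segments.copyY-run A
          (pair? live-y (trans (sym kind-y) (≡ᵇ-true e)))))
      (λ e → skip-run λ p → ⊥-elim (true≢false (true-≡ᵇ (trans kind-y (IsPair.kind p))) e))

    partX-run : Seg partX s (λ s′ → IsPair x →
      (∀ l → OvScale (W (right x)) (W y) j l → Cov x y s′ j l) ×
      (∀ l u → Oc (W x) (len (W (left x))) (W y) l → l + u ≡ len (W y) → Scale i l →
          Scale j u → Cov x y s′ lg l))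
    partX-run = run-branch (fits (kindT xE 1))
      (λ e → let px = pair? live-x (trans (sym kind-x) (≡ᵇ-true e)) in
        run-seq (Segments.copyX-run A px) λ s₁ (P₁ , C₁) →
        run-weaken ≤-refl (λ s₂ (P₂ , C₂) → progress-trans P₁ P₂ , λ _ → (λ l o → mono P₂ _ l (C₁ l o)) , C₂)
          (Segments.ends-run (at-step A P₁) px))
      (λ e → skip-run λ p → ⊥-elim (true≢false (true-≡ᵇ (trans kind-x (IsPair.kind p))) e))

    LongCov : ℕ → ℕ → State → Set
    LongCov a b s′ = ∀ l m m′ → OvScale (W x) (W y) i l → len (W (right x)) + len (W (left y)) ≤ l →
                     m + len (W (right x)) ≡ l → m′ + len (W (left y)) ≡ l → Scale a m →
                         Scale b m′ → Cov x y s′ i l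

    partXY-run : Seg partXY s (λ s′ → IsPair x → IsPair y →
      (∀ l → OvScale (W x) (W y) j l → len (W (right x)) < l → len (W (left y)) < l →
              l < len (W (right x)) + len (W (left y)) → Cov x y s′ j l) ×
      LongCov i j s′ × LongCov (i ∸ 1) j s′ × LongCov j i s′ × LongCov j (i ∸ 1) s′)
    partXY-run = run-branch (fits (and (kindT xE 1) (kindT yE 1)))
      (λ e → let px = pair? live-x (trans (sym kind-x) (≡ᵇ-true (proj₁ (∧-true e))))
                 py = pair? live-y (trans (sym kind-y) (≡ᵇ-true (proj₂ (∧-true e))))
                 i∸1< = ≤-<-trans (m∸n≤m i 1) i<lg in
        run-seq (Segments.cross-run A px py) λ s₁ (P₁ , C₁) → let A₁ = at-step A P₁ in
        run-seq (Segments.long-run A₁ px py iE jE _ (At.r5 A₁) (At.r6 A₁) i<lg j<lg) λ s₂ (P₂ , C₂) → let A₂ = at-step A₁ P₂ in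
        run-seq (Segments.long-run A₂ px py (op sub iE (lit 1)) jE _ (cong (_∸ 1) (At.r5 A₂)) (At.r6 A₂) i∸1< j<lg) λ s₃ (P₃ , C₃) → let A₃ = at-step A₂ P₃ in
        run-seq (Segments.long-run A₃ px py jE iE _ (At.r6 A₃) (At.r5 A₃) j<lg i<lg) λ s₄ (P₄ , C₄) → let A₄ = at-step A₃ P₄ in
        run-weaken ≤-refl (λ s₅ (P₅ , C₅) →
            progress-trans P₁ (progress-trans P₂ (progress-trans P₃ (progress-trans P₄ P₅))) , λ _ _ →
            (λ l o a b c → mono P₅ _ l (mono P₄ _ l (mono P₃ _ l (mono P₂ _ l (C₁ l o a b c))))) ,
            (λ l m m′ o a b c d f → mono P₅ _ l (mono P₄ _ l (mono P₃ _ l (C₂ l m m′ o a b c d f)))) ,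
            (λ l m m′ o a b c d f → mono P₅ _ l (mono P₄ _ l (C₃ l m m′ o a b c d f))) ,
            (λ l m m′ o a b c d f → mono P₅ _ l (C₄ l m m′ o a b c d f)) , C₅)
          (Segments.long-run A₄ px py jE (op sub iE (lit 1)) _ (At.r6 A₄) (cong (_∸ 1) (At.r5 A₄)) j<lg i∸1<))
      (λ e → skip-run λ p q → ⊥-elim (true≢false (∧-intro (true-≡ᵇ (trans kind-x (IsPair.kind p)))
          (true-≡ᵇ (trans kind-y (IsPair.kind q)))) e))

    partL-run : Seg partL s (λ s′ → IsLetter x → IsLetter y → F 1 x ≡ F 1 y → Cov x y s′ 0 1)
    partL-run = run-branch (fits (and (and (kindT xE 0) (kindT yE 0)) (eq (1 ⟦ xE ⟧) (1 ⟦ yE ⟧))))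
      (λ e → let k = ∧-true (proj₁ (∧-true e)) in
        run-weaken ≤-refl (λ s′ (P , C) → P , λ _ _ _ → C)
        (Segments.letter-run A (letter? live-x (trans (sym kind-x) (≡ᵇ-true (proj₁ k))))
            (letter? live-y (trans (sym kind-y) (≡ᵇ-true (proj₂ k))))
          (trans (sym code-x) (trans (≡ᵇ-true (proj₂ (∧-true e))) code-y)) (≤-<-trans z≤n i<lg)))
      (λ e → skip-run λ p q c → ⊥-elim (true≢false
        (∧-intro (∧-intro (true-≡ᵇ (trans kind-x (IsLetter.kind p)))
            (true-≡ᵇ (trans kind-y (IsLetter.kind q)))) (true-≡ᵇ (trans code-x (trans c (sym code-y))))) e))

-- The four nested loops that fill the table

tableP : Program
tableP = forLoop 3 (op add (reg 0) (reg 0)) (forLoop 4 (reg 0) (forLoop 5 (reg 1) (forLoop 6 (reg 1) blockP)))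

loopTime : ℕ → ℕ → ℕ → ℕ
loopTime b c t = b * (t + c + 7) + (5 + c)

tableTime : ℕ → ℕ → ℕ
tableTime n lg = loopTime (n + n) 3 (loopTime n 1 (loopTime lg 1 (loopTime lg 1 (time blockP))))

module Loops (model : Model) where
  open Model model
  open Table model
  open Block model
  open Body model

  record Advance (s s′ : State) : Set where
    constructor advance
    field
      inv′  : Inv s′
      mono′ : Mono s s′
      kept  : Same 7 8 s s′
  open Advance

  progress-advance : ∀ {s s′} → Progress s s′ → Advance s s′
  progress-advance (progress I m u) = advance I m (same-≤ (≤ᵇ⇒≤ 7 30 tt) u)

  advance-trans : ∀ {s s′ s″} → Advance s s′ → Advance s′ s″ → Advance s s″
  advance-trans (advance _ m k) (advance I m′ k′) = advance I (λ i v c → m′ i v (m i v c)) (same-trans k k′)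

  body-run : ∀ {x y i j s} → Inv s → Earlier (x + y) s → Live x → Live y → i < lg → j < lg →
    regs s 4 ≡ x → regs s 5 ≡ i → regs s 6 ≡ j → regs s 20 ≡ y →
    Run B bodyP s (time bodyP) (λ s′ → Advance s s′ × Facts x y i j s′)
  body-run {x} {y} {i} {j} {s} I earlier lx ly i<lg j<lg r4 r5 r6 r20 =
    run-seq (load-run nodeP s I) λ { s₁ (refl , I₁) →
      let A₁ = at₁ I₁ in
      run-seq (Parts.partY-run A₁) λ s₂ (P₂ , C₂) → let A₂ = at-step A₁ P₂ in
      run-seq (Parts.partX-run A₂) λ s₃ (P₃ , C₃) → let A₃ = at-step A₂ P₃ in
      run-seq (Parts.partXY-run A₃) λ s₄ (P₄ , C₄) → let A₄ = at-step A₃ P₄ in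
      run-weaken ≤-refl (λ s₅ (P₅ , C₅) →
          advance-trans (advance I₁ (λ _ _ c → c) (frame {7} {8} nodeP s _))
            (progress-advance (progress-trans P₂ (progress-trans P₃ (progress-trans P₄ P₅)))) ,
          record
            { byY   = λ p l o → mono P₅ _ l (mono P₄ _ l (mono P₃ _ l (C₂ p l o)))
            ; byX   = λ p l o → mono P₅ _ l (mono P₄ _ l (proj₁ (C₃ p) l o))
            ; ends  = λ p l u o e a b → mono P₅ _ l (mono P₄ _ l (proj₂ (C₃ p) l u o e a b))
            ; cross = λ p q l o a b c → mono P₅ _ l (proj₁ (C₄ p q) l o a b c)
            ; long  = λ { p q a b (inj₁ (inj₁ refl , refl)) l m m′ o c d e f g →
                mono P₅ _ l (proj₁ (proj₂ (C₄ p q)) l m m′ o c d e f g)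
                        ; p q a b (inj₁ (inj₂ refl , refl)) l m m′ o c d e f g →
                            mono P₅ _ l (proj₁ (proj₂ (proj₂ (C₄ p q))) l m m′ o c d e f g)
                        ; p q a b (inj₂ (refl , inj₁ refl)) l m m′ o c d e f g →
                            mono P₅ _ l (proj₁ (proj₂ (proj₂ (proj₂ (C₄ p q)))) l m m′ o c d e f g)
                        ; p q a b (inj₂ (refl , inj₂ refl)) l m m′ o c d e f g →
                            mono P₅ _ l (proj₂ (proj₂ (proj₂ (proj₂ (C₄ p q)))) l m m′ o c d e f g) }
            ; unit  = C₅ })
        (Parts.partL-run A₄) }
    where
    at₁ : Inv (exec nodeP s) → At x y i j (exec nodeP s)
    at₁ I₁ = record
      { invariant = I₁ ; earlier = earlier ; live-x = lx ; live-y = ly ; i<lg = i<lg ; j<lg = j<lg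
      ; r4 = r4 ; r5 = r5 ; r6 = r6 ; r20 = r20
      ; r21 = look 6 _ r4 ; r22 = look 2 _ r4 ; r23 = look 6 _ r20 ; r24 = look 2 _ r20
      ; r25 = look 4 _ (look 2 _ r4) ; r26 = look 4 _ (look 6 _ r20) ; r27 = look 4 _ r20 }
      where
      look : ∀ a → T (a <ᵇ 8) → ∀ {k k′} → k ≡ k′ → arrays s a k ≡ F a k′
      look a t e = cong₂ (λ f k → f k) (Inv.fixed I a (<ᵇ⇒< a 8 t)) e

  block-run : ∀ {k x i j s} → Inv s → Earlier k s → i < lg → j < lg → x < n →
    regs s 3 ≡ k → regs s 4 ≡ x → regs s 5 ≡ i → regs s 6 ≡ j →
    Run B blockP s (time blockP) (λ s′ → Advance s s′ × (∀ y → x + y ≡ k → Live x → Live y →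
        Facts x y i j s′))
  block-run {k} {x} {i} {j} {s} I earlier i<lg j<lg x<n r3 r4 r5 r6 =
    run-seq (load-run (set 20 (op sub (reg 3) xE)) s I) λ { s₁ (refl , I₁) → afterwards I₁ }
    where
    s₁ : State
    s₁ = exec (set 20 (op sub (reg 3) xE)) s
    r20 : regs s₁ 20 ≡ k ∸ x
    r20 = cong₂ _∸_ r3 r4
    validT : Test
    validT = and (neg (lt (reg 3) xE)) (and (lt yE (reg 0)) (and (eq (3 ⟦ xE ⟧) (lit 1))
        (eq (3 ⟦ yE ⟧) (lit 1))))
    A₁ : Inv s₁ → Advance s s₁
    A₁ I₁ = advance I₁ (λ _ _ c → c) (frame {7} {8} (set 20 (op sub (reg 3) xE)) s _)
    mark-x : arrays s 3 (regs s 4) ≡ F 3 x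
    mark-x = cong₂ (λ f k → f k) (Inv.fixed I 3 (<ᵇ⇒< 3 8 tt)) r4
    mark-y : arrays s 3 (regs s 3 ∸ regs s 4) ≡ F 3 (k ∸ x)
    mark-y = cong₂ (λ f k → f k) (Inv.fixed I 3 (<ᵇ⇒< 3 8 tt)) r20
    afterwards : Inv s₁ → Run B (branch validT bodyP skip) s₁ (1 + costTest validT + (time bodyP + time skip))
                   (λ s′ → Advance s s′ × (∀ y → x + y ≡ k → Live x → Live y → Facts x y i j s′))
    afterwards I₁ = run-branch (D.okTest-sound 2 (inv-bounded I₁) validT _) yes-valid not-valid
      where
      yes-valid : test validT s₁ ≡ true →
        Run B bodyP s₁ (time bodyP) (λ s′ → Advance s s′ × (∀ y → x + y ≡ k → Live x → Live y →
            Facts x y i j s′))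
      yes-valid e = run-weaken ≤-refl
          (λ s′ (A , f) → advance-trans (A₁ I₁) A , λ y x+y _ _ → subst (λ y → Facts x y i j s′) (y≡ y x+y) f)
          (body-run I₁ (subst (λ k → Earlier k s₁) (sym x+y≡k) earlier) live-x live-y i<lg j<lg r4 r5 r6 r20)
        where
        e₁ = ∧-true e
        e₂ = ∧-true (proj₂ e₁)
        e₃ = ∧-true (proj₂ e₂)
        x≤k : x ≤ k
        x≤k = subst₂ _≤_ r4 r3 (<ᵇ-false (regs s 3) (regs s 4) (not-true (proj₁ e₁)))
        x+y≡k : x + (k ∸ x) ≡ k
        x+y≡k = m+[n∸m]≡n x≤k
        y≡ : ∀ y → x + y ≡ k → k ∸ x ≡ y
        y≡ y e = trans (cong (_∸ x) (sym e)) (m+n∸m≡n x y)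
        live-x : Live x
        live-x = x<n , trans (sym mark-x) (≡ᵇ-true (proj₁ e₃))
        live-y : Live (k ∸ x)
        live-y = subst₂ _<_ r20 (Inv.reg-n I) (<ᵇ-true _ _ (proj₁ e₂)) , trans (sym mark-y)
            (≡ᵇ-true (proj₂ e₃))
      not-valid : test validT s₁ ≡ false →
        Run B skip s₁ (time skip) (λ s′ → Advance s s′ × (∀ y → x + y ≡ k → Live x → Live y →
            Facts x y i j s′))
      not-valid e = run-weaken ≤-refl (λ { s′ refl → A₁ I₁ , λ y x+y lx ly →
          ⊥-elim (true≢false (holds y x+y lx ly) e) }) (run-exec skip s₁ tt)
        where
        holds : ∀ y → x + y ≡ k → Live x → Live y → test validT s₁ ≡ true
        holds y x+y (_ , mx) (y<n , my) = ∧-intro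
            (cong not (false-<ᵇ (subst₂ _≤_ (sym r4) (sym r3) (subst (x ≤_) x+y (m≤m+n x y)))))
            (∧-intro (true-<ᵇ (subst₂ _<_ (sym (trans r20 k∸x)) (sym (Inv.reg-n I)) y<n))
              (∧-intro (true-≡ᵇ (trans mark-x mx)) (true-≡ᵇ (trans mark-y (trans (cong (F 3) k∸x) my)))))
          where
          k∸x : k ∸ x ≡ y
          k∸x = trans (cong (_∸ x) (sym x+y)) (m+n∸m≡n x y)

  counter-inv : ∀ {s} r {v} → 3 ≤ r → r < 30 → v ≤ M ^ 2 → Inv s → Inv (setReg r v s)
  counter-inv {s} r {v} 3≤r r<30 v≤ I = inv-same I
    (same (λ q q<3 → update-other (regs s) r v q (<⇒≢ (<-≤-trans q<3 3≤r))) (λ _ _ → refl) refl)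
    (D.boundedRegs {2} (D.bounded-set 2 (inv-bounded I) r (subst (λ d → v ≤ M ^ d) (sym (Γ≡2 r<30)) v≤)))
    (Inv.valid I)
    where
    Γ≡2 : ∀ {r} → r < 30 → Γ r ≡ 2
    Γ≡2 {r} r<30 with r <ᵇ 30 | <⇒<ᵇ r<30
    ... | true | _ = refl

  facts-counter : ∀ {x y i j s} r v → Facts x y i j s → Facts x y i j (setReg r v s)
  facts-counter {s = s} r v = facts-mono {s = s} {setReg r v s} (λ _ _ c → c)

  -- One invariant per loop, each containing that of the enclosing loop. `Facts` accumulate over the
  -- two loops on scales and become `Done` in the loop on x; a full sweep over x then advances the
  -- sum k.
  record Outer (k : ℕ) (s : State) : Set where
    constructor outer
    field
      oInv     : Inv s
      oEarlier : Earlier k s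

  record Row (k x : ℕ) (s : State) : Set where
    constructor row
    field
      rOuter : Outer k s
      r3≡    : regs s 3 ≡ k
      rDone  : ∀ x′ y → x′ < x → x′ + y ≡ k → Live x′ → Live y → Done x′ y s

  record Cells (k x i : ℕ) (s : State) : Set where
    constructor cells
    field
      cRow  : Row k x s
      r4≡   : regs s 4 ≡ x
      cDone : ∀ i′ j y → i′ < i → j < lg → x + y ≡ k → Live x → Live y → Facts x y i′ j s

  record Scan (k x i j : ℕ) (s : State) : Set where
    constructor scan
    field
      sCells : Cells k x i s
      r5≡    : regs s 5 ≡ i
      sDone  : ∀ j′ y → j′ < j → x + y ≡ k → Live x → Live y → Facts x y i j′ s

  n≤M : n ≤ M
  n≤M = m≤m+n n N

  M≤B : M ≤ B
  M≤B = subst (_≤ B) (^-identityʳ M) (M^mono {1} {12} (≤ᵇ⇒≤ 1 12 tt))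

  2M≤M² : M + M ≤ M ^ 2
  2M≤M² = subst (_≤ M ^ 2) (cong (M +_) (+-identityʳ M))
    (≤-trans (*-monoˡ-≤ M (≤-trans (≤ᵇ⇒≤ 2 4 tt) 4≤M)) (≤-reflexive (cong (M *_) (sym (*-identityʳ M)))))

  M≤M² : M ≤ M ^ 2
  M≤M² = ≤-trans (m≤m+n M M) 2M≤M²

  2M<B : M + M < B
  2M<B = ≤-<-trans 2M≤M² (^-monoʳ-< M (≤-trans (≤ᵇ⇒≤ 2 4 tt) 4≤M) (<ᵇ⇒< 2 12 tt))

  M<B : M < B
  M<B = ≤-<-trans (m≤m+n M M) 2M<B

  scan-run : ∀ {k x i} s → x < n → i < lg → Cells k x i s → regs s 5 ≡ i →
    Run B (forLoop 6 (reg 1) blockP) s (loopTime lg 1 (time blockP)) (Scan k x i lg)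
  scan-run {k} {x} {i} s x<n i<lg C r5 = for-run (Scan k x i) lg (time blockP) (≤-<-trans lg≤M M<B)
    (λ j s S → Inv.reg-lg (Outer.oInv (Row.rOuter (Cells.cRow (Scan.sCells S)))) , tt)
    step s
    (scan (cells (row (outer (counter-inv 6 (≤ᵇ⇒≤ 3 6 tt) (<ᵇ⇒< 6 30 tt) z≤n
        (Outer.oInv (Row.rOuter (Cells.cRow C)))) (Outer.oEarlier (Row.rOuter (Cells.cRow C))))
       (Row.r3≡ (Cells.cRow C)) (Row.rDone (Cells.cRow C))) (Cells.r4≡ C) (λ i′ j y a b e lx ly →
           facts-counter 6 0 (Cells.cDone C i′ j y a b e lx ly))) r5 (λ _ _ ()))
    where
    step : ∀ j s → j < lg → Scan k x i j s → regs s 6 ≡ j →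
           Run B blockP s (time blockP) (λ s′ → regs s′ 6 ≡ j × Scan k x i (suc j) (setReg 6 (suc j) s′))
    step j s j<lg (scan (cells (row (outer I E) r3 rd) r4 cd) r5 sd) r6 = run-weaken ≤-refl
      (λ s′ (advance I′ m K , f) → trans (sameRegs K 6 (<ᵇ⇒< 6 7 tt)) r6 ,
        scan (cells (row (outer (counter-inv 6 (≤ᵇ⇒≤ 3 6 tt) (<ᵇ⇒< 6 30 tt) (≤-trans j<lg (≤-trans lg≤M M≤M²))
            I′)
                                (λ x y lx ly e → done-mono {x} {y} {s} {s′} m (E x y lx ly e)))
                    (trans (sameRegs K 3 (<ᵇ⇒< 3 7 tt)) r3)
                    (λ x′ y a b lx ly → done-mono {x′} {y} {s} {s′} m (rd x′ y a b lx ly)))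
               (trans (sameRegs K 4 (<ᵇ⇒< 4 7 tt)) r4)
               (λ i′ j′ y a b e lx ly → facts-counter 6 (suc j) (facts-mono {s = s} {s′ = s′} m
                   (cd i′ j′ y a b e lx ly))))
             (trans (sameRegs K 5 (<ᵇ⇒< 5 7 tt)) r5)
             (λ j′ y a e lx ly → facts-counter 6 (suc j) (last s′ m f (m≤n⇒m<n∨m≡n (≤-pred a)) e lx ly)))
      (block-run I E i<lg j<lg x<n r3 r4 r5 r6)
      where
      last : ∀ s′ → Mono s s′ → (∀ y → x + y ≡ k → Live x → Live y → Facts x y i j s′) →
             ∀ {j′ y} → j′ < j ⊎ j′ ≡ j → x + y ≡ k → Live x → Live y → Facts x y i j′ s′
      last s′ m f (inj₁ j′<j) e lx ly = facts-mono {s = s} {s′ = s′} m (sd _ _ j′<j e lx ly)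
      last s′ m f (inj₂ refl) e lx ly = f _ e lx ly

  cells-run : ∀ {k x} s → x < n → Row k x s → regs s 4 ≡ x →
    Run B (forLoop 5 (reg 1) (forLoop 6 (reg 1) blockP)) s (loopTime lg 1 (loopTime lg 1 (time blockP)))
        (Cells k x lg)
  cells-run {k} {x} s x<n (row (outer I E) r3 rd) r4 = for-run (Cells k x) lg _ (≤-<-trans lg≤M M<B)
    (λ i s C → Inv.reg-lg (Outer.oInv (Row.rOuter (Cells.cRow C))) , tt)
    step s
    (cells (row (outer (counter-inv 5 (≤ᵇ⇒≤ 3 5 tt) (<ᵇ⇒< 5 30 tt) z≤n I) E) r3 rd) r4 (λ _ _ _ ()))
    where
    step : ∀ i s → i < lg → Cells k x i s → regs s 5 ≡ i →
           Run B (forLoop 6 (reg 1) blockP) s (loopTime lg 1 (time blockP)) (λ s′ → regs s′ 5 ≡ i × Cells k x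
               (suc i) (setReg 5 (suc i) s′))
    step i s i<lg C r5 = run-weaken ≤-refl
      (λ { s′ (scan (cells (row (outer I′ E′) r3′ rd′) r4′ cd′) r5′ sd′) → r5′ ,
           cells (row (outer (counter-inv 5 (≤ᵇ⇒≤ 3 5 tt) (<ᵇ⇒< 5 30 tt) (≤-trans i<lg (≤-trans lg≤M M≤M²))
               I′) E′) r3′ rd′) r4′
             (λ i′ j y a b e lx ly → facts-counter 5 (suc i)
                 (last s′ cd′ sd′ (m≤n⇒m<n∨m≡n (≤-pred a)) b e lx ly)) })
      (scan-run s x<n i<lg C r5)
      where
      last : ∀ s′ → (∀ i′ j y → i′ < i → j < lg → x + y ≡ k → Live x → Live y → Facts x y i′ j s′) →
             (∀ j′ y → j′ < lg → x + y ≡ k → Live x → Live y → Facts x y i j′ s′) →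
             ∀ {i′ j y} → i′ < i ⊎ i′ ≡ i → j < lg → x + y ≡ k → Live x → Live y → Facts x y i′ j s′
      last s′ f g (inj₁ a) b e lx ly = f _ _ _ a b e lx ly
      last s′ f g (inj₂ refl) b e lx ly = g _ _ b e lx ly

  row-run : ∀ {k} s → Outer k s → regs s 3 ≡ k →
    Run B (forLoop 4 (reg 0) (forLoop 5 (reg 1) (forLoop 6 (reg 1) blockP))) s
      (loopTime n 1 (loopTime lg 1 (loopTime lg 1 (time blockP)))) (Row k n)
  row-run {k} s (outer I E) r3 = for-run (Row k) n _ (≤-<-trans n≤M M<B)
    (λ x s R → Inv.reg-n (Outer.oInv (Row.rOuter R)) , tt)
    step s
    (row (outer (counter-inv 4 (≤ᵇ⇒≤ 3 4 tt) (<ᵇ⇒< 4 30 tt) z≤n I) E) r3 (λ _ _ ()))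
    where
    step : ∀ x s → x < n → Row k x s → regs s 4 ≡ x →
           Run B (forLoop 5 (reg 1) (forLoop 6 (reg 1) blockP)) s
               (loopTime lg 1 (loopTime lg 1 (time blockP)))
             (λ s′ → regs s′ 4 ≡ x × Row k (suc x) (setReg 4 (suc x) s′))
    step x s x<n R r4 = run-weaken ≤-refl
      (λ { s′ (cells (row (outer I′ E′) r3′ rd′) r4′ cd′) → r4′ ,
           row (outer (counter-inv 4 (≤ᵇ⇒≤ 3 4 tt) (<ᵇ⇒< 4 30 tt) (≤-trans x<n (≤-trans n≤M M≤M²)) I′) E′) r3′
             (λ x′ y a e lx ly → last s′ rd′ cd′ (m≤n⇒m<n∨m≡n (≤-pred a)) e lx ly) })
      (cells-run s x<n R r4)
      where
      last : ∀ s′ → (∀ x′ y → x′ < x → x′ + y ≡ k → Live x′ → Live y → Done x′ y s′) →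
             (∀ i′ j y → i′ < lg → j < lg → x + y ≡ k → Live x → Live y → Facts x y i′ j s′) →
             ∀ {x′ y} → x′ < x ⊎ x′ ≡ x → x′ + y ≡ k → Live x′ → Live y → Done x′ y s′
      last s′ f g (inj₁ a) e lx ly = f _ _ a e lx ly
      last s′ f g (inj₂ refl) e lx ly = facts-done lx ly λ i j i< j< → g i j _ i< j< e lx ly

  table-run : ∀ s → Inv s → Run B tableP s (tableTime n lg) (λ s′ → Inv s′ × (∀ x y → Live x →
      Live y → Done x y s′))
  table-run s I = run-weaken ≤-refl
    (λ { s′ (outer I′ E) → I′ , λ x y lx ly → E x y lx ly (+-mono-< (proj₁ lx) (proj₁ ly)) })
    (for-run Outer (n + n) _ (≤-<-trans (+-mono-≤ n≤M n≤M) 2M<B)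
      (λ k s O → let r0 = Inv.reg-n (Outer.oInv O) in
         cong₂ _+_ r0 r0 , tt , tt , subst (_≤ B) (sym r0) (≤-trans n≤M M≤B) , subst (_≤ B) (sym r0)
             (≤-trans n≤M M≤B) ,
         subst (_≤ B) (sym (cong₂ _+_ r0 r0)) (≤-trans (+-mono-≤ n≤M n≤M) (<⇒≤ 2M<B)))
      step s
      (outer (counter-inv 3 ≤-refl (<ᵇ⇒< 3 30 tt) z≤n I) (λ _ _ _ _ ())))
    where
    step : ∀ k s → k < n + n → Outer k s → regs s 3 ≡ k →
           Run B (forLoop 4 (reg 0) (forLoop 5 (reg 1) (forLoop 6 (reg 1) blockP))) s
             (loopTime n 1 (loopTime lg 1 (loopTime lg 1 (time blockP)))) (λ s′ → regs s′ 3 ≡ k × Outer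
                 (suc k) (setReg 3 (suc k) s′))
    step k s k< O r3 = run-weaken ≤-refl
      (λ { s′ (row (outer I′ E′) r3′ rd′) → r3′ ,
           outer (counter-inv 3 ≤-refl (<ᵇ⇒< 3 30 tt) (≤-trans k< (≤-trans (+-mono-≤ n≤M n≤M) 2M≤M²)) I′)
             (λ x y lx ly e → last s′ E′ rd′ lx ly (m≤n⇒m<n∨m≡n (≤-pred e))) })
      (row-run s O r3)
      where
      last : ∀ s′ → Earlier k s′ → (∀ x′ y → x′ < n → x′ + y ≡ k → Live x′ → Live y → Done x′ y s′) →
             ∀ {x y} → Live x → Live y → x + y < k ⊎ x + y ≡ k → Done x y s′
      last s′ f g lx ly (inj₁ a) = f _ _ lx ly a
      last s′ f g lx ly (inj₂ e) = g _ _ (proj₁ lx) e lx ly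

-- Preprocessing: reachable nonterminals, lengths and powers of two

markBody lenBody powBody initP : Program
-- Children have smaller numbers, so one pass downwards marks everything reachable. Unmarked
-- nonterminals are never measured, since their words may be too long for a machine word.
markBody =
  set 20 (op sub (op sub (reg 0) (lit 1)) (reg 3)) ⨾
  branch (and (eq (3 ⟦ reg 20 ⟧) (lit 1)) (eq (0 ⟦ reg 20 ⟧) (lit 1)))
    -- Left children are copied because array 1 mixes them with letter codes and has no bound; array
    -- 6 holds numbers of nonterminals only.
    (store 6 (reg 20) (1 ⟦ reg 20 ⟧) ⨾ store 3 (1 ⟦ reg 20 ⟧) (lit 1) ⨾ store 3 (2 ⟦ reg 20 ⟧) (lit 1))
    skip
lenBody =
  branch (eq (3 ⟦ reg 3 ⟧) (lit 1))
    (branch (eq (0 ⟦ reg 3 ⟧) (lit 1))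
      (store 4 (reg 3) (op add (4 ⟦ 6 ⟦ reg 3 ⟧ ⟧) (4 ⟦ 2 ⟦ reg 3 ⟧ ⟧)))
      (store 4 (reg 3) (lit 1)))
    skip
powBody =
  -- Once the current power exceeds N nothing changes any more; n passes suffice because N < 2ⁿ.
  branch (lt (reg 2) (5 ⟦ reg 1 ⟧)) skip
    (store 5 (op add (reg 1) (lit 1)) (op mul (lit 2) (5 ⟦ reg 1 ⟧)) ⨾ set 1 (op add (reg 1) (lit 1)))
initP =
  store 3 (op sub (reg 0) (lit 1)) (lit 1) ⨾ forLoop 3 (reg 0) markBody ⨾
  forLoop 3 (reg 0) lenBody ⨾
  set 2 (4 ⟦ op sub (reg 0) (lit 1) ⟧) ⨾ set 1 (lit 0) ⨾ store 5 (lit 0) (lit 1) ⨾ forLoop 3 (reg 0) powBody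

initTime : ℕ → ℕ
initTime n = 5 + ((n * (time markBody + 1 + 7) + 6) + ((n * (time lenBody + 1 + 7) + 6) +
    (5 + (2 + (3 + (n * (time powBody + 1 + 7) + 6))))))

record Source : Set where
  field
    k     : ℕ
    A₀ A₁ A₂ : ℕ → ℕ
    W     : ℕ → Str
  n N : ℕ
  n = suc k
  N = len (W k)
  data Node (x : ℕ) : Set where
    letterNode : A₀ x ≡ 0 → len (W x) ≡ 1 → at (W x) 0 ≡ A₁ x → Node x
    pairNode   : A₀ x ≡ 1 → A₁ x < x → A₂ x < x → Cat (W x) (W (A₁ x)) (W (A₂ x)) → Node x

record GoodSource : Set where
  field
    source : Source
  open Source source public
  field
    node  : ∀ {x} → x < n → Node x
    A₀≤   : ∀ x → A₀ x ≤ 1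
    A₂≤   : ∀ x → A₂ x ≤ k
    2≤N   : 2 ≤ N

update-≤ : ∀ {f : ℕ → ℕ} {b i v} → (∀ j → f j ≤ b) → v ≤ b → ∀ j → update f i v j ≤ b
update-≤ {i = i} f≤ v≤ j with j ≡ᵇ i
... | true  = v≤
... | false = f≤ j

update-case : ∀ (f : ℕ → ℕ) i v j → (j ≡ i × update f i v j ≡ v) ⊎ (j ≢ i × update f i v j ≡ f j)
update-case f i v j with j ≟ i
... | yes refl = inj₁ (refl , update-same f j v)
... | no ne    = inj₂ (ne , update-other f i v j ne)

-- The word bound B stays abstract: unfolding a high power of suc k + … is slow.
module Init (good : GoodSource) (B : ℕ) (M²≤B : (GoodSource.n good + GoodSource.N good) ^ 2 ≤ B) where
  open GoodSource good

  M : ℕ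
  M = n + N

  -- Each production at most doubles the length, and children have smaller numbers; h bounds the
  -- recursion. The result N < 2ⁿ later gives lg ≤ n, which turns log² |T| into n log |T|.
  len-positive : ∀ h {x} → x ≤ h → x < n → 1 ≤ len (W x) × len (W x) ≤ 2 ^ x
  len-positive h {x} x≤h x<n with node x<n
  ... | letterNode _ l _ = ≤-reflexive (sym l) , subst (_≤ 2 ^ x) (sym l) (m^n>0 2 x)
  len-positive zero {zero} x≤h x<n | pairNode _ () _ _
  len-positive (suc h) {suc x} (s≤s x≤h) x<n | pairNode _ (s≤s p) (s≤s q) c
    with len-positive h (≤-trans p x≤h) (≤-<-trans (≤-trans p (n≤1+n x)) x<n) | len-positive h (≤-trans q x≤h)
        (≤-<-trans (≤-trans q (n≤1+n x)) x<n)
  ... | a≥1 , a≤ | b≥1 , b≤ = subst (1 ≤_) (sym (Cat.lens c)) (≤-trans a≥1 (m≤m+n _ _)) ,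
    subst (_≤ 2 * 2 ^ x) (sym (Cat.lens c)) (+-mono-≤ (≤-trans a≤ (^-monoʳ-≤ 2 p))
        (≤-trans b≤ (≤-trans (^-monoʳ-≤ 2 q) (≤-reflexive (sym (+-identityʳ _))))))

  len≥1ⁿ : ∀ {x} → x < n → 1 ≤ len (W x)
  len≥1ⁿ x<n = proj₁ (len-positive _ ≤-refl x<n)

  N<2^n : N < 2 ^ n
  N<2^n = ≤-<-trans (proj₂ (len-positive k ≤-refl ≤-refl)) (^-monoʳ-< 2 (s≤s (s≤s z≤n)) {k} {n} ≤-refl)

  n≥2 : 2 ≤ n
  n≥2 = s≤s (go k refl)
    where
    go : ∀ j → j ≡ k → 1 ≤ j
    go (suc j) _ = s≤s z≤n
    go zero e = ⊥-elim (<⇒≱ (≤-trans 2≤N (subst (λ j → len (W k) ≤ 2 ^ j) (sym e)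
        (proj₂ (len-positive k ≤-refl ≤-refl)))) ≤-refl)

  4≤M : 4 ≤ M
  4≤M = +-mono-≤ n≥2 2≤N

  4M≤M² : 4 * M ≤ M ^ 2
  4M≤M² = ≤-trans (*-monoˡ-≤ M 4≤M) (≤-reflexive (cong (M *_) (sym (*-identityʳ M))))

  M≤B : M ≤ B
  M≤B = ≤-trans (≤-trans (m≤m+n M _) 4M≤M²) M²≤B

  n<B : n < B
  n<B = <-≤-trans (m<m+n n (≤-trans (s≤s z≤n) 2≤N)) M≤B

  n≤M : n ≤ M
  n≤M = m≤m+n n N
  n≤B : n ≤ B
  n≤B = <⇒≤ n<B
  k≤B : k ≤ B
  k≤B = ≤-trans (n≤1+n k) n≤B
  N≤M : N ≤ M
  N≤M = m≤n+m N n
  1≤M : 1 ≤ M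
  1≤M = ≤-trans (s≤s z≤n) 4≤M
  2≤B : 2 ≤ B
  2≤B = ≤-trans (≤-trans (s≤s (s≤s z≤n)) 4≤M) M≤B
  1≤B : 1 ≤ B
  1≤B = ≤-trans (s≤s z≤n) 2≤B

  record Base (ρ a₀ a₁ a₂ a₇ t₈ t₉ t₁₀ : ℕ → ℕ) (o : List ℕ) : Set where
    field
      n≡     : ρ 0 ≡ n
      small  : ∀ r → ρ r ≤ M
      isA₀   : a₀ ≡ A₀
      isA₁   : a₁ ≡ A₁
      isA₂   : a₂ ≡ A₂
      zero₇  : ∀ i → a₇ i ≡ 0
      zero₈  : ∀ i → t₈ i ≡ 0
      zero₉  : ∀ i → t₉ i ≡ 0
      zero₁₀ : ∀ i → t₁₀ i ≡ 0
      silent : o ≡ []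

  -- Only the components mentioned matter, so that stores to arrays 3–6
  -- preserve this predicate definitionally.
  Basic : State → Set
  Basic s = Base (regs s) (arrays s 0) (arrays s 1) (arrays s 2) (arrays s 7) (arrays s 8) (arrays s 9)
      (arrays s 10) (output s)

  basic-set : ∀ {s} r {v} → 0 < r → v ≤ M → Basic s → Basic (setReg r v s)
  basic-set {s} r {v} 0<r v≤ b = record
    { n≡ = trans (update-other (regs s) r v 0 (<⇒≢ 0<r)) n≡ ; small = update-≤ small v≤
    ; isA₀ = isA₀ ; isA₁ = isA₁ ; isA₂ = isA₂
    ; zero₇ = zero₇ ; zero₈ = zero₈ ; zero₉ = zero₉ ; zero₁₀ = zero₁₀ ; silent = silent }
    where open Base b

  -- After j steps the nonterminals x with n ≤ x + j have passed on their marks.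
  record Marks (j : ℕ) (m₃ m₆ : ℕ → ℕ) : Set where
    field
      mark≤  : ∀ x → m₃ x ≤ 1
      marked : ∀ x → m₃ x ≡ 1 → x < n × len (W x) ≤ N
      down   : ∀ x → n ≤ x + j → m₃ x ≡ 1 → A₀ x ≡ 1 → m₃ (A₁ x) ≡ 1 × m₃ (A₂ x) ≡ 1 × m₆ x ≡ A₁ x
      left≤  : ∀ x → m₆ x ≤ k
      root   : m₃ k ≡ 1

  record Mark (j : ℕ) (s : State) : Set where
    constructor mark
    field
      basic : Basic s
      marks : Marks j (arrays s 3) (arrays s 6)
      clean₄ : ∀ i → arrays s 4 i ≡ 0
      clean₅ : ∀ i → arrays s 5 i ≡ 0

  -- New marks land strictly below x, so a node above x that is marked now was marked before and has
  -- already passed its mark on. A child generates a factor of the word of x, so its length stays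
  -- within N.
  mark-step : ∀ {j m₃ m₆} x → x + suc j ≡ n → Marks j m₃ m₆ → m₃ x ≡ 1 → A₀ x ≡ 1 →
              Marks (suc j) (update (update m₃ (A₁ x) 1) (A₂ x) 1) (update m₆ x (A₁ x))
  mark-step {j} {m₃} {m₆} x x+ ms mx ax with node {x} (lia 3 (λ x j n → (x ⊕ (con 1 ⊕ j) ≐ n) ∷ [] ⊢ˡ x ≺ n) x
      j n x+)
  ... | letterNode a₀ _ _ with trans (sym ax) a₀
  ...   | ()
  mark-step {j} {m₃} {m₆} x x+ ms mx ax | pairNode _ p<x q<x c = record
    { mark≤ = update-≤ (update-≤ (Marks.mark≤ ms) ≤-refl) ≤-refl
    ; marked = marked′ ; down = down′
    ; left≤ = update-≤ (Marks.left≤ ms) (≤-trans (<⇒≤ p<x) x≤k)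
    ; root = up k (Marks.root ms) }
    where
    m₃′ = update (update m₃ (A₁ x) 1) (A₂ x) 1
    x<n : x < n
    x<n = lia 3 (λ x j n → (x ⊕ (con 1 ⊕ j) ≐ n) ∷ [] ⊢ˡ x ≺ n) x j n x+
    x≤k : x ≤ k
    x≤k = ≤-pred x<n
    lenx = proj₂ (Marks.marked ms x mx)
    marked′ : ∀ y → m₃′ y ≡ 1 → y < n × len (W y) ≤ N
    marked′ y e with update-case (update m₃ (A₁ x) 1) (A₂ x) 1 y
    ... | inj₁ (refl , _) = <-trans q<x x<n , ≤-trans (m≤n+m _ _) (subst (_≤ N) (Cat.lens c) lenx)
    ... | inj₂ (_ , e′) with update-case m₃ (A₁ x) 1 y
    ...   | inj₁ (refl , _) = <-trans p<x x<n , ≤-trans (m≤m+n _ _) (subst (_≤ N) (Cat.lens c) lenx)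
    ...   | inj₂ (_ , e″) = Marks.marked ms y (trans (sym (trans e′ e″)) e)
    up : ∀ y → m₃ y ≡ 1 → m₃′ y ≡ 1
    up y e with update-case (update m₃ (A₁ x) 1) (A₂ x) 1 y
    ... | inj₁ (_ , e′) = e′
    ... | inj₂ (_ , e′) with update-case m₃ (A₁ x) 1 y
    ...   | inj₁ (_ , e″) = trans e′ e″
    ...   | inj₂ (_ , e″) = trans e′ (trans e″ e)
    at-p : m₃′ (A₁ x) ≡ 1
    at-p with update-case (update m₃ (A₁ x) 1) (A₂ x) 1 (A₁ x)
    ... | inj₁ (_ , e′) = e′
    ... | inj₂ (_ , e′) = trans e′ (update-same m₃ (A₁ x) 1)
    down′ : ∀ y → n ≤ y + suc j → m₃′ y ≡ 1 → A₀ y ≡ 1 → m₃′ (A₁ y) ≡ 1 × m₃′ (A₂ y) ≡ 1 × update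
        m₆ x (A₁ x) y ≡ A₁ y
    down′ y n≤ e ay with update-case m₆ x (A₁ x) y
    ... | inj₁ (refl , e₆) = at-p , update-same (update m₃ (A₁ x) 1) (A₂ x) 1 , e₆
    ... | inj₂ (y≢x , e₆) with Marks.down ms y n≤y+j my ay
      where
      x<y : x < y
      x<y = ≤∧≢⇒< (lia 4 (λ x y j n → (x ⊕ (con 1 ⊕ j) ≐ n) ∷ (n ≼ y ⊕ (con 1 ⊕ j)) ∷ [] ⊢ˡ x ≼ y) x y j n x+
          n≤) (λ e → y≢x (sym e))
      n≤y+j : n ≤ y + j
      n≤y+j = lia 4 (λ x y j n → (x ⊕ (con 1 ⊕ j) ≐ n) ∷ (x ≺ y) ∷ [] ⊢ˡ n ≼ y ⊕ j) x y j n x+ x<y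
      my : m₃ y ≡ 1
      my = trans (sym (trans (update-other (update m₃ (A₁ x) 1) (A₂ x) 1 y (λ e →
          <⇒≢ (<-trans q<x x<y) (sym e)))
                             (update-other m₃ (A₁ x) 1 y (λ e → <⇒≢ (<-trans p<x x<y) (sym e))))) e
    ...   | a , b , c′ = up _ a , up _ b , trans e₆ c′

  mark-later : ∀ {j m₃ m₆} x → x + suc j ≡ n → Marks j m₃ m₆ → ¬ (m₃ x ≡ 1 × A₀ x ≡ 1) → Marks (suc j) m₃ m₆
  mark-later {j} {m₃} {m₆} x x+ ms ¬p = record
    { mark≤ = Marks.mark≤ ms ; marked = Marks.marked ms ; left≤ = Marks.left≤ ms ; root = Marks.root ms
    ; down = λ y n≤ my ay → Marks.down ms y (later y n≤ λ { refl → ¬p (my , ay) }) my ay }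
    where
    later : ∀ y → n ≤ y + suc j → y ≢ x → n ≤ y + j
    later y n≤ y≢x = lia 4 (λ x y j n → (x ⊕ (con 1 ⊕ j) ≐ n) ∷ (x ≺ y) ∷ [] ⊢ˡ n ≼ y ⊕ j) x y j n x+
      (≤∧≢⇒< (lia 4 (λ x y j n → (x ⊕ (con 1 ⊕ j) ≐ n) ∷ (n ≼ y ⊕ (con 1 ⊕ j)) ∷ [] ⊢ˡ x ≼ y) x y j n x+ n≤)
          (λ e → y≢x (sym e)))

  mark-run : ∀ j s → j < n → Mark j s → regs s 3 ≡ j →
             Run B markBody s (time markBody) (λ s′ → regs s′ 3 ≡ j × Mark (suc j) (setReg 3 (suc j) s′))
  mark-run j s j<n (mark b ms c₄ c₅) r3 =
      run-seq (run-exec (set 20 (op sub (op sub (reg 0) (lit 1)) (reg 3))) s fits₀)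
    λ { s₁ refl → run-branch (((tt , x≤B) , tt) , ((tt , x≤B) , tt))
      (λ e → run-weaken ≤-refl (λ { s′ refl → r3 ,
          mark (basic-set {setReg 20 x s} 3 z<s (≤-trans j<n n≤M) b₁)
            (subst₂ (λ p q → Marks (suc j) (update (update (arrays s 3) p 1) q 1) (update (arrays s 6) x p))
              (sym (cong (λ f → f x) isA₁)) (sym (cong (λ f → f x) isA₂))
              (mark-step x x+ ms (≡ᵇ-true (proj₁ (∧-true e))) (A₀≡1 e))) c₄ c₅ })
        (run-exec _ s₁ ((tt , x≤B , tt , x≤B) , ((tt , x≤B) , p≤B (A₀≡1 e) , tt) , ((tt , x≤B) , q≤B , tt))))
      (λ e → run-weaken ≤-refl (λ { s′ refl → r3 ,
          mark (basic-set {setReg 20 x s} 3 z<s (≤-trans j<n n≤M) b₁)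
            (mark-later x x+ ms λ { (p , q) →
                true≢false (∧-intro (true-≡ᵇ p) (true-≡ᵇ (trans (cong (λ f → f x) isA₀) q))) e }) c₄ c₅ })
        (run-exec skip s₁ tt)) }
    where
    open Base b
    x = regs s 0 ∸ 1 ∸ regs s 3
    x≡ : x ≡ k ∸ j
    x≡ = cong₂ (λ a b → a ∸ 1 ∸ b) n≡ r3
    x≤k : x ≤ k
    x≤k = subst (_≤ k) (sym x≡) (m∸n≤m k j)
    x≤B : x ≤ B
    x≤B = ≤-trans x≤k k≤B
    x+ : x + suc j ≡ n
    x+ = trans (cong (_+ suc j) x≡) (trans (+-suc (k ∸ j) j) (cong suc (m∸n+n≡m (≤-pred j<n))))
    A₀≡1 : ((arrays s 3 x ≡ᵇ 1) ∧ (arrays s 0 x ≡ᵇ 1)) ≡ true → A₀ x ≡ 1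
    A₀≡1 e = trans (sym (cong (λ f → f x) isA₀)) (≡ᵇ-true (proj₂ (∧-true {arrays s 3 x ≡ᵇ 1} e)))
    p≤B : A₀ x ≡ 1 → arrays s 1 x ≤ B
    p≤B a with node {x} (s≤s x≤k)
    ... | pairNode _ p<x _ _ = ≤-trans (subst (λ f → f x ≤ k) (sym isA₁) (≤-trans (<⇒≤ p<x) x≤k)) k≤B
    ... | letterNode a₀ _ _ with trans (sym a) a₀
    ...   | ()
    q≤B : arrays s 2 x ≤ B
    q≤B = ≤-trans (subst (λ f → f x ≤ k) (sym isA₂) (A₂≤ x)) k≤B
    b₁ : Basic (setReg 20 x s)
    b₁ = basic-set {s} 20 z<s (≤-trans x≤k (≤-trans (n≤1+n k) n≤M)) b
    r≤B : ∀ r → regs s r ≤ B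
    r≤B r = ≤-trans (small r) M≤B
    fits₀ : Fits B (op sub (op sub (reg 0) (lit 1)) (reg 3)) s
    fits₀ = (tt , tt , r≤B 0 , 1≤B , ≤-trans (m∸n≤m _ 1) (r≤B 0)) , tt , ≤-trans (m∸n≤m _ 1) (r≤B 0) , r≤B 3 ,
        x≤B

  record Fresh (s : State) : Set where
    field
      basic  : Basic s
      empty₃ : ∀ i → arrays s 3 i ≡ 0
      empty₄ : ∀ i → arrays s 4 i ≡ 0
      empty₅ : ∀ i → arrays s 5 i ≡ 0
      empty₆ : ∀ i → arrays s 6 i ≡ 0

  record Len (m₃ m₆ : ℕ → ℕ) (j : ℕ) (s : State) : Set where
    constructor length-so-far
    field
      basic : Basic s
      is₃   : arrays s 3 ≡ m₃
      is₆   : arrays s 6 ≡ m₆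
      lens  : ∀ x → x < j → m₃ x ≡ 1 → arrays s 4 x ≡ len (W x)
      len≤  : ∀ x → arrays s 4 x ≤ N
      clean₅ : ∀ i → arrays s 5 i ≡ 0

  len-run : ∀ {m₃ m₆} → Marks n m₃ m₆ → ∀ j s → j < n → Len m₃ m₆ j s → regs s 3 ≡ j →
            Run B lenBody s (time lenBody) (λ s′ → regs s′ 3 ≡ j × Len m₃ m₆ (suc j) (setReg 3 (suc j) s′))
  len-run {m₃} {m₆} ms j s j<n (length-so-far b refl refl ls l≤ c₅) r3 = run-branch ((tt , r≤B 3) , tt)
    (λ e → let mj = trans (cong m₃ (sym r3)) (≡ᵇ-true e) in run-branch ((tt , r≤B 3) , tt)
      (λ e₀ → pair-case mj (trans (cong A₀ (sym r3))
          (trans (sym (cong (λ f → f (regs s 3)) isA₀)) (≡ᵇ-true e₀))))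
      (λ e₀ → letter-case mj λ a → true≢false (true-≡ᵇ (trans (cong (λ f → f (regs s 3)) isA₀)
          (trans (cong A₀ r3) a))) e₀))
    (λ e → run-weaken ≤-refl (λ { s′ refl → r3 ,
        length-so-far b′ refl refl (λ x x<sj mx →
            ls x (≤∧≢⇒< (≤-pred x<sj) λ { refl → true≢false (true-≡ᵇ (trans (cong m₃ r3) mx)) e }) mx) l≤ c₅
            })
      (run-exec skip s tt))
    where
    open Base b
    open Marks ms
    r≤B : ∀ r → regs s r ≤ B
    r≤B r = ≤-trans (small r) M≤B
    b′ : Basic (setReg 3 (suc j) s)
    b′ = basic-set {s} 3 z<s (≤-trans j<n n≤M) b
    extend : ∀ {v} → v ≡ len (W j) → m₃ j ≡ 1 → Len m₃ m₆ (suc j)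
        (setReg 3 (suc j) (setCell 4 (regs s 3) v s))
    extend {v} v≡ mj = length-so-far b′ refl refl lens′
        (update-≤ l≤ (subst (_≤ N) (sym v≡) (proj₂ (marked j mj)))) c₅
      where
      lens′ : ∀ x → x < suc j → m₃ x ≡ 1 → update (arrays s 4) (regs s 3) v x ≡ len (W x)
      lens′ x x<sj mx with update-case (arrays s 4) (regs s 3) v x
      ... | inj₁ (x≡ , e) = trans e (trans v≡ (cong (λ x → len (W x)) (sym (trans x≡ r3))))
      ... | inj₂ (x≢ , e) = trans e (ls x (≤∧≢⇒< (≤-pred x<sj) λ x≡j → x≢ (trans x≡j (sym r3))) mx)
    pair-case : m₃ j ≡ 1 → A₀ j ≡ 1 →
      Run B (store 4 (reg 3) (op add (4 ⟦ 6 ⟦ reg 3 ⟧ ⟧) (4 ⟦ 2 ⟦ reg 3 ⟧ ⟧))) s (1 + 1 + 7)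
        (λ s′ → regs s′ 3 ≡ j × Len m₃ m₆ (suc j) (setReg 3 (suc j) s′))
    pair-case mj aj with node {j} j<n | down j (m≤n+m n j) mj aj
    ... | letterNode a₀ _ _ | _ = ⊥-elim (1+n≢0 (trans (sym aj) a₀))
    ... | pairNode _ p<j q<j c | mp , mq , m₆≡ = run-weaken ≤-refl (λ { s′ refl → r3 , extend sum≡ mj })
        (run-exec _ s (tt , r≤B 3 , ((tt , r≤B 3) , ≤-trans (left≤ (regs s 3)) k≤B) ,
          ((tt , r≤B 3) , subst (_≤ B) (sym A₂≡) (≤-trans (A₂≤ j) k≤B)) , N≤B (l≤ _) , N≤B (l≤ _) ,
          subst (_≤ B) (sym sum≡) (N≤B (proj₂ (marked j mj)))))
      where
      N≤B : ∀ {v} → v ≤ N → v ≤ B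
      N≤B v≤N = ≤-trans v≤N (≤-trans N≤M M≤B)
      A₂≡ : arrays s 2 (regs s 3) ≡ A₂ j
      A₂≡ = cong₂ (λ f i → f i) isA₂ r3
      sum≡ : arrays s 4 (m₆ (regs s 3)) + arrays s 4 (arrays s 2 (regs s 3)) ≡ len (W j)
      sum≡ = trans (cong₂ (λ u v → arrays s 4 u + arrays s 4 v) (trans (cong m₆ r3) m₆≡) A₂≡)
        (trans (cong₂ _+_ (ls (A₁ j) p<j mp) (ls (A₂ j) q<j mq)) (sym (Cat.lens c)))
    letter-case : m₃ j ≡ 1 → ¬ A₀ j ≡ 1 →
      Run B (store 4 (reg 3) (lit 1)) s 3 (λ s′ → regs s′ 3 ≡ j × Len m₃ m₆ (suc j) (setReg 3 (suc j) s′))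
    letter-case mj ¬a with node {j} j<n
    ... | pairNode a _ _ _ = ⊥-elim (¬a a)
    ... | letterNode _ l _ = run-weaken ≤-refl (λ { s′ refl → r3 , extend (sym l) mj })
        (run-exec _ s (tt , r≤B 3 , tt))

  -- Either every pass so far has doubled or the power already exceeds N; after n passes both
  -- alternatives give N < 2 ^ lg. The bound `low` says that doubling never goes beyond 2 N, which
  -- keeps lg logarithmic in N.
  record Pow (m₃ m₄ m₆ : ℕ → ℕ) (j : ℕ) (s : State) : Set where
    constructor pow-so-far
    field
      basic : Basic s
      is₃   : arrays s 3 ≡ m₃
      is₄   : arrays s 4 ≡ m₄
      is₆   : arrays s 6 ≡ m₆
      N≡    : regs s 2 ≡ N
      lg≤   : regs s 1 ≤ j
      pows  : ∀ t → t ≤ regs s 1 → arrays s 5 t ≡ 2 ^ t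
      low   : 2 ^ regs s 1 ≤ 2 * N
      exit  : regs s 1 ≡ j ⊎ N < 2 ^ regs s 1
      pow≤  : ∀ t → arrays s 5 t ≤ 2 * N

  pow-run : ∀ {m₃ m₄ m₆} j s → j < n → Pow m₃ m₄ m₆ j s → regs s 3 ≡ j →
            Run B powBody s (time powBody) (λ s′ → regs s′ 3 ≡ j × Pow m₃ m₄ m₆ (suc j) (setReg 3 (suc j) s′))
  pow-run {m₃} {m₄} {m₆} j s j<n (pow-so-far b refl refl refl N≡ lg≤ ps low ex p≤) r3 =
    run-branch (tt , (tt , r≤B 1))
      (λ e → run-weaken ≤-refl (λ { s′ refl → r3 ,
          pow-so-far b′ refl refl refl N≡ (m≤n⇒m≤1+n lg≤) ps low (inj₂ (N<pow (<ᵇ-true _ _ e))) p≤ })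
              (run-exec skip s tt))
      (λ e → run-weaken ≤-refl (λ { s′ refl → r3 , grow (<ᵇ-false _ _ e) })
        (run-exec _ s (((tt , tt , r≤B 1 , 1≤B , lg+1≤B) , lg+1≤B , (tt , (tt , r≤B 1) , 2≤B ,
            pow≤B , 2pow≤B)) ,
          (tt , tt , r≤B 1 , 1≤B , lg+1≤B))))
    where
    open Base b
    lg = regs s 1
    r≤B : ∀ r → regs s r ≤ B
    r≤B r = ≤-trans (small r) M≤B
    b′ : Basic (setReg 3 (suc j) s)
    b′ = basic-set {s} 3 z<s (≤-trans j<n n≤M) b
    lg+1≤n : lg + 1 ≤ n
    lg+1≤n = subst (_≤ n) (+-comm 1 lg) (≤-trans (s≤s lg≤) j<n)
    lg+1≤B : lg + 1 ≤ B
    lg+1≤B = ≤-trans lg+1≤n n≤B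
    pow≤4M : ∀ {v} → v ≤ 2 * N → 2 * v ≤ M ^ 2
    pow≤4M {v} v≤ = ≤-trans (lia 3 (λ v N M → (v ≼ 2 ⊛ N) ∷ (N ≼ M) ∷ [] ⊢ˡ 2 ⊛ v ≼ 4 ⊛ M) v N M v≤ N≤M) 4M≤M²
    2pow≤B : 2 * arrays s 5 lg ≤ B
    2pow≤B = ≤-trans (pow≤4M (p≤ lg)) M²≤B
    pow≤B : arrays s 5 lg ≤ B
    pow≤B = ≤-trans (m≤m+n _ _) 2pow≤B
    N<pow : regs s 2 < arrays s 5 lg → N < 2 ^ lg
    N<pow = subst₂ _<_ N≡ (ps lg ≤-refl)
    grow : arrays s 5 lg ≤ regs s 2 → Pow m₃ m₄ m₆ (suc j)
        (setReg 3 (suc j) (setReg 1 (lg + 1) (setCell 5 (lg + 1) (2 * arrays s 5 lg) s)))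
    grow p≤N = pow-so-far
        (basic-set {setReg 1 (lg + 1) s} 3 z<s (≤-trans j<n n≤M) (basic-set {s} 1 z<s (≤-trans lg+1≤n n≤M) b))
            refl refl refl N≡
        (subst (_≤ suc j) (+-comm 1 lg) (s≤s lg≤)) pows′
        (subst (_≤ 2 * N) (sym pow≡) 2p≤) (inj₁ (trans (+-comm lg 1) (cong suc lg≡j)))
        (update-≤ p≤ (subst (λ p → 2 * p ≤ 2 * N) (sym (ps lg ≤-refl)) 2p≤))
      where
      2^lg≤N : 2 ^ lg ≤ N
      2^lg≤N = subst₂ _≤_ (ps lg ≤-refl) N≡ p≤N
      lg≡j : lg ≡ j
      lg≡j = go ex
        where
        go : lg ≡ j ⊎ N < 2 ^ lg → lg ≡ j
        go (inj₁ e)  = e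
        go (inj₂ N<) = ⊥-elim (<⇒≱ N< 2^lg≤N)
      pow≡ : 2 ^ (lg + 1) ≡ 2 * 2 ^ lg
      pow≡ = cong (2 ^_) (+-comm lg 1)
      2p≤ : 2 * 2 ^ lg ≤ 2 * N
      2p≤ = *-monoʳ-≤ 2 2^lg≤N
      pows′ : ∀ t → t ≤ lg + 1 → update (arrays s 5) (lg + 1) (2 * arrays s 5 lg) t ≡ 2 ^ t
      pows′ t t≤ with update-case (arrays s 5) (lg + 1) (2 * arrays s 5 lg) t
      ... | inj₁ (refl , e) = trans e (trans (cong (2 *_) (ps lg ≤-refl)) (sym pow≡))
      ... | inj₂ (t≢ , e) = trans e (ps t (≤-pred (subst (suc t ≤_) (+-comm lg 1) (≤∧≢⇒< t≤ t≢))))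

  record Ready (s : State) : Set where
    constructor is-ready
    field
      {m₃ m₄ m₆} : ℕ → ℕ
      marks : Marks n m₃ m₆
      lens  : ∀ x → x < n → m₃ x ≡ 1 → m₄ x ≡ len (W x)
      len≤  : ∀ x → m₄ x ≤ N
      pow   : Pow m₃ m₄ m₆ n s

  init-run : ∀ s → Fresh s → Run B initP s (initTime n) Ready
  init-run s f = run-weaken (≤-reflexive time≡) (λ _ r → r)
    (run-seq (run-exec (store 3 (op sub (reg 0) (lit 1)) (lit 1)) s ((tt , tt , r≤B s b 0 , 1≤B , n∸1≤B s b) ,
        n∸1≤B s b , tt)) λ { s₁ refl →
     run-seq (for-run Mark n (time markBody) n<B (λ j s I → Base.n≡ (Mark.basic I) , tt) mark-run s₁
       (mark (basic-set {s} 3 z<s z≤n b) start empty₄ empty₅)) λ s₂ mk →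
     run-seq (for-run (Len (arrays s₂ 3) (arrays s₂ 6)) n (time lenBody) n<B (λ j s I →
         Base.n≡ (Len.basic I) , tt)
       (len-run (Mark.marks mk)) s₂
       (length-so-far (basic-set {s₂} 3 z<s z≤n (Mark.basic mk)) refl refl (λ _ ()) (λ x →
           subst (_≤ N) (sym (Mark.clean₄ mk x)) z≤n) (Mark.clean₅ mk)))
       λ s₃ ln → let b₃ = Len.basic ln in
     run-seq (run-exec (set 2 (4 ⟦ op sub (reg 0) (lit 1) ⟧)) s₃ ((tt , tt , r≤B s₃ b₃ 0 , 1≤B ,
         n∸1≤B s₃ b₃) , n∸1≤B s₃ b₃)) λ { s₄ refl →
     run-seq (run-exec (set 1 (lit 0)) s₄ tt) λ { s₅ refl →
     run-seq (run-exec (store 5 (lit 0) (lit 1)) s₅ (tt , z≤n , tt)) λ { s₆ refl →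
     run-weaken ≤-refl (λ s₇ pw → is-ready (Mark.marks mk) (Len.lens ln) (Len.len≤ ln) pw)
       (for-run (Pow (arrays s₂ 3) (arrays s₃ 4) (arrays s₂ 6)) n (time powBody) n<B (λ j s I →
           Base.n≡ (Pow.basic I) , tt)
         pow-run s₆ (pow-start s₃ (Mark.marks mk) ln)) } } } })
    where
    open Fresh f renaming (basic to b)
    r≤B : ∀ s → Basic s → ∀ r → regs s r ≤ B
    r≤B s b r = ≤-trans (Base.small b r) M≤B
    n∸1≤B : ∀ s → Basic s → regs s 0 ∸ 1 ≤ B
    n∸1≤B s b = ≤-trans (m∸n≤m _ 1) (r≤B s b 0)
    time≡ : _ ≡ initTime n
    time≡ = refl
    start : Marks 0 (update (arrays s 3) (regs s 0 ∸ 1) 1) (arrays s 6)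
    start = record
      { mark≤ = update-≤ (λ x → subst (_≤ 1) (sym (empty₃ x)) z≤n) ≤-refl
      ; marked = marked′
      ; down = λ x n≤x e _ → ⊥-elim (<⇒≱ (proj₁ (marked′ x e)) (subst (n ≤_) (+-identityʳ x) n≤x))
      ; left≤ = λ x → subst (_≤ k) (sym (empty₆ x)) z≤n
      ; root = trans (cong (update (arrays s 3) (regs s 0 ∸ 1) 1) (sym last≡k)) (update-same (arrays s 3)
          (regs s 0 ∸ 1) 1) }
      where
      last≡k : regs s 0 ∸ 1 ≡ k
      last≡k = cong (_∸ 1) (Base.n≡ b)
      marked′ : ∀ x → update (arrays s 3) (regs s 0 ∸ 1) 1 x ≡ 1 → x < n × len (W x) ≤ N
      marked′ x e with update-case (arrays s 3) (regs s 0 ∸ 1) 1 x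
      ... | inj₁ (refl , _) = subst (λ x → x < n × len (W x) ≤ N) (sym last≡k) (≤-refl , ≤-refl)
      ... | inj₂ (_ , e′) = ⊥-elim (1+n≢0 (trans (sym e) (trans e′ (empty₃ x))))
    pow-start : ∀ s {m₃ m₆} → Marks n m₃ m₆ → Len m₃ m₆ n s →
      Pow m₃ (arrays s 4) m₆ 0
          (setReg 3 0 (setCell 5 0 1 (setReg 1 0 (setReg 2 (arrays s 4 (regs s 0 ∸ 1)) s))))
    pow-start s {m₃} {m₆} ms (length-so-far b i₃ i₆ ls l≤ c₅) = pow-so-far
        (basic-set {setReg 1 0 (setReg 2 (arrays s 4 (regs s 0 ∸ 1)) s)} 3 z<s z≤n
          (basic-set {setReg 2 (arrays s 4 (regs s 0 ∸ 1)) s} 1 z<s z≤n (basic-set {s} 2 z<s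
              (≤-trans (l≤ _) N≤M) b))) i₃ refl i₆
        (trans (cong (λ x → arrays s 4 (x ∸ 1)) (Base.n≡ b)) (ls k ≤-refl (Marks.root ms)))
        z≤n pows (≤-trans (s≤s z≤n) (*-monoʳ-≤ 2 (≤-trans (s≤s z≤n) 2≤N))) (inj₁ refl)
        (update-≤ (λ t → subst (_≤ 2 * N) (sym (c₅ t)) z≤n)
            (≤-trans (s≤s z≤n) (*-monoʳ-≤ 2 (≤-trans (s≤s z≤n) 2≤N))))
      where
      pows : ∀ t → t ≤ 0 → update (arrays s 5) 0 1 t ≡ 2 ^ t
      pows zero _ = refl

  module _ {s : State} (ready : Ready s) where
    open Ready ready
    open Pow pow
    open Base basic

    readyLayout : Layout
    readyLayout = record { n = n ; lg = regs s 1 ; N = N ; F = arrays s ; W = W }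

    N<2^lg : N < 2 ^ regs s 1
    N<2^lg = go exit
      where
      go : regs s 1 ≡ n ⊎ N < 2 ^ regs s 1 → N < 2 ^ regs s 1
      go (inj₁ e)  = subst (λ t → N < 2 ^ t) (sym e) N<2^n
      go (inj₂ N<) = N<

    private
      module L = Layout readyLayout
      live-mark : ∀ {x} → L.Live x → m₃ x ≡ 1
      live-mark {x} (_ , e) = trans (cong (λ f → f x) (sym is₃)) e

      live-intro : ∀ {x} → x < n → m₃ x ≡ 1 → L.Live x
      live-intro {x} x<n e = x<n , trans (cong (λ f → f x) is₃) e

    ready-shape : ∀ {x} → L.Live x → L.IsPair x ⊎ L.IsLetter x
    ready-shape {x} l with node {x} (proj₁ l)
    ... | letterNode a e c = inj₂ (record
        { kind = trans (cong (λ f → f x) isA₀) a ; len≡1 = e ; code = trans c (cong (λ f → f x) (sym isA₁)) })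
    ... | pairNode a p<x q<x c with Marks.down marks x (m≤n+m n x) (live-mark l) a
    ...   | mp , mq , m₆≡ = inj₁ (record
        { kind = trans (cong (λ f → f x) isA₀) a
        ; live-left = subst L.Live (sym left≡) (live-intro (<-trans p<x (proj₁ l)) mp)
        ; live-right = subst L.Live (sym right≡) (live-intro (<-trans q<x (proj₁ l)) mq)
        ; left< = subst (_< x) (sym left≡) p<x
        ; right< = subst (_< x) (sym right≡) q<x
        ; cat = subst₂ (λ p q → Cat (W x) (W p) (W q)) (sym left≡) (sym right≡) c })
      where
      left≡ : arrays s 6 x ≡ A₁ x
      left≡ = trans (cong (λ f → f x) is₆) m₆≡
      right≡ : arrays s 2 x ≡ A₂ x
      right≡ = cong (λ f → f x) isA₂

    ready-bound : ∀ a → a ≢ 1 → a < 8 → ∀ i → arrays s a i ≤ M ^ 2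
    ready-bound a a≢1 a<8 i = go a a≢1 a<8
      where
      small² : ∀ {v} → v ≤ M → v ≤ M ^ 2
      small² v≤ = ≤-trans v≤ (≤-trans (m≤m+n M _) 4M≤M²)
      k≤M : k ≤ M
      k≤M = ≤-trans (n≤1+n k) n≤M
      go : ∀ a → a ≢ 1 → a < 8 → arrays s a i ≤ M ^ 2
      go 0 _ _ = small² (subst (λ f → f i ≤ M) (sym isA₀) (≤-trans (A₀≤ i) 1≤M))
      go 1 ne _ = ⊥-elim (ne refl)
      go 2 _ _ = small² (subst (λ f → f i ≤ M) (sym isA₂) (≤-trans (A₂≤ i) k≤M))
      go 3 _ _ = small² (subst (λ f → f i ≤ M) (sym is₃) (≤-trans (Marks.mark≤ marks i) 1≤M))
      go 4 _ _ = small² (subst (λ f → f i ≤ M) (sym is₄) (≤-trans (len≤ i) N≤M))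
      go 5 _ _ = ≤-trans (pow≤ i) (≤-trans (lia 2 (λ N M → (N ≼ M) ∷ [] ⊢ˡ 2 ⊛ N ≼ 4 ⊛ M) N M N≤M) 4M≤M²)
      go 6 _ _ = small² (subst (λ f → f i ≤ M) (sym is₆) (≤-trans (Marks.left≤ marks i) k≤M))
      go 7 _ _ = subst (_≤ M ^ 2) (sym (zero₇ i)) z≤n
      go (suc (suc (suc (suc (suc (suc (suc (suc a)))))))) _ a<8 = ⊥-elim (<⇒≱ a<8 (m≤m+n 8 a))

    readyModel : Model
    readyModel = record
      { layout = readyLayout ; 4≤M = 4≤M ; lg≤M = ≤-trans lg≤ n≤M ; F-bound = ready-bound
      ; N<2^lg = N<2^lg ; powers = pows
      ; len-F = λ {x} l → trans (cong (λ f → f x) is₄) (lens x (proj₁ l) (live-mark l))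
      ; len≥1 = λ l → len≥1ⁿ (proj₁ l)
      ; len≤N = λ {x} l → proj₂ (Marks.marked marks x (live-mark l))
      ; shape = ready-shape }

    root-live : Model.Live readyModel k
    root-live = live-intro ≤-refl (Marks.root marks)

    ready-inv : Table.Inv readyModel s
    ready-inv = Table.inv n≡ refl N≡ (λ a _ → refl)
      (λ r → ≤-trans (small r) (M≤ (Γ r) (Γ≥1 r)))
      (λ i → inj₁ (cell≡′ (zero₈ i) (zero₉ i) (zero₁₀ i))) silent
      where
      M≤ : ∀ d → 1 ≤ d → M ≤ M ^ d
      M≤ d 1≤d = subst (_≤ M ^ d) (^-identityʳ M) (^-monoʳ-≤ M {{>-nonZero 1≤M}} 1≤d)
      Γ≥1 : ∀ r → 1 ≤ Γ r
      Γ≥1 r = if-elim (1 ≤_) (r <ᵇ 30) (λ _ → s≤s z≤n) λ _ → if-elim (1 ≤_) (r <ᵇ 37) (λ _ → s≤s z≤n) λ _ →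
              if-elim (1 ≤_) (r <ᵇ 40) (λ _ → s≤s z≤n) (λ _ → s≤s z≤n)
      cell≡′ : ∀ {h g l} → h ≡ 0 → g ≡ 0 → l ≡ 0 → cell h g l ≡ cell 0 0 0
      cell≡′ refl refl refl = refl

-- Words as lists, and periods in terms of positions

open import Data.List.Relation.Binary.Prefix.Heterogeneous using (Prefix; []; _∷_)

-- Positions beyond the end of a word hold 0.

nth : List Letter → ℕ → ℕ
nth []       i       = 0
nth (x ∷ xs) zero    = x
nth (x ∷ xs) (suc i) = nth xs i

word : List Letter → Str
word u = str (length u) (nth u)

nth-++ˡ : ∀ u v i → i < length u → nth (u ++ v) i ≡ nth u i
nth-++ˡ (x ∷ u) v zero    _       = refl
nth-++ˡ (x ∷ u) v (suc i) (s≤s p) = nth-++ˡ u v i p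

nth-++ʳ : ∀ u v i → nth (u ++ v) (length u + i) ≡ nth v i
nth-++ʳ []      v i = refl
nth-++ʳ (x ∷ u) v i = nth-++ʳ u v i

word-cat : ∀ u v → Cat (word (u ++ v)) (word u) (word v)
word-cat u v = record { lens = length-++ u ; fst-at = nth-++ˡ u v ; snd-at = λ z _ → nth-++ʳ u v z }

prefix-length : ∀ {u v : List Letter} → Prefix _≡_ u v → length u ≤ length v
prefix-length []      = z≤n
prefix-length (_ ∷ p) = s≤s (prefix-length p)

prefix-nth : ∀ {u v : List Letter} → Prefix _≡_ u v → ∀ i → i < length u → nth u i ≡ nth v i
prefix-nth (e ∷ p) zero    _       = e
prefix-nth (e ∷ p) (suc i) (s≤s l) = prefix-nth p i l

nth-prefix : ∀ u v → length u ≤ length v → (∀ i → i < length u → nth u i ≡ nth v i) → Prefix _≡_ u v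
nth-prefix []      v       _       _ = []
nth-prefix (x ∷ u) (y ∷ v) (s≤s l) f = f 0 z<s ∷ nth-prefix u v l (λ i i< → f (suc i) (s<s i<))

take-prefix : ∀ p (u : List Letter) → Prefix _≡_ (take p u) u
take-prefix zero    u       = []
take-prefix (suc p) []      = []
take-prefix (suc p) (x ∷ u) = refl ∷ take-prefix p u

PeriodOf : ℕ → List Letter → Set
PeriodOf p u = 1 ≤ p × p ≤ length u × (∀ z → z + p < length u → nth u z ≡ nth u (z + p))

power : ℕ → List Letter → List Letter
power k w = concat (replicate k w)

-- A power is built by adding copies in front. To compare it with its shift by one copy, it must be
-- known that a further copy leaves the existing positions unchanged.
power-agree : ∀ w k z → z < length (power k w) → nth (power (suc k) w) z ≡ nth (power k w) z
power-agree w (suc k) z z< with z <? length w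
... | yes z<w = trans (nth-++ˡ w _ z z<w) (sym (nth-++ˡ w _ z z<w))
... | no z≮w with z ∸ length w | m+[n∸m]≡n (≮⇒≥ z≮w)
...   | i | refl = trans (nth-++ʳ w (power (suc k) w) i) (trans (power-agree w k i i<)
    (sym (nth-++ʳ w (power k w) i)))
  where
  i< : i < length (power k w)
  i< = +-cancelˡ-< (length w) _ _ (subst (length w + i <_) (length-++ w) z<)

power-period : ∀ w k z → z + length w < length (power k w) → nth (power k w) z ≡ nth
    (power k w) (z + length w)
power-period w (suc k) z z< = trans (power-agree w k z i<)
    (sym (trans (cong (nth (power (suc k) w)) (+-comm z (length w))) (nth-++ʳ w (power k w) z)))
  where
  i< : z < length (power k w)
  i< = +-cancelˡ-< (length w) _ _ (subst₂ _<_ (+-comm z (length w)) (length-++ w) z<)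

power-[] : ∀ k → power k [] ≡ []
power-[] zero    = refl
power-[] (suc k) = power-[] k

periodLength-periodOf : ∀ {p u} → 1 ≤ length u → IsPeriodLength p u → PeriodOf p u
periodLength-periodOf {u = u} u≥1 (w , refl , w≤u , k , u≤) = w≥1 w u≤ , prefix-length w≤u , per
  where
  w≥1 : ∀ w → Prefix _≡_ u (power k w) → 1 ≤ length w
  w≥1 (_ ∷ _) _ = s≤s z≤n
  w≥1 [] pre = ⊥-elim (<⇒≱ u≥1 (subst (λ v → length u ≤ length v) (power-[] k) (prefix-length pre)))
  per : ∀ z → z + length w < length u → nth u z ≡ nth u (z + length w)
  per z z< = trans (prefix-nth u≤ z (≤-<-trans (m≤m+n z (length w)) z<))
    (trans (power-period w k z (<-≤-trans z< (prefix-length u≤))) (sym (prefix-nth u≤ (z + length w) z<)))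

length-power : ∀ k (w : List Letter) → length (power k w) ≡ k * length w
length-power zero    w = refl
length-power (suc k) w = trans (length-++ w) (cong (length w +_) (length-power k w))

periodOf-periodLength : ∀ {p u} → PeriodOf p u → IsPeriodLength p u
-- A prefix of positive length p, repeated `length u` times, is at least as long as u.
periodOf-periodLength {p} {u} (p≥1 , p≤u , per) = w , w-len , take-prefix p u , length u ,
  nth-prefix u (power (length u) w)
    (subst (length u ≤_) (sym (trans (length-power (length u) w) (cong (length u *_) w-len)))
      (≤-trans (≤-reflexive (sym (*-identityʳ (length u)))) (*-monoʳ-≤ (length u) p≥1)))
    (λ i i< → sym (agree (length u) i i<
        (subst (i <_) (sym (trans (length-power (length u) w) (cong (length u *_) w-len)))
      (<-≤-trans i< (≤-trans (≤-reflexive (sym (*-identityʳ (length u)))) (*-monoʳ-≤ (length u) p≥1))))))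
  where
  w = take p u
  w-len : length w ≡ p
  w-len = trans (length-take p u) (m≤n⇒m⊓n≡m p≤u)
  agree : ∀ k z → z < length u → z < length (power k w) → nth (power k w) z ≡ nth u z
  agree (suc k) z z<u z< with z <? length w
  ... | yes z<w = trans (nth-++ˡ w _ z z<w) (prefix-nth (take-prefix p u) z z<w)
  ... | no z≮w with z ∸ length w | m+[n∸m]≡n (≮⇒≥ z≮w)
  ...   | i | refl = trans (nth-++ʳ w (power k w) i)
      (trans (agree k i i<u (+-cancelˡ-< (length w) _ _ (subst (length w + i <_) (length-++ w) z<)))
            (trans (per i (subst (_< length u) w+i z<u)) (cong (nth u) (sym w+i))))
    where
    w+i : length w + i ≡ i + p
    w+i = trans (+-comm (length w) i) (cong (i +_) w-len)
    i<u : i < length u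
    i<u = ≤-<-trans (m≤n+m i (length w)) z<u

-- The words generated by a straight-line program

module Words {k : ℕ} (G : SLP (suc k)) where
  private
    n = suc k

  derivation : ∀ h (i : Fin n) → toℕ i < h → ∃ λ u → G ⊢ i ⇒ u
  derivation (suc h) i (s≤s i<h) = go (G i) refl
    where
    go : (π : Production i) → G i ≡ π → ∃ λ u → G ⊢ i ⇒ u
    go (letter a) e = _ , letter e
    go (pair p q p<i q<i) e with derivation h p (<-≤-trans p<i i<h) | derivation h q (<-≤-trans q<i i<h)
    ... | u , du | v , dv = _ , pair e du dv

  deterministic : ∀ {i u v} → G ⊢ i ⇒ u → G ⊢ i ⇒ v → u ≡ v
  deterministic (letter e) (letter e′) with trans (sym e) e′
  ... | refl = refl
  deterministic (letter e) (pair e′ _ _) with trans (sym e) e′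
  ... | ()
  deterministic (pair e _ _) (letter e′) with trans (sym e) e′
  ... | ()
  deterministic (pair e du dv) (pair e′ du′ dv′) with trans (sym e) e′
  ... | refl = cong₂ _++_ (deterministic du du′) (deterministic dv dv′)

  val : Fin n → List Letter
  val i = proj₁ (derivation n i (toℕ<n i))

  val-derived : ∀ i → G ⊢ i ⇒ val i
  val-derived i = proj₂ (derivation n i (toℕ<n i))

  W : ℕ → Str
  W x with x <? n
  ... | yes x<n = word (val (fromℕ< x<n))
  ... | no _    = str 0 (λ _ → 0)

  W-val : ∀ i → W (toℕ i) ≡ word (val i)
  W-val i with toℕ i <? n
  ... | yes x<n = cong (λ j → word (val j)) (fromℕ<-toℕ i x<n)
  ... | no x≮n  = ⊥-elim (x≮n (toℕ<n i))

  input-code : ∀ a i → inputArrays G a (toℕ i) ≡ productionCode (G i) a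
  input-code a i with toℕ i <? n
  ... | yes x<n = cong (λ j → productionCode (G j) a) (fromℕ<-toℕ i x<n)
  ... | no x≮n  = ⊥-elim (x≮n (toℕ<n i))

  source : Source
  source = record { k = k ; A₀ = inputArrays G 0 ; A₁ = inputArrays G 1 ; A₂ = inputArrays G 2 ; W = W }

  open Source source using (Node; letterNode; pairNode)

  node-fin : ∀ i → Node (toℕ i)
  node-fin i = go (G i) refl
    where
    go : (π : Production i) → G i ≡ π → Node (toℕ i)
    go (letter a) e = letterNode (code 0)
        (cong len Wi) (trans (cong (λ w → at w 0) Wi) (sym (code 1)))
      where
      code : ∀ c → inputArrays G c (toℕ i) ≡ productionCode (letter {i = i} a) c
      code c = trans (input-code c i) (cong (λ π → productionCode π c) e)
      Wi : W (toℕ i) ≡ word (a ∷ [])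
      Wi = trans (W-val i) (cong word (deterministic (val-derived i) (letter e)))
    go π@(pair p q p<i q<i) e = pairNode (code 0)
        (subst (_< toℕ i) (sym (code 1)) p<i) (subst (_< toℕ i) (sym (code 2)) q<i)
        (cat (trans (cong W (code 1)) (W-val p)) (trans (cong W (code 2)) (W-val q)))
      where
      code : ∀ c → inputArrays G c (toℕ i) ≡ productionCode π c
      code c = trans (input-code c i) (cong (λ π → productionCode π c) e)
      Wi : W (toℕ i) ≡ word (val p ++ val q)
      Wi = trans (W-val i) (cong word (deterministic (val-derived i) (pair e (val-derived p)
          (val-derived q))))
      cat : ∀ {X Y} → X ≡ word (val p) → Y ≡ word (val q) → Cat (W (toℕ i)) X Y
      cat refl refl = subst (λ Z → Cat Z (word (val p)) (word (val q))) (sym Wi) (word-cat (val p) (val q))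

  code₀≤1 : ∀ {i : Fin n} (π : Production i) → productionCode π 0 ≤ 1
  code₀≤1 (letter a)     = z≤n
  code₀≤1 (pair p q _ _) = ≤-refl

  code₂≤k : ∀ {i : Fin n} (π : Production i) → productionCode π 2 ≤ k
  code₂≤k (letter a)     = z≤n
  code₂≤k (pair p q _ _) = ≤-pred (toℕ<n q)

  module _ {T : List Letter} (generates : G Generates T) (2≤T : 2 ≤ length T) where
    W-root : W k ≡ word T
    W-root = trans (cong W (sym (toℕ-fromℕ k))) (trans (W-val (fromℕ k))
        (cong word (deterministic (val-derived (fromℕ k)) generates)))

    goodSource : GoodSource
    goodSource = record
      { source = source
      ; node = λ {x} x<n → subst Node (toℕ-fromℕ< x<n) (node-fin (fromℕ< x<n))
      ; A₀≤ = λ x → bound 0 1 (λ i → code₀≤1 (G i)) x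
      ; A₂≤ = λ x → bound 2 k (λ i → code₂≤k (G i)) x
      ; 2≤N = subst (λ X → 2 ≤ len X) (sym W-root) 2≤T }
      where
      bound : ∀ a b → (∀ i → productionCode (G i) a ≤ b) → ∀ x → inputArrays G a x ≤ b
      bound a b f x with x <? n
      ... | yes x<n = f (fromℕ< x<n)
      ... | no _    = z≤n

-- From borders to periods

-- The periods N − l for the border lengths l < N of a cell; the border of
-- length N is the largest element of its cell and is skipped by moving one
-- step down.  An empty cell yields the period N.
skipped : ℕ → Cell → ℕ
skipped N c = 1 ∸ (N ∸ hi c)

periodsOf : ℕ → Cell → Progression
periodsOf N c = progression (N ∸ hi c + skipped N c * gap c) (gap c)
    (quot (hi c ∸ lo c) (gap c) + (1 ∸ skipped N c))

Periodic : (ℕ → ℕ) → ℕ → ℕ → Set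
Periodic f N p = 1 ≤ p × p ≤ N × (∀ z → z + p < N → f z ≡ f (z + p))

module _ {X : Str} where
  private
    N = len X

  ov-periodic : ∀ {p l} → 1 ≤ p → p + l ≡ N → Ov X X l → Periodic (at X) N p
  ov-periodic {p} {l} p≥1 p+l (ov o o+l l≥1 _ m) = p≥1 , subst (p ≤_) p+l (m≤m+n p l) ,
    λ z z+p< → sym (trans
        (cong (at X) (trans (+-comm z p) (cong (_+ z) (+-cancelʳ-≡ l p o (trans p+l (sym o+l))))))
      (m z (lia 4 (λ z p l n → (z ⊕ p ≺ n) ∷ (p ⊕ l ≐ n) ∷ [] ⊢ˡ z ≺ l) z p l N z+p< p+l)))

  periodic-ov : ∀ {p l} → 1 ≤ l → p + l ≡ N → Periodic (at X) N p → Ov X X l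
  periodic-ov {p} {l} l≥1 p+l (p≥1 , _ , per) = ov p p+l l≥1 (subst (l ≤_) p+l (m≤n+m l p))
    λ z z<l → trans (cong (at X) (+-comm p z))
        (sym (per z (lia 4 (λ z p l n → (z ≺ l) ∷ (p ⊕ l ≐ n) ∷ [] ⊢ˡ z ⊕ p ≺ n) z p l N z<l p+l)))

  module _ {t c} (2≤N : 2 ≤ N) (R : Rep c (OvScale X X t)) where
    private
      δ = skipped N c
      h≤N : hi c ≤ N
      h≤N = Rep.hi-bound R λ v (O , _) → Ov.l≤Y O

    data Top : ℕ → ℕ → Set where
      proper : ∀ {r} → 0 < r → Top r 0
      whole  : Top 0 1

    top-view : Top (N ∸ hi c) δ
    top-view with N ∸ hi c
    ... | zero  = whole
    ... | suc r = subst (Top (suc r)) (sym (0∸n≡0 r)) (proper z<s)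

    aligned-quot : lo c + quot (hi c ∸ lo c) (gap c) * gap c ≡ hi c
    aligned-quot with Rep.aligned R
    ... | k , e = trans (cong (lo c +_) (quot-exact k (trans (sym (m+n∸m≡n (lo c) (k * gap c)))
        (cong (_∸ lo c) e))))
                        (m+[n∸m]≡n (subst (lo c ≤_) e (m≤m+n (lo c) (k * gap c))))

    private
      g = gap c
      q = quot (hi c ∸ lo c) g

      quot-pos : ∀ {j m} g → j < quot m g → 0 < g
      quot-pos (suc g) _ = z<s

      from-border : ∀ {p d} i → d + hi c ≡ N → i ≤ q → p ≡ d + i * g → 1 ≤ p → Periodic (at X) N p
      from-border {p} {d} i d+h i≤q p≡ p≥1 = split (m≤n⇒m<n∨m≡n (z≤n {l}))
        where
        l = hi c ∸ i * g
        ig≤ : i * g ≤ q * g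
        ig≤ = *-monoˡ-≤ g i≤q
        l+ : l + i * g ≡ hi c
        l+ = m∸n+n≡m (≤-trans ig≤ (subst (q * g ≤_) aligned-quot (m≤n+m (q * g) (lo c))))
        p+l : p + l ≡ N
        p+l = lia 6 (λ p d x h n l → (p ≐ d ⊕ x) ∷ (d ⊕ h ≐ n) ∷ (l ⊕ x ≐ h) ∷ [] ⊢ˡ p ⊕ l ≐ n) p d (i * g)
            (hi c) N l p≡ d+h l+
        split : 0 < l ⊎ 0 ≡ l → Periodic (at X) N p
        split (inj₁ l≥1) = ov-periodic p≥1 p+l (proj₁ (Rep.sound R l≥1
          (lia 5 (λ lo l x y h → (lo ⊕ y ≐ h) ∷ (l ⊕ x ≐ h) ∷ (x ≼ y) ∷ [] ⊢ˡ lo ≼ l) (lo c) l (i * g) (q * g)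
              (hi c) aligned-quot l+ ig≤ ,
           m∸n≤m (hi c) (i * g) , i , l+)))
        -- No border remains, as happens for the empty cell; then p = N and the condition on
        -- positions is vacuous.
        split (inj₂ 0≡l) = p≥1 , ≤-reflexive p≡N , λ z z+p< →
            ⊥-elim (<⇒≱ z+p< (≤-trans (≤-reflexive (sym p≡N)) (m≤n+m p z)))
          where
          p≡N : p ≡ N
          p≡N = trans (sym (+-identityʳ p)) (trans (cong (p +_) 0≡l) p+l)

      sound′ : ∀ {d δ p j} → Top d δ → d + hi c ≡ N → j < q + (1 ∸ δ) → p ≡ d + δ * g + j * g →
          Periodic (at X) N p
      sound′ {d} {j = j} (proper 0<d) d+h j< p≡ = from-border j d+h
          (≤-pred (subst (suc j ≤_) (+-comm q 1) j<)) p≡′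
          (≤-trans 0<d (subst (d ≤_) (sym p≡′) (m≤m+n d (j * g))))
        where
        p≡′ = trans p≡ (cong (_+ j * g) (+-identityʳ d))
      sound′ {j = j} whole d+h j< p≡ = from-border (suc j) d+h j<q p≡′ (subst (1 ≤_) (sym p≡′)
          (≤-trans (quot-pos g j<q) (m≤m+n g (j * g))))
        where
        j<q = subst (suc j ≤_) (+-identityʳ q) j<
        p≡′ = trans p≡ (cong (_+ j * g) (+-identityʳ g))

      complete′ : ∀ {d δ p l} → Top d δ → d + hi c ≡ N → p + l ≡ N → 1 ≤ p → l ∈ᶜ c →
                  ∃ λ j → j < q + (1 ∸ δ) × p ≡ d + δ * g + j * g
      complete′ {d} {δ} {p} {l} T d+h p+l p≥1 (lo≤l , _ , k , l+) = go T (m≤n⇒m<n∨m≡n (z≤n {g})) k p≡ kg≤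
        where
        p≡ : p ≡ d + k * g
        p≡ = lia 6 (λ p d x h n l → (p ⊕ l ≐ n) ∷ (d ⊕ h ≐ n) ∷ (l ⊕ x ≐ h) ∷ [] ⊢ˡ p ≐ d ⊕ x) p d (k * g)
            (hi c) N l p+l d+h l+
        kg≤ : k * g ≤ hi c ∸ lo c
        kg≤ = m+n≤o⇒m≤o∸n (k * g) (subst (k * g + lo c ≤_) (trans (+-comm (k * g) l) l+)
            (+-monoʳ-≤ (k * g) lo≤l))
        go : ∀ {d δ} → Top d δ → 0 < g ⊎ 0 ≡ g → ∀ k → p ≡ d + k * g → k * g ≤ hi c ∸ lo c → ∃ λ j →
            j < q + (1 ∸ δ) × p ≡ d + δ * g + j * g
        go {d} (proper _) (inj₁ 0<g) k p≡ kg≤ = k , subst (k <_) (+-comm 1 q) (s≤s (quot-max k 0<g kg≤)) ,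
            trans p≡ (cong (_+ k * g) (sym (+-identityʳ d)))
        go {d} (proper _) (inj₂ 0≡g) k p≡ _ = 0 , subst (0 <_) (+-comm 1 q) z<s ,
          trans p≡ (trans (cong (d +_) (trans (cong (k *_) (sym 0≡g)) (*-zeroʳ k)))
              (sym (+-identityʳ (d + 0))))
        go whole _ zero p≡ _ = ⊥-elim (<⇒≱ p≥1 (≤-reflexive p≡))
        go whole (inj₂ 0≡g) (suc k) p≡ _ =
            ⊥-elim (<⇒≱ p≥1 (≤-reflexive (trans p≡ (trans (cong (suc k *_) (sym 0≡g)) (*-zeroʳ (suc k))))))
        go whole (inj₁ 0<g) (suc k) p≡ kg≤ = k , subst (k <_) (sym (+-identityʳ q))
            (quot-max (suc k) 0<g kg≤) ,
          trans p≡ (cong (_+ k * g) (sym (+-identityʳ g)))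

    periodsOf-sound : ∀ {p} → p ∈ᴾ periodsOf N c → Periodic (at X) N p
    periodsOf-sound (j , j< , p≡) = sound′ top-view (m∸n+n≡m h≤N) j< p≡

    periodsOf-complete : ∀ {p l} → p + l ≡ N → 1 ≤ l → Periodic (at X) N p → Scale t l → p ∈ᴾ periodsOf N c
    periodsOf-complete p+l l≥1 P sc = complete′ top-view (m∸n+n≡m h≤N) p+l (proj₁ P)
        (Rep.member R (periodic-ov l≥1 p+l P , sc))

-- The output phase

-- A cell holding only the border N yields a progression without elements whose `first` is 0; the
-- test on `count` keeps it out of the minimum.
minOf : ℕ → (ℕ → Progression) → ℕ → ℕ
minOf N π zero    = N
minOf N π (suc t) = if 0 <ᵇ count (π t) then minˢ (minOf N π t) (first (π t)) else minOf N π t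

listed : ℕ → (ℕ → Progression) → ℕ → List Progression
listed N π zero    = progression N 0 1 ∷ []
listed N π (suc t) = listed N π t ++ [ π t ]

module _ {f : ℕ → ℕ} {N lg : ℕ} {π : ℕ → Progression} (1≤N : 1 ≤ N)
  (sound : ∀ t → t < lg → ∀ {p} → p ∈ᴾ π t → Periodic f N p) where

  whole-period : Periodic f N N
  whole-period = 1≤N , ≤-refl , λ z z+N<N → ⊥-elim (<⇒≱ z+N<N (m≤n+m N z))

  minOf-periodic : ∀ t → t ≤ lg → Periodic f N (minOf N π t)
  minOf-periodic zero    _ = whole-period
  minOf-periodic (suc t) t<lg = if-elim (Periodic f N) (0 <ᵇ count (π t))
    (λ c → min-elim (Periodic f N) (minOf-periodic t (<⇒≤ t<lg))
      (sound t t<lg (0 , <ᵇ-true 0 _ c , sym (+-identityʳ _))))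
    (λ _ → minOf-periodic t (<⇒≤ t<lg))

  minOf-≤N : ∀ t → minOf N π t ≤ N
  minOf-≤N zero = ≤-refl
  minOf-≤N (suc t) = if-elim (_≤ N) (0 <ᵇ count (π t)) (λ _ → ≤-trans (min≤ˡ (minOf N π t) (first (π t)))
      (minOf-≤N t)) (λ _ → minOf-≤N t)

  minOf-least : ∀ k t → t < k → ∀ {p} → p ∈ᴾ π t → minOf N π k ≤ p
  minOf-least (suc k) t t<k {p} mem@(j , j< , p≡) = if-elim (_≤ p) (0 <ᵇ count (π k))
      (λ _ → split₁ (m≤n⇒m<n∨m≡n (≤-pred t<k))) (λ c → split₂ c (m≤n⇒m<n∨m≡n (≤-pred t<k)))
    where
    split₁ : t < k ⊎ t ≡ k → minˢ (minOf N π k) (first (π k)) ≤ p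
    split₁ (inj₁ t<k) = ≤-trans (min≤ˡ (minOf N π k) (first (π k))) (minOf-least k t t<k mem)
    split₁ (inj₂ refl) = ≤-trans (min≤ʳ (minOf N π k) _) (subst (first (π k) ≤_) (sym p≡) (m≤m+n _ _))
    split₂ : (0 <ᵇ count (π k)) ≡ false → t < k ⊎ t ≡ k → minOf N π k ≤ p
    split₂ c (inj₁ t<k) = minOf-least k t t<k mem
    split₂ c (inj₂ refl) = ⊥-elim (<⇒≱ (≤-<-trans z≤n j<) (<ᵇ-false 0 _ c))

  listed-sound : ∀ t → t ≤ lg → ∀ {p} → Any (p ∈ᴾ_) (listed N π t) → Periodic f N p
  listed-sound zero _ (here (zero , _ , p≡)) = subst (Periodic f N)
      (sym (trans p≡ (+-identityʳ N))) whole-period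
  listed-sound zero _ (here (suc j , s≤s () , _))
  listed-sound (suc t) t<lg a with ++⁻ (listed N π t) a
  ... | inj₁ b        = listed-sound t (<⇒≤ t<lg) b
  ... | inj₂ (here m) = sound t t<lg m

listed-N : ∀ N π t → Any (N ∈ᴾ_) (listed N π t)
listed-N N π zero    = here (0 , ≤-refl , sym (+-identityʳ N))
listed-N N π (suc t) = ++⁺ˡ (listed-N N π t)

listed-complete : ∀ N π k t → t < k → ∀ {p} → p ∈ᴾ π t → Any (p ∈ᴾ_) (listed N π k)
listed-complete N π (suc k) t t<k mem with m≤n⇒m<n∨m≡n (≤-pred t<k)
... | inj₁ t<k′ = ++⁺ˡ (listed-complete N π k t t<k′ mem)
... | inj₂ refl = ++⁺ʳ (listed N π k) (here mem)

encode-∷ʳ : ∀ L π → encode (L ++ [ π ]) ≡ ((encode L ++ [ first π ]) ++ [ difference π ]) ++ [ count π ]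
encode-∷ʳ L π = trans (concatMap-++ _ L [ π ])
  (trans (sym (++-assoc (encode L) [ first π ] (difference π ∷ count π ∷ [])))
         (sym (++-assoc (encode L ++ [ first π ]) [ difference π ] [ count π ])))

loadCellP minBody emitBody outP : Program
loadCellP =
  set 42 (ιE (reg 20) (reg 20) (reg 3)) ⨾
  set 30 (8 ⟦ reg 42 ⟧) ⨾ set 31 (9 ⟦ reg 42 ⟧) ⨾ set 32 (10 ⟦ reg 42 ⟧) ⨾
  set 33 (op sub (lit 1) (op sub (reg 2) (reg 30))) ⨾
  set 40 (op add (op sub (reg 2) (reg 30)) (op mul (reg 33) (reg 31))) ⨾
  set 41 (op add (op div (op sub (reg 30) (reg 32)) (reg 31)) (op sub (lit 1) (reg 33)))
minBody = loadCellP ⨾ branch (lt (lit 0) (reg 41)) (set 8 (minE (reg 8) (reg 40))) skip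
emitBody = loadCellP ⨾ emit (reg 40) ⨾ emit (reg 31) ⨾ emit (reg 41)
outP = set 20 (op sub (reg 0) (lit 1)) ⨾ set 8 (reg 2) ⨾ forLoop 3 (reg 1) minBody ⨾
  emit (reg 8) ⨾ emit (reg 2) ⨾ emit (lit 0) ⨾ emit (lit 1) ⨾ forLoop 3 (reg 1) emitBody

outTime : ℕ → ℕ
outTime lg = 4 + (2 + ((lg * (time minBody + 1 + 7) + 6) +
    (2 + (2 + (2 + (2 + (lg * (time emitBody + 1 + 7) + 6)))))))

module Out (model : Model) where
  open Model model
  open Table model

  module _ (s₀ : State) (r : ℕ) where
    progs : ℕ → Progression
    progs t = periodsOf N (tabs s₀ (ι r r t))

    record Outgoing (s : State) : Set where
      constructor outgoing
      field
        bds : D.Bounded 2 s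
        arr : arrays s ≡ arrays s₀
        o0  : regs s 0 ≡ n
        o1  : regs s 1 ≡ lg
        o2  : regs s 2 ≡ N
        o20 : regs s 20 ≡ r

    2≤Γ : ∀ {v} → v ≤ M → v ≤ M ^ 2
    2≤Γ v≤ = ≤-trans v≤ (subst (_≤ M ^ 2) (^-identityʳ M) (M^mono {1} {2} (s≤s z≤n)))

    outgoing-counter : ∀ {s v} → v ≤ M → Outgoing s → Outgoing (setReg 3 v s)
    outgoing-counter v≤ (outgoing b a p q u w) = outgoing (D.bounded-set 2 b 3 (2≤Γ v≤)) a p q u w

    lg<B : lg < B
    lg<B = ≤-<-trans lg≤M (subst (_< B) (^-identityʳ M) (^-monoʳ-< M (≤-trans (≤ᵇ⇒≤ 2 4 tt) 4≤M) {1}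
        {12} (≤ᵇ⇒≤ 2 12 tt)))

    module _ {s : State} (O : Outgoing s) {t : ℕ} (r3 : regs s 3 ≡ t) where
      open Outgoing O
      private
        s₁ = exec loadCellP s
        c = tabs s₀ (ι r r t)

      loaded : regs s₁ 40 ≡ first (progs t) × regs s₁ 31 ≡ difference (progs t) × regs s₁ 41 ≡ count (progs t)
      loaded = cong₂ (λ c N → first (periodsOf N c)) c≡ o2 , cong gap c≡ ,
          cong₂ (λ c N → count (periodsOf N c)) c≡ o2
        where
        ι′≡ : ∀ {x n′ l′ t′} → x ≡ r → n′ ≡ n → l′ ≡ lg → t′ ≡ t → (x * n′ + x) * (l′ + 1) + t′ ≡ ι r r t
        ι′≡ refl refl refl refl = refl
        c≡ : tabs s ((regs s 20 * regs s 0 + regs s 20) * (regs s 1 + 1) + regs s 3) ≡ c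
        c≡ = cong₂ (λ a i → cell (a 8 i) (a 9 i) (a 10 i)) arr (ι′≡ o20 o0 o1 r3)

    record MinSoFar (t : ℕ) (s : State) : Set where
      constructor minSoFar
      field
        out   : Outgoing s
        isMin : regs s 8 ≡ minOf N progs t
        quiet : output s ≡ []

    min-run : ∀ t s → t < lg → MinSoFar t s → regs s 3 ≡ t →
      Run B minBody s (time minBody) (λ s′ → regs s′ 3 ≡ t × MinSoFar (suc t) (setReg 3 (suc t) s′))
    min-run t s t<lg (minSoFar O m≡ q) r3 = run-weaken ≤-refl
      (λ { s′ (refl , bd) → after bd })
      (D.run-typed 2 minBody {s} (Outgoing.bds O))
      where
      open Outgoing O
      s₁ = exec loadCellP s
      s₂ = exec minBody s
      v = minˢ (regs s₁ 8) (regs s₁ 40)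
      b : Bool
      b = 0 <ᵇ regs s₁ 41
      keep : ∀ (P : State → Set) → P (setReg 8 v s₁) → P s₁ → P s₂
      keep P x y = if-elim P b (λ _ → x) (λ _ → y)
      min≡ : regs s₂ 8 ≡ minOf N progs (suc t)
      min≡ = step b (cong (0 <ᵇ_) (proj₂ (proj₂ (loaded O r3))))
        where
        step : ∀ b {b′} → b ≡ b′ → regs (if b then setReg 8 v s₁ else s₁) 8 ≡
            (if b′ then minˢ (minOf N progs t) (first (progs t)) else minOf N progs t)
        step true  refl = cong₂ minˢ m≡ (proj₁ (loaded O r3))
        step false refl = m≡
      after : D.Bounded 2 s₂ → regs s₂ 3 ≡ t × MinSoFar (suc t) (setReg 3 (suc t) s₂)
      after bd = keep (λ s → regs s 3 ≡ t) r3 r3 ,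
        minSoFar (outgoing-counter (≤-trans t<lg lg≤M)
            (outgoing bd (keep (λ s → arrays s ≡ arrays s₀) arr arr)
          (keep (λ s → regs s 0 ≡ n) o0 o0) (keep (λ s → regs s 1 ≡ lg) o1 o1) (keep (λ s → regs s 2 ≡ N) o2
              o2) (keep (λ s → regs s 20 ≡ r) o20 o20)))
          min≡ (keep (λ s → output s ≡ []) q q)

    record Emitted (p t : ℕ) (s : State) : Set where
      constructor emitted
      field
        out : Outgoing s
        log : output s ≡ p ∷ encode (listed N progs t)

    emit-run : ∀ p t s → t < lg → Emitted p t s → regs s 3 ≡ t →
      Run B emitBody s (time emitBody) (λ s′ → regs s′ 3 ≡ t × Emitted p (suc t) (setReg 3 (suc t) s′))
    emit-run p t s t<lg (emitted O log) r3 = run-weaken ≤-refl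
      (λ { s′ (refl , bd) → r3 , emitted (outgoing-counter (≤-trans t<lg lg≤M) (outgoing bd arr o0 o1 o2 o20))
        (trans (emitted≡ log (proj₁ L) (proj₁ (proj₂ L)) (proj₂ (proj₂ L)))
            (cong (p ∷_) (sym (encode-∷ʳ (listed N progs t) (progs t))))) })
      (D.run-typed 2 emitBody {s} (Outgoing.bds O))
      where
      open Outgoing O
      L = loaded O r3
      emitted≡ : ∀ {o o′ : List ℕ} {a a′ b b′ c c′ : ℕ} → o ≡ o′ → a ≡ a′ → b ≡ b′ → c ≡ c′ →
                 ((o ++ [ a ]) ++ [ b ]) ++ [ c ] ≡ ((o′ ++ [ a′ ]) ++ [ b′ ]) ++ [ c′ ]
      emitted≡ refl refl refl refl = refl

  out-run : ∀ s r → Inv s → suc r ≡ n →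
    Run B outP s (outTime lg) (λ s′ → output s′ ≡ minOf N (progs s r) lg ∷ encode (listed N (progs s r) lg))
  out-run s r I r+1 =
    run-seq (D.run-typed 2 (set 20 (op sub (reg 0) (lit 1))) {s} (inv-bounded I)) λ { s₁ (refl , b₁) →
    run-seq (D.run-typed 2 (set 8 (reg 2)) {s₁} b₁) λ { s₂ (refl , b₂) →
    run-seq (for-run (MinSoFar s r) lg (time minBody) (lg<B s r) (λ t s M → Outgoing.o1 (MinSoFar.out M) , tt)
      (min-run s r) s₂ (minSoFar (outgoing-counter s r z≤n (outgoing b₂ refl (Inv.reg-n I) (Inv.reg-lg I)
          (Inv.reg-N I) r≡)) (Inv.reg-N I) (Inv.silent I)))
      emit-phase } }
    where
    r≡ : regs s 0 ∸ 1 ≡ r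
    r≡ = trans (cong (_∸ 1) (Inv.reg-n I)) (cong (_∸ 1) (sym r+1))
    p = minOf N (progs s r) lg
    start : ∀ {o : List ℕ} {a a′ b b′ : ℕ} → o ≡ [] → a ≡ a′ → b ≡ b′ → (((o ++ [ a ]) ++ [ b ]) ++ [ 0 ]) ++
        [ 1 ] ≡ a′ ∷ b′ ∷ 0 ∷ 1 ∷ []
    start refl refl refl = refl
    emit-phase : ∀ s₃ → MinSoFar s r lg s₃ →
      Run B (emit (reg 8) ⨾ emit (reg 2) ⨾ emit (lit 0) ⨾ emit (lit 1) ⨾ forLoop 3 (reg 1) emitBody) s₃
        (2 + (2 + (2 + (2 + (lg * (time emitBody + 1 + 7) + 6))))) (λ s′ → output s′ ≡ p ∷ encode
            (listed N (progs s r) lg))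
    emit-phase s₃ (minSoFar (outgoing bds arr o0 o1 o2 o20) isMin quiet) =
      run-seq (run-exec (emit (reg 8)) s₃ tt) λ { s₄ refl →
      run-seq (run-exec (emit (reg 2)) s₄ tt) λ { s₅ refl →
      run-seq (run-exec (emit (lit 0)) s₅ tt) λ { s₆ refl →
      run-seq (run-exec (emit (lit 1)) s₆ tt) λ { s₇ refl →
      run-weaken ≤-refl (λ s₈ E → Emitted.log E)
        (for-run (Emitted s r p) lg (time emitBody) (lg<B s r) (λ t s E → Outgoing.o1 (Emitted.out E) , tt)
          (emit-run s r p) s₇
          (emitted (outgoing-counter s r z≤n
              (outgoing (record { boundedRegs = D.boundedRegs bds ; boundedArrays = D.boundedArrays bds })
              arr o0 o1 o2 o20))
            (start quiet isMin o2))) } } } }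

-- The running time

-- Bounds of the shape X · C are closed under loops: X takes the factor b, and 2 c + 12 absorbs the
-- c + 7 steps of each pass and the 5 + c steps outside.
loop-bound : ∀ {b c t X C} → 1 ≤ b → 1 ≤ X → t ≤ X * C → loopTime b c t ≤ b * X * (C + (c + c + 12))
loop-bound {b} {c} {t} {X} {C} b≥1 X≥1 t≤ = begin
  b * (t + c + 7) + (5 + c)          ≤⟨ +-monoʳ-≤ (b * (t + c + 7))
      (≤-trans (≤-reflexive (sym (*-identityˡ (5 + c)))) (*-monoˡ-≤ (5 + c) b≥1)) ⟩
  b * (t + c + 7) + b * (5 + c)      ≡⟨ *-distribˡ-+ b (t + c + 7) (5 + c) ⟨
  b * (t + c + 7 + (5 + c))          ≤⟨ *-monoʳ-≤ b (lia 3 (λ t c x → (t ≼ x) ∷ [] ⊢ˡ t ⊕ c ⊕ con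
      7 ⊕ (con 5 ⊕ c) ≼ x ⊕ (c ⊕ c ⊕ con 12)) t c (X * C) t≤) ⟩
  b * (X * C + (c + c + 12))         ≤⟨ *-monoʳ-≤ b
      (+-monoʳ-≤ (X * C) (≤-trans (≤-reflexive (sym (*-identityˡ _))) (*-monoˡ-≤ (c + c + 12) X≥1))) ⟩
  b * (X * C + X * (c + c + 12))     ≡⟨ cong (b *_) (*-distribˡ-+ X C (c + c + 12)) ⟨
  b * (X * (C + (c + c + 12)))       ≡⟨ *-assoc b X _ ⟨
  b * X * (C + (c + c + 12))         ∎
  where open ≤-Reasoning

init-bound : ∀ {n} C₁ C₂ C₃ → 1 ≤ n →
  5 + ((n * (C₁ + 1 + 7) + 6) + ((n * (C₂ + 1 + 7) + 6) + (5 + (2 + (3 + (n * (C₃ + 1 + 7) + 6)))))) ≤ n *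
      (C₁ + C₂ + C₃ + 60)
init-bound {n} C₁ C₂ C₃ n≥1 = subst₂ _≤_ (sym lhs) (sym rhs)
  (lia 4 (λ n p q r → (con 1 ≼ n) ∷ [] ⊢ˡ
    con 5 ⊕ ((p ⊕ 8 ⊛ n ⊕ con 6) ⊕ ((q ⊕ 8 ⊛ n ⊕ con 6) ⊕ (con 5 ⊕ (con 2 ⊕ (con 3 ⊕ (r ⊕ 8 ⊛ n ⊕ con 6))))))
        ≼ p ⊕ q ⊕ r ⊕ 60 ⊛ n)
    n (n * C₁) (n * C₂) (n * C₃) n≥1)
  where
  each : ∀ C → n * (C + 1 + 7) ≡ n * C + 8 * n
  each C = trans (cong (n *_) (+-assoc C 1 7)) (trans (*-distribˡ-+ n C 8) (cong (n * C +_) (*-comm n 8)))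
  lhs = cong₂ (λ a x → 5 + ((a + 6) + x)) (each C₁) (cong₂ (λ a b → (a + 6) + (5 + (2 + (3 + (b + 6)))))
      (each C₂) (each C₃))
  rhs : n * (C₁ + C₂ + C₃ + 60) ≡ n * C₁ + n * C₂ + n * C₃ + 60 * n
  rhs = trans (*-distribˡ-+ n (C₁ + C₂ + C₃) 60) (cong₂ _+_ (trans (*-distribˡ-+ n (C₁ + C₂) C₃)
      (cong (_+ n * C₃) (*-distribˡ-+ n C₁ C₂))) (*-comm n 60))

out-bound : ∀ {m} C₁ C₂ → 1 ≤ m →
  4 + (2 + ((m * (C₁ + 1 + 7) + 6) + (2 + (2 + (2 + (2 + (m * (C₂ + 1 + 7) + 6))))))) ≤ m * (C₁ + C₂ + 50)
out-bound {m} C₁ C₂ m≥1 = subst₂ _≤_ (sym lhs) (sym rhs)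
  (lia 3 (λ m p q → (con 1 ≼ m) ∷ [] ⊢ˡ
    con 4 ⊕ (con 2 ⊕ ((p ⊕ 8 ⊛ m ⊕ con 6) ⊕ (con 2 ⊕ (con 2 ⊕ (con 2 ⊕ (con 2 ⊕ (q ⊕ 8 ⊛ m ⊕ con 6))))))) ≼
        p ⊕ q ⊕ 50 ⊛ m)
    m (m * C₁) (m * C₂) m≥1)
  where
  each : ∀ C → m * (C + 1 + 7) ≡ m * C + 8 * m
  each C = trans (cong (m *_) (+-assoc C 1 7)) (trans (*-distribˡ-+ m C 8) (cong (m * C +_) (*-comm m 8)))
  lhs = cong₂ (λ a b → 4 + (2 + ((a + 6) + (2 + (2 + (2 + (2 + (b + 6)))))))) (each C₁) (each C₂)
  rhs : m * (C₁ + C₂ + 50) ≡ m * C₁ + m * C₂ + 50 * m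
  rhs = trans (*-distribˡ-+ m (C₁ + C₂) 50) (cong₂ _+_ (*-distribˡ-+ m C₁ C₂) (*-comm m 50))

-- The three inner loops add 1 + 1 + 12 each and the outer one, whose limit costs 3, adds 3 + 3 +
-- 12. The factor 4 stems from 2 n sums and from lg ≤ 2 g; the other lg is replaced by n.
table-bound : ∀ {n lg g} C → 1 ≤ n → 1 ≤ lg → lg ≤ n → lg ≤ 2 * g →
  loopTime (n + n) 3 (loopTime n 1 (loopTime lg 1 (loopTime lg 1 C))) ≤ (C + 14 + 14 + 14 + 18) * 4 * (n ^
      3 * g)
table-bound {n} {lg} {g} C n≥1 lg≥1 lg≤n lg≤2g = begin
  loopTime (n + n) 3 _                       ≤⟨ loop-bound {n + n} {3} (≤-trans n≥1 (m≤m+n n n))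
      (*-mono-≤ n≥1 lg*lg≥1)
                                                  (loop-bound {n} {1} n≥1 lg*lg≥1 (loop-bound {lg} {1} lg≥1
                                                      (*-mono-≤ lg≥1 (≤-refl {1})) (loop-bound {lg} {1} {C}
                                                      {1} lg≥1 ≤-refl (≤-reflexive (sym (*-identityˡ C)))))) ⟩
  (n + n) * (n * (lg * (lg * 1))) * C′       ≤⟨ *-monoˡ-≤ C′
      (*-monoʳ-≤ (n + n) (*-monoʳ-≤ n (*-mono-≤ lg≤n (≤-trans (≤-reflexive (*-identityʳ lg)) lg≤2g)))) ⟩
  (n + n) * (n * (n * (2 * g))) * C′         ≡⟨ rearrange n g C′ ⟩
  C′ * 4 * (n ^ 3 * g)                       ∎
  where
  open ≤-Reasoning
  C′ = C + 14 + 14 + 14 + 18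
  lg*lg≥1 : 1 ≤ lg * (lg * 1)
  lg*lg≥1 = *-mono-≤ lg≥1 (*-mono-≤ lg≥1 (≤-refl {1}))
  rearrange : ∀ n g C → (n + n) * (n * (n * (2 * g))) * C ≡ C * 4 * (n * (n * (n * 1)) * g)
  rearrange = solve-∀

linear-bound : ∀ {n m g} C → m ≤ n → 1 ≤ n → 1 ≤ g → m * C ≤ C * (n ^ 3 * g)
linear-bound {n} {m} {g} C m≤n n≥1 g≥1 = begin
  m * C             ≡⟨ *-comm m C ⟩
  C * m             ≤⟨ *-monoʳ-≤ C (≤-trans m≤n (begin
    n                   ≡⟨ *-identityʳ n ⟨
    n * 1               ≤⟨ *-monoʳ-≤ n (*-mono-≤ n≥1 (*-mono-≤ n≥1 (≤-refl {1}))) ⟩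
    n ^ 3               ≡⟨ *-identityʳ (n ^ 3) ⟨
    n ^ 3 * 1           ≤⟨ *-monoʳ-≤ (n ^ 3) g≥1 ⟩
    n ^ 3 * g           ∎)) ⟩
  C * (n ^ 3 * g)   ∎
  where open ≤-Reasoning

abstract
  -- Kept abstract because the constants are running times of whole programs, which should stay
  -- folded where the bound is used.
  total-bound : ∃ λ c → ∀ n lg g → 1 ≤ n → 1 ≤ lg → 1 ≤ g → lg ≤ n → lg ≤ 2 * g →
                initTime n + (tableTime n lg + outTime lg) ≤ c * (n ^ 3 * g)
  total-bound = c₁ + (c₂ + c₃) , λ n lg g n≥1 lg≥1 g≥1 lg≤n lg≤2g →
    let x = n ^ 3 * g in
    ≤-trans (+-mono-≤ (≤-trans (init-bound (time markBody) (time lenBody) (time powBody) n≥1)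
        (linear-bound c₁ ≤-refl n≥1 g≥1))
              (+-mono-≤ (table-bound (time blockP) n≥1 lg≥1 lg≤n lg≤2g)
                        (≤-trans (out-bound (time minBody) (time emitBody) lg≥1)
                            (linear-bound c₃ lg≤n n≥1 g≥1))))
      (≤-reflexive (trans (cong (c₁ * x +_) (sym (*-distribʳ-+ x c₂ c₃)))
          (sym (*-distribʳ-+ x c₁ (c₂ + c₃)))))
    where
    c₁ c₂ c₃ : ℕ
    c₁ = time markBody + time lenBody + time powBody + 60
    c₂ = (time blockP + 14 + 14 + 14 + 18) * 4
    c₃ = time minBody + time emitBody + 50

-- The exponent is at most 1 + log N, and 1 ≤ log N because N ≥ 2.
log-bound : ∀ {t N} → 2 ≤ N → 2 ^ t ≤ 2 * N → t ≤ 2 * ⌊log₂ N ⌋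
log-bound {t} {N} 2≤N le = begin
  t                      ≡⟨ ⌊log₂[2^n]⌋≡n t ⟨
  ⌊log₂ 2 ^ t ⌋          ≤⟨ ⌊log₂⌋-mono-≤ le ⟩
  ⌊log₂ 2 * N ⌋          ≡⟨ ⌊log₂[2*b]⌋≡1+⌊log₂b⌋ N {{>-nonZero (≤-trans (s≤s z≤n) 2≤N)}} ⟩
  1 + ⌊log₂ N ⌋          ≤⟨ +-monoˡ-≤ ⌊log₂ N ⌋ (⌊log₂⌋-mono-≤ 2≤N) ⟩
  ⌊log₂ N ⌋ + ⌊log₂ N ⌋  ≡⟨ cong (⌊log₂ N ⌋ +_) (+-identityʳ _) ⟨
  2 * ⌊log₂ N ⌋          ∎
  where open ≤-Reasoning

-- Unlike in `run-seq`, the time of the second program may depend on the intermediate state: the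
-- table phase is timed by the value of lg left in register 1.
run-then : ∀ {B P P′ s t T Q Q′} → Run B P s t Q →
           (∀ s′ → Q s′ → ∃ λ t′ → Run B P′ s′ t′ Q′ × t + t′ ≤ T) → Run B (P ⨾ P′) s T Q′
run-then (u , s′ , d , u≤t , q) f with f s′ q
... | t′ , (v , s″ , d′ , v≤t′ , q′) , t+t′≤T = u + v , s″ , seq d d′ , ≤-trans (+-mono-≤ u≤t v≤t′) t+t′≤T ,
    q′

-- The complete algorithm

periodsP : Program
periodsP = initP ⨾ tableP ⨾ outP

module Periods (model : Model) where
  open Model model
  open Table model
  open Loops model using (table-run)
  open Out model using (progs; out-run)

  record Answer (f : ℕ → ℕ) (s : State) : Set where
    field
      least       : ℕ
      found       : List Progression
      printed     : output s ≡ least ∷ encode found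
      least-valid : Periodic f N least
      least-least : ∀ p → Periodic f N p → least ≤ p
      sound       : ∀ p → Any (p ∈ᴾ_) found → Periodic f N p
      complete    : ∀ p → Periodic f N p → Any (p ∈ᴾ_) found

  answer-run : ∀ s r → Inv s → suc r ≡ n → Live r → len (W r) ≡ N → 2 ≤ N →
               Run B (tableP ⨾ outP) s (tableTime n lg + outTime lg) (Answer (at (W r)))
  answer-run s r I r+1 live refl 2≤N = run-seq (table-run s I) λ s₁ (I₁ , done) →
    run-weaken ≤-refl (λ s₂ out → answer s₁ I₁ (done r r live live) s₂ out) (out-run s₁ r I₁ r+1)
    where
    N≥1 : 1 ≤ N
    N≥1 = ≤-trans (s≤s z≤n) 2≤N
    answer : ∀ s₁ → Inv s₁ → Done r r s₁ → ∀ s₂ →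
             output s₂ ≡ minOf N (progs s₁ r) lg ∷ encode (listed N (progs s₁ r) lg) → Answer (at (W r)) s₂
    answer s₁ I₁ done s₂ out = record
      { printed     = out
      ; least-valid = minOf-periodic N≥1 π-sound lg ≤-refl
      ; least-least = λ p P → least (π-complete P)
      ; sound       = λ p → listed-sound N≥1 π-sound lg ≤-refl
      ; complete    = λ p P → listing (π-complete P) }
      where
      π = progs s₁ r
      R : ∀ t → t < lg → Rep (tabs s₁ (ι r r t)) (OvScale (W r) (W r) t)
      R t t< = rep-ov I₁ live live done t<
      π-sound : ∀ t → t < lg → ∀ {p} → p ∈ᴾ π t → Periodic (at (W r)) N p
      π-sound t t< = periodsOf-sound {t = t} 2≤N (R t t<)
      π-complete : ∀ {p} → Periodic (at (W r)) N p → p ≡ N ⊎ ∃ λ t → t < lg × p ∈ᴾ π t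
      π-complete {p} P@(p≥1 , p≤N , _) with m≤n⇒m<n∨m≡n p≤N
      ... | inj₂ e   = inj₁ e
      ... | inj₁ p<N with scale-exists lg (m<n⇒0<n∸m p<N) (≤-<-trans (m∸n≤m N p) N<2^lg)
      ...   | t , t< , sc = inj₂ (t , t< , periodsOf-complete {t = t} 2≤N (R t t<) (m+[n∸m]≡n p≤N)
          (m<n⇒0<n∸m p<N) P sc)
      least : ∀ {q} → q ≡ N ⊎ (∃ λ t → t < lg × q ∈ᴾ π t) → minOf N π lg ≤ q
      least (inj₁ refl)           = minOf-≤N N≥1 π-sound lg
      least (inj₂ (t , t< , mem)) = minOf-least N≥1 π-sound lg t t< mem
      listing : ∀ {p} → p ≡ N ⊎ (∃ λ t → t < lg × p ∈ᴾ π t) → Any (p ∈ᴾ_) (listed N π lg)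
      listing (inj₁ refl)           = listed-N N π lg
      listing (inj₂ (t , t< , mem)) = listed-complete N π lg t t< mem

module _ {k : ℕ} (G : SLP (suc k)) where
  open Words G

  code≡0 : ∀ a x → inputArrays G (3 + a) x ≡ 0
  code≡0 a x with x <? suc k
  ... | no _    = refl
  ... | yes x<n = go (G (fromℕ< x<n))
    where
    go : ∀ {i : Fin (suc k)} (π : Production i) → productionCode π (3 + a) ≡ 0
    go (letter _)     = refl
    go (pair _ _ _ _) = refl

  module _ (T : List Letter) (generates : G Generates T) (2≤T : 2 ≤ length T)
           (B : ℕ) (M²≤B : (suc k + len (W k)) ^ 2 ≤ B)
           (B≡ : ∀ m → Model.n m ≡ suc k → Model.N m ≡ len (W k) → Model.B m ≡ B) where
    private
      good = goodSource generates 2≤T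
      root = W-root generates 2≤T
      n = suc k
      N = len (W k)
      2≤N : 2 ≤ N
      2≤N = GoodSource.2≤N good
      module I = Init good B M²≤B

    fresh : I.Fresh (initial G)
    fresh = record
      { basic = record
          { n≡ = refl ; small = update-≤ {λ _ → 0} {i = 0} (λ _ → z≤n) (m≤m+n n N) ; isA₀ = refl ; isA₁ =
              refl ; isA₂ = refl
          ; zero₇ = code≡0 4 ; zero₈ = code≡0 5 ; zero₉ = code≡0 6 ; zero₁₀ = code≡0 7 ; silent = refl }
      ; empty₃ = code≡0 0 ; empty₄ = code≡0 1 ; empty₅ = code≡0 2 ; empty₆ = code≡0 3 }

    Correct : State → Set
    Correct s = ∃ λ p → ∃ λ L → output s ≡ p ∷ encode L × IsMinimalPeriodLength p T × RepresentsPeriods L T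

    correct : ∀ {model s} → Model.N model ≡ N → Periods.Answer model (at (W k)) s → Correct s
    correct refl A = least , found , printed , (toT least-valid , λ q Q → least-least q (fromT Q)) ,
      λ p → mk⇔ (λ a → toT (sound p a)) (λ P → complete p (fromT P))
      where
      open Periods.Answer A
      toT : ∀ {p} → Periodic (at (W k)) N p → IsPeriodLength p T
      toT {p} P = periodOf-periodLength (subst (λ X → Periodic (at X) (len X) p) root P)
      fromT : ∀ {p} → IsPeriodLength p T → Periodic (at (W k)) N p
      fromT {p} P = subst (λ X → Periodic (at X) (len X) p) (sym root) (periodLength-periodOf
          (≤-trans (s≤s z≤n) 2≤T) P)

    finish : ∀ {s} → I.Ready s → Run B (tableP ⨾ outP) s (tableTime n (regs s 1) + outTime (regs s 1)) Correct
    finish {s} ready = subst (λ b → Run b (tableP ⨾ outP) s (tableTime n (regs s 1) + outTime (regs s 1))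
        Correct) (B≡ model refl refl)
      (run-weaken ≤-refl (λ s′ → correct {model} refl)
        (Periods.answer-run model s k (I.ready-inv ready) refl (I.root-live ready) refl 2≤N))
      where
      model = I.readyModel ready

    lg≥1 : ∀ {s} → I.Ready s → 1 ≤ regs s 1
    lg≥1 {s} ready = go (regs s 1) (I.N<2^lg ready)
      where
      go : ∀ t → N < 2 ^ t → 1 ≤ t
      go zero    N<1 = ⊥-elim (<⇒≱ N<1 (≤-trans (s≤s z≤n) 2≤N))
      go (suc t) _   = s≤s z≤n

    periods-run : Run B periodsP (initial G) (proj₁ total-bound * (n ^ 3 * ⌊log₂ N ⌋)) Correct
    periods-run = run-then (I.init-run (initial G) fresh) λ s ready →
      tableTime n (regs s 1) + outTime (regs s 1) , finish ready ,
      proj₂ total-bound n (regs s 1) ⌊log₂ N ⌋ (s≤s z≤n) (lg≥1 ready) (⌊log₂⌋-mono-≤ 2≤N)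
        (I.Pow.lg≤ (I.Ready.pow ready)) (log-bound {regs s 1} {N} 2≤N (I.Pow.low (I.Ready.pow ready)))

-- Generic in the exponent, so that the two bounds are compared as unexpanded powers.
wordBound-≡ : ∀ w n T m → Model.n m ≡ n → Model.N m ≡ length T → Model.M m ^ w ≡ wordBound w n T
wordBound-≡ w n T m e f = cong₂ (λ a b → (a + b) ^ w) e f

wordBound-≥ : ∀ {w n N T} → 1 ≤ n → 2 ≤ w → N ≡ length T → (n + N) ^ 2 ≤ wordBound w n T
wordBound-≥ {w} {n} {N} n≥1 2≤w refl = ^-monoʳ-≤ (n + N) {{>-nonZero (m≤n⇒m≤n+o N n≥1)}} 2≤w

mainTheorem4 : ∃ λ (P : Program) → ∃ λ (w : ℕ) → ∃ λ (c : ℕ) →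
    ∀ (k : ℕ) (G : SLP (suc k)) (T : List Letter) →
    G Generates T → 2 ≤ length T →
    ∃ λ (p : ℕ) → ∃ λ (L : List Progression) →
    ∃ λ (t : ℕ) → ∃ λ (s : State) →
    wordBound w (suc k) T ⊢ P , initial G ⇓[ t ] s ×
    output s ≡ p ∷ encode L ×
    IsMinimalPeriodLength p T ×
    RepresentsPeriods L T ×
    t ≤ c * (suc k ^ 3 * ⌊log₂ length T ⌋)
mainTheorem4 = periodsP , 12 , proj₁ total-bound , λ k G T generates 2≤T →
  let N≡ = cong len (Words.W-root G generates 2≤T)
      (t , s , d , t≤ , p , L , out , minimal , represents) =
        periods-run G T generates 2≤T (wordBound 12 (suc k) T)
          (wordBound-≥ {12} {suc k} {len (Words.W G k)} {T} (s≤s z≤n) (≤ᵇ⇒≤ 2 12 tt) N≡)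
          (λ m e f → wordBound-≡ 12 (suc k) T m e (trans f N≡))
  in p , L , t , s , d , out , minimal , represents ,
     subst (λ N → t ≤ proj₁ total-bound * (suc k ^ 3 * ⌊log₂ N ⌋)) N≡ t≤
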